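{- Let $H$ be a connected hypergraph and let $f\in\mathcal V_p(H)$ with $p\ge1$ satisfy $f_1(v)+\cdots+f_p(v)\ge d_H(v)$ for all $v\in V(H)$. Then there is an $f$-partition $(H_1,\dots,H_p)$ of $H$ such that $d_{H_i}(v)\le f_i(v)$ for all $v\in V(H_i)$ and all $i\in\{1,\dots,p\}$ if and only if $(H,f)$ is not a hard pair.
   Context: A hypergraph $H=(V,E,i)$ consists of finite sets $V(H)$, $E(H)$ and an incidence function $i_H:E\to 2^V$ with $|i(e)|\ge 2$ (parallel edges allowed; edges with $|i(e)|=2$ are ordinary). $H[X]$ is the subhypergraph with vertex set $X$ and edges $e$ with $i_H(e)\subseteq X$ (induced subhypergraph). The degree $d_G(v)$ is the number of edges of $G$ incident with $v$. $H$ is connected if nonempty and for every $\emptyset\ne X\subsetneq V(H)$ some edge meets both $X$ and its complement. A vertex $v$ is separating if $H$ is the union of two induced subhypergraphs $H_1,H_2$ with $V(H_1)\cap V(H_2)=\{v\}$, $|V(H_i)|\ge2$; a block is a maximal connected subhypergraph without separating vertex. For $h:V(H)\to\mathbb N_0$, $H$ is strictly $h$-degenerate if every nonempty subhypergraph $G$ has a vertex $v$ with $d_G(v)<h(v)$. $\mathcal V_p(H)$ is the set of $f=(f_1,\dots,f_p):V(H)\to\mathbb N_0^p$. An $f$-partition is a sequence $(H_1,\dots,H_p)$ of pairwise vertex-disjoint, possibly empty, induced subhypergraphs covering $V(H)$ with each $H_i$ strictly $f_i$-degenerate. $tK_n$: $n$ vertices, each pair joined by exactly $t$ parallel ordinary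 edges, no other edges; $tC_n$ ($n\ge3$): cycle of length $n$ with each edge replaced by $t$ parallel ordinary edges. Merging disjoint $H^1,H^2$ at $v^1\in V(H^1),v^2\in V(H^2)$: identify $v^1,v^2$ to a new vertex $v^*$, keeping all edges. $(H,f)$ with $H$ connected is a hard pair if: (M) $H$ is a block and for some $j$, $f_j(v)=d_H(v)$ and $f_i(v)=0$ for $i\ne j$, all $v$; or (K) $H=tK_n$, $t\ge1,n\ge3$, and $f(v)=(tn_1,\dots,tn_p)$ for all $v$, with integers $n_i\ge0$, at least two nonzero, $\sum n_i=n-1$; or (C) $H=tC_n$, $t\ge1$, $n\ge5$ odd, and for some $k\ne\ell$, $f_k\equiv f_\ell\equiv t$ and all other coordinates $\equiv0$; or (merge) $(H,f)$ arises from hard pairs $(H^1,f^1),(H^2,f^2)$ by merging $v^1,v^2$ to $v^*$ with $f=f^j$ on $V(H^j)\setminus\{v^j\}$ and $f(v^*)=f^1(v^1)+f^2(v^2)$. -}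

module Defs where

open import Data.Nat using (ℕ; zero; suc; _+_; _*_; _∸_; _≤_; _<_; pred)
open import Data.Bool using (Bool; true; false; _∧_; if_then_else_)
import Data.Bool as Bool
open import Data.Fin using (Fin; zero; suc; toℕ; splitAt; punchIn; inject+; _≟_)
open import Data.Fin.Subset using (Subset; _∈_; _∉_; _⊆_; _∩_; _∪_; ⁅_⁆; ∣_∣; Nonempty; Empty)
open import Data.Fin.Subset.Properties using (_⊆?_)
open import Data.Fin.Permutation using (Permutation; Permutation′; _⟨$⟩ʳ_)
open import Data.Vec using (Vec; lookup; tabulate; sum)
open import Data.Vec.Properties using (≡-dec)
open import Data.Sum using (_⊎_; inj₁; inj₂)
open import Data.Product using (Σ; ∃; ∃-syntax; _×_; _,_)
open import Relation.Nullary using (¬_; Dec; yes; no)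
open import Relation.Nullary.Decidable using (⌊_⌋)
open import Relation.Binary.PropositionalEquality using (_≡_; _≢_)

-- Hypergraphs.  Vertices are Fin nV, edges are Fin nE (so parallel
-- edges are allowed), and the incidence function i : E → 2^V sends each
-- edge to a subset of the vertices.

record PreHypergraph : Set where
  field
    nV  : ℕ
    nE  : ℕ
    inc : Fin nE → Subset nV
open PreHypergraph public

IsHypergraph : PreHypergraph → Set
IsHypergraph H = ∀ (e : Fin (nE H)) → 2 ≤ ∣ inc H e ∣

incidentTo : (H : PreHypergraph) → Fin (nV H) → Subset (nE H)
incidentTo H v = tabulate (λ e → lookup (inc H e) v)

deg : (H : PreHypergraph) → Subset (nE H) → Fin (nV H) → ℕ
deg H F v = ∣ F ∩ incidentTo H v ∣

inducedEdges : (H : PreHypergraph) → Subset (nV H) → Subset (nE H)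
inducedEdges H X = tabulate (λ e → ⌊ inc H e ⊆? X ⌋)

degH : (H : PreHypergraph) → Fin (nV H) → ℕ
degH H v = ∣ incidentTo H v ∣

Connected : PreHypergraph → Set
Connected H =
  1 ≤ nV H ×
  (∀ (X : Subset (nV H)) → Nonempty X → (∃[ w ] w ∉ X) →
     ∃[ e ] ((∃[ u ] (u ∈ inc H e × u ∈ X)) × (∃[ u ] (u ∈ inc H e × u ∉ X))))

-- v is a separating vertex: H is the union of two induced
-- subhypergraphs H[X₁], H[X₂] with X₁ ∩ X₂ = {v}, |X₁|,|X₂| ≥ 2
Separating : (H : PreHypergraph) → Fin (nV H) → Set
Separating H v =
  ∃[ X₁ ] ∃[ X₂ ]
    ((∀ u → u ∈ X₁ ⊎ u ∈ X₂) ×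
     (X₁ ∩ X₂ ≡ ⁅ v ⁆) ×
     2 ≤ ∣ X₁ ∣ × 2 ≤ ∣ X₂ ∣ ×
     (∀ e → inc H e ⊆ X₁ ⊎ inc H e ⊆ X₂))

IsBlock : PreHypergraph → Set
IsBlock H = Connected H × (∀ v → ¬ Separating H v)

-- strict h-degeneracy of the induced subhypergraph H[X]: every nonempty
-- subhypergraph G = (Y, F) of H[X] has a vertex v with d_G(v) < h(v)
StrictlyDegenerate : (H : PreHypergraph) → Subset (nV H) → (Fin (nV H) → ℕ) → Set
StrictlyDegenerate H X h =
  ∀ (Y : Subset (nV H)) (F : Subset (nE H)) →
    Y ⊆ X → Nonempty Y → (∀ e → e ∈ F → inc H e ⊆ Y) →
    ∃[ v ] (v ∈ Y × deg H F v < h v)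

VecFun : (H : PreHypergraph) → ℕ → Set
VecFun H p = Fin (nV H) → Fin p → ℕ

-- (P 1, ..., P p) are the vertex sets of a sequence of pairwise disjoint,
-- covering induced subhypergraphs H[P i]
IsVertexPartition : ∀ {n p} → (Fin p → Subset n) → Set
IsVertexPartition {n} {p} P =
  (∀ i j → i ≢ j → Empty (P i ∩ P j)) × (∀ (v : Fin n) → ∃[ i ] v ∈ P i)

IsFPartition : ∀ {p} (H : PreHypergraph) → VecFun H p → (Fin p → Subset (nV H)) → Set
IsFPartition H f P =
  IsVertexPartition P × (∀ i → StrictlyDegenerate H (P i) (λ v → f v i))

_≟ₛ_ : ∀ {n} (X Y : Subset n) → Dec (X ≡ Y)
_≟ₛ_ = ≡-dec Bool._≟_

joinCount : (H : PreHypergraph) → Fin (nV H) → Fin (nV H) → ℕ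
joinCount H u v = ∣ tabulate (λ e → ⌊ inc H e ≟ₛ (⁅ u ⁆ ∪ ⁅ v ⁆) ⌋) ∣

Ordinary : (H : PreHypergraph) → Fin (nE H) → Set
Ordinary H e = ∃[ u ] ∃[ v ] (u ≢ v × inc H e ≡ ⁅ u ⁆ ∪ ⁅ v ⁆)

IsTK : ℕ → PreHypergraph → Set
IsTK t H =
  (∀ e → Ordinary H e) × (∀ u v → u ≢ v → joinCount H u v ≡ t)

NextCyc : ∀ {n} → Fin n → Fin n → Set
NextCyc {n} i j = (suc (toℕ i) ≡ toℕ j) ⊎ (suc (toℕ i) ≡ n × toℕ j ≡ 0)

IsTC : ℕ → PreHypergraph → Set
IsTC t H =
  Σ (Permutation′ (nV H)) λ σ →
    (∀ e → ∃[ i ] ∃[ j ] (NextCyc i j × inc H e ≡ ⁅ σ ⟨$⟩ʳ i ⁆ ∪ ⁅ σ ⟨$⟩ʳ j ⁆)) ×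
    (∀ i j → NextCyc i j → joinCount H (σ ⟨$⟩ʳ i) (σ ⟨$⟩ʳ j) ≡ t)

-- Merging H¹ and H² at v¹ ∈ V(H¹), v² ∈ V(H²).
-- New vertex set Fin (n₁ + (n₂ - 1)): the first n₁ vertices are those of
-- H¹ (v¹ playing the role of v*), the remaining ones are V(H²) ∖ {v²}
-- (via punchIn v²).  New edge set Fin (m₁ + m₂).

mergeInc₁ : ∀ {n₁} n₂ → Subset n₁ → Subset (n₁ + pred n₂)
mergeInc₁ {n₁} n₂ S = tabulate λ u → g (splitAt n₁ u)
  where
  g : Fin n₁ ⊎ Fin (pred n₂) → Bool
  g (inj₁ a) = lookup S a
  g (inj₂ b) = false

mergeInc₂ : ∀ {n₁ n₂} → Fin n₁ → Fin n₂ → Subset n₂ → Subset (n₁ + pred n₂)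
mergeInc₂ {n₁} {suc k} v₁ v₂ S = tabulate λ u → g (splitAt n₁ u)
  where
  g : Fin n₁ ⊎ Fin k → Bool
  g (inj₁ a) = ⌊ a ≟ v₁ ⌋ ∧ lookup S v₂
  g (inj₂ b) = lookup S (punchIn v₂ b)

mergeHG : (H₁ H₂ : PreHypergraph) → Fin (nV H₁) → Fin (nV H₂) → PreHypergraph
mergeHG H₁ H₂ v₁ v₂ = record
  { nV  = nV H₁ + pred (nV H₂)
  ; nE  = nE H₁ + nE H₂
  ; inc = λ e → g (splitAt (nE H₁) e)
  }
  where
  g : Fin (nE H₁) ⊎ Fin (nE H₂) → Subset (nV H₁ + pred (nV H₂))
  g (inj₁ e) = mergeInc₁ (nV H₂) (inc H₁ e)
  g (inj₂ e) = mergeInc₂ v₁ v₂ (inc H₂ e)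

_+ᵥ_ : ∀ {p} → (Fin p → ℕ) → (Fin p → ℕ) → Fin p → ℕ
(x +ᵥ y) i = x i + y i

mergeF : ∀ {p n₁ n₂} → (Fin n₁ → Fin p → ℕ) → (Fin n₂ → Fin p → ℕ) →
         Fin n₁ → Fin n₂ → Fin (n₁ + pred n₂) → Fin p → ℕ
mergeF {p} {n₁} {suc k} f₁ f₂ v₁ v₂ u = g (splitAt n₁ u)
  where
  g : Fin n₁ ⊎ Fin k → Fin p → ℕ
  g (inj₁ a) with a ≟ v₁
  ... | yes _ = f₁ v₁ +ᵥ f₂ v₂
  ... | no _  = f₁ a
  g (inj₂ b) = f₂ (punchIn v₂ b)

record Iso (H H' : PreHypergraph) : Set where
  field
    φ   : Permutation (nV H) (nV H')
    ψ   : Permutation (nE H) (nE H')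
    pres : ∀ e v → lookup (inc H e) v ≡ lookup (inc H' (ψ ⟨$⟩ʳ e)) (φ ⟨$⟩ʳ v)

data HardPair {p : ℕ} : (H : PreHypergraph) → VecFun H p → Set where
  hardM : ∀ {H f} → IsHypergraph H → IsBlock H → (j : Fin p) →
          (∀ v → f v j ≡ degH H v) → (∀ v i → i ≢ j → f v i ≡ 0) →
          HardPair H f
  hardK : ∀ {H f} (t : ℕ) → 1 ≤ t → 3 ≤ nV H → IsTK t H →
          (ns : Fin p → ℕ) →
          (∃[ i ] ∃[ j ] (i ≢ j × ns i ≢ 0 × ns j ≢ 0)) →
          sum (tabulate ns) ≡ nV H ∸ 1 →
          (∀ v i → f v i ≡ t * ns i) →
          HardPair H f
  hardC : ∀ {H f} (t : ℕ) → 1 ≤ t → 5 ≤ nV H → (∃[ k ] nV H ≡ suc (2 * k)) →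
          IsTC t H →
          (k ℓ : Fin p) → k ≢ ℓ →
          (∀ v → f v k ≡ t) → (∀ v → f v ℓ ≡ t) →
          (∀ v i → i ≢ k → i ≢ ℓ → f v i ≡ 0) →
          HardPair H f
  hardMerge : ∀ {H f} (H₁ H₂ : PreHypergraph) (f₁ : VecFun H₁ p) (f₂ : VecFun H₂ p)
              (v₁ : Fin (nV H₁)) (v₂ : Fin (nV H₂)) →
              HardPair H₁ f₁ → HardPair H₂ f₂ →
              (ι : Iso H (mergeHG H₁ H₂ v₁ v₂)) →
              (∀ v i → f v i ≡ mergeF f₁ f₂ v₁ v₂ (Iso.φ ι ⟨$⟩ʳ v) i) →
              HardPair H f

{-# OPTIONS --safe #-}

-- A colouring c : V → Fin p is good when each class i is strictly fᵢ-degenerate.  If there is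
-- no good colouring then, for every z, greedy colouring towards z still colours V ∖ {z}, and
-- tightness forces this configuration with hole z to be rigid: each edge at z is monochromatic
-- apart from z, and exactly fᵢ(z) of these edges have colour i.  The hole can slide along any
-- edge, so two configurations with the same hole yield identities between edge multiplicities.
-- In a block where some f(z) has two nonzero entries, take a shortest path avoiding a hole
-- between two differently coloured neighbours of it.  If the path is a single step, the
-- resulting triangle grows to a clique with constant multiplicity that exhausts the block;
-- otherwise rotating the hole around the cycle shows that it is odd, alternately coloured and
-- exhausts the block.  At a separating vertex v, the colours of the edges at a hole v
-- distribute f(v) over the two sides, both of which again have no good colouring.
-- Finally a good colouring satisfies the degree bound once the number of monochromatic edges
-- minus Σ_v f_{c(v)}(v) cannot be lowered by recolouring a vertex.
module Submission where

open import Defs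
open import Data.Bool using (Bool; true; false; _∧_)
open import Data.Empty using (⊥; ⊥-elim)
open import Data.Fin using (Fin; zero; suc; toℕ; fromℕ<; _↑ˡ_; _↑ʳ_; splitAt; join; punchIn; punchOut) renaming (_≟_ to _≟F_)
open import Data.Fin.Permutation using (Permutation; Permutation′; permutation; _⟨$⟩ʳ_; _⟨$⟩ˡ_; inverseˡ; inverseʳ; flip; ↔⇒≡)
open import Data.Fin.Properties using (any?; all?; toℕ<n; toℕ-injective; toℕ-fromℕ<; fromℕ<-injective; injective⇒≤;
  splitAt-↑ˡ; splitAt-↑ʳ; splitAt⁻¹-↑ˡ; splitAt⁻¹-↑ʳ; splitAt-join; join-splitAt; ↑ˡ-injective; ↑ʳ-injective;
  punchIn-injective; punchIn-punchOut; punchInᵢ≢i)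
open import Data.Fin.Subset using (Subset; _∈_; _∉_; _⊆_; _∩_; _∪_; ⁅_⁆; ∣_∣; Nonempty; Empty; inside; outside) renaming (⊥ to ∅)
open import Data.Fin.Subset.Properties using (_∈?_; _⊆?_; x∈p∩q⁺; x∈p∩q⁻; x∈⁅x⁆; x∈⁅y⁆⇒x≡y; x∈p∪q⁻; x∈p∪q⁺; ⊆-antisym; ∉⊥; ∪-comm; anySubset?; nonempty?)
open import Data.Nat using (ℕ; zero; suc; _+_; _*_; _∸_; _≤_; _<_; z≤n; s≤s)
open import Data.Nat.DivMod using (_%_; _/_; m%n<n; m≡m%n+[m/n]*n)
open import Data.Nat.Properties
open import Data.Nat.Solver using (module +-*-Solver)
open import Data.Product using (∃; ∃-syntax; _×_; _,_; proj₁; proj₂)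
open import Data.Sum using (_⊎_; inj₁; inj₂) renaming (map to ⊎-map; swap to ⊎-swap)
open import Data.Unit using (⊤; tt)
open import Data.Vec using (Vec; []; _∷_; lookup; tabulate; sum; there)
open import Data.Vec.Properties using (lookup∘tabulate; []=⇒lookup; lookup⇒[]=)
open import Function using (_∘_; id)
open import Function.Bundles using (_⇔_; mk⇔)
open import Relation.Binary.Definitions using (tri<; tri≈; tri>)
open import Relation.Binary.PropositionalEquality using (_≡_; _≢_; refl; sym; trans; cong; cong₂; subst; subst₂; module ≡-Reasoning)
open import Relation.Nullary using (¬_; Dec; yes; no)
open import Relation.Nullary.Decidable using (⌊_⌋; _×-dec_; _⊎-dec_; _→-dec_; ¬?; map′; decidable-stable)
open import Relation.Unary using (Decidable)
open import Algebra.Properties.CommutativeMonoid.Sum +-0-commutativeMonoid using (∑-distrib-+; ∑-comm; ∑-permute; sum-cong-≗) renaming (sum to sumₘ)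

-- Counting over finite sets

-- The main direction is argued under double negation. Nothing decides which vertices a walk
-- reaches, whether some vertex separates, or which path length is least, so these distinctions are
-- made by continuations into `⊥`. The theorem supplies a negation, `¬ HardPair`, so refuting the
-- absence of a partition is enough; the partition itself comes from an exhaustive search over
-- colourings.
--
-- The identities between multiplicities have one source: at a common hole, two configurations show
-- each colour on equally many edges. When, among the neighbours of the hole, they differ only by
-- exchanging the colours of two vertices, those two have equal codegree with the hole and the edges
-- involved are ordinary. The difficulty is to produce such pairs. Rotating the hole around a closed
-- walk returns it to its place with permuted colours. Carrying both configurations along one path
-- then moves the comparison to a hole far away. The second device is what controls the rest of the
-- block, because absence of separating vertices says only that an outside component attaches
-- somewhere else, not where.

private
  variable
    m n : ℕ

opaque

  ∑ : (Fin n → ℕ) → ℕ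
  ∑ = sumₘ

  ∑-[] : (x : Fin 0 → ℕ) → ∑ x ≡ 0
  ∑-[] x = refl

  ∑-∷ : (x : Fin (suc n) → ℕ) → ∑ x ≡ x zero + ∑ (x ∘ suc)
  ∑-∷ x = refl

  ∑-cong : {x y : Fin n → ℕ} → (∀ i → x i ≡ y i) → ∑ x ≡ ∑ y
  ∑-cong = sum-cong-≗

  ∑-+ : (x y : Fin n → ℕ) → ∑ (λ i → x i + y i) ≡ ∑ x + ∑ y
  ∑-+ = ∑-distrib-+

  ∑-swap : (x : Fin m → Fin n → ℕ) → ∑ (λ i → ∑ (x i)) ≡ ∑ (λ j → ∑ (λ i → x i j))
  ∑-swap = ∑-comm

  ∑-reindex : (x : Fin n → ℕ) (π : Permutation m n) → ∑ x ≡ ∑ (x ∘ (π ⟨$⟩ʳ_))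
  ∑-reindex = ∑-permute

  ∑-mono : {x y : Fin n → ℕ} → (∀ i → x i ≤ y i) → ∑ x ≤ ∑ y
  ∑-mono {zero} x≤y = z≤n
  ∑-mono {suc n} x≤y = +-mono-≤ (x≤y zero) (∑-mono (x≤y ∘ suc))

  ∑-mono-< : {x y : Fin n → ℕ} → (∀ i → x i ≤ y i) → ∀ j → x j < y j → ∑ x < ∑ y
  ∑-mono-< x≤y zero xj<yj = +-mono-<-≤ xj<yj (∑-mono (x≤y ∘ suc))
  ∑-mono-< x≤y (suc j) xj<yj = +-mono-≤-< (x≤y zero) (∑-mono-< (x≤y ∘ suc) j xj<yj)

  -- This turns one tight inequality between totals into an equality for every colour.
  ∑-squeeze : {x y : Fin n → ℕ} → (∀ i → x i ≤ y i) → ∑ y ≤ ∑ x → ∀ i → x i ≡ y i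
  ∑-squeeze {x = x} {y} x≤y ∑y≤∑x i with m≤n⇒m<n∨m≡n (x≤y i)
  ... | inj₁ xi<yi = ⊥-elim (<⇒≱ (∑-mono-< x≤y i xi<yi) ∑y≤∑x)
  ... | inj₂ xi≡yi = xi≡yi

  ∑-find-< : {x y : Fin n → ℕ} → ∑ x < ∑ y → ∃[ i ] x i < y i
  ∑-find-< {n} {x} {y} ∑x<∑y with any? (λ i → x i <? y i)
  ... | yes p = p
  ... | no ¬p = ⊥-elim (<⇒≱ ∑x<∑y (∑-mono (λ i → ≮⇒≥ (λ lt → ¬p (i , lt)))))

  ∑-zero : {x : Fin n → ℕ} → (∀ i → x i ≡ 0) → ∑ x ≡ 0
  ∑-zero {zero} x≡0 = refl
  ∑-zero {suc n} x≡0 = cong₂ _+_ (x≡0 zero) (∑-zero (x≡0 ∘ suc))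

  ∑-single : {x : Fin n → ℕ} (j : Fin n) → (∀ i → i ≢ j → x i ≡ 0) → ∑ x ≡ x j
  ∑-single {suc n} {x} zero x≡0 =
    trans (cong (x zero +_) (∑-zero (λ i → x≡0 (suc i) (λ ())))) (+-identityʳ _)
  ∑-single {suc n} {x} (suc j) x≡0 =
    cong₂ _+_ (x≡0 zero (λ ())) (∑-single j (λ i i≢j → x≡0 (suc i) (λ { refl → i≢j refl })))

  ≤-∑ : (x : Fin n → ℕ) (j : Fin n) → x j ≤ ∑ x
  ≤-∑ x zero = m≤m+n _ _
  ≤-∑ x (suc j) = ≤-trans (≤-∑ (x ∘ suc) j) (m≤n+m _ _)

  sum-tabulate : (x : Fin n → ℕ) → sum (tabulate x) ≡ ∑ x
  sum-tabulate {zero} x = refl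
  sum-tabulate {suc n} x = cong (x zero +_) (sum-tabulate (x ∘ suc))

  ∑-↑ : (x : Fin (m + n) → ℕ) → ∑ x ≡ ∑ (λ i → x (i ↑ˡ n)) + ∑ (λ j → x (m ↑ʳ j))
  ∑-↑ {zero} x = refl
  ∑-↑ {suc m} x = trans (cong (x zero +_) (∑-↑ {m} (x ∘ suc))) (sym (+-assoc (x zero) _ _))

χ : {A : Set} → Dec A → ℕ
χ (yes _) = 1
χ (no _) = 0

χ-yes : {A : Set} (A? : Dec A) → A → χ A? ≡ 1
χ-yes (yes _) a = refl
χ-yes (no ¬a) a = ⊥-elim (¬a a)

χ-no : {A : Set} (A? : Dec A) → ¬ A → χ A? ≡ 0
χ-no (yes a) ¬a = ⊥-elim (¬a a)
χ-no (no _) ¬a = refl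

χ-mono : {A B : Set} (A? : Dec A) (B? : Dec B) → (A → B) → χ A? ≤ χ B?
χ-mono (yes a) B? f = ≤-reflexive (sym (χ-yes B? (f a)))
χ-mono (no _) B? f = z≤n

# : {P : Fin n → Set} → Decidable P → ℕ
# P? = ∑ (λ i → χ (P? i))

module _ {P Q : Fin n → Set} (P? : Decidable P) (Q? : Decidable Q) where

  #-mono : (∀ i → P i → Q i) → # P? ≤ # Q?
  #-mono P⇒Q = ∑-mono (λ i → χ-mono (P? i) (Q? i) (P⇒Q i))

  #-mono-< : (∀ i → P i → Q i) → ∀ j → Q j → ¬ P j → # P? < # Q?
  #-mono-< P⇒Q j Qj ¬Pj = ∑-mono-< (λ i → χ-mono (P? i) (Q? i) (P⇒Q i)) j
    (≤-reflexive (trans (cong suc (χ-no (P? j) ¬Pj)) (sym (χ-yes (Q? j) Qj))))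

  #-split : # P? ≡ # (λ i → P? i ×-dec Q? i) + # (λ i → P? i ×-dec ¬? (Q? i))
  #-split = trans (∑-cong (λ i → lemma (P? i) (Q? i))) (∑-+ _ _)
    where
    lemma : {A B : Set} (A? : Dec A) (B? : Dec B) → χ A? ≡ χ (A? ×-dec B?) + χ (A? ×-dec ¬? B?)
    lemma (yes _) (yes _) = refl
    lemma (yes _) (no _) = refl
    lemma (no _) (yes _) = refl
    lemma (no _) (no _) = refl

module _ {P Q : Fin n → Set} (P? : Decidable P) (Q? : Decidable Q) where

  #-cong : (∀ i → P i → Q i) → (∀ i → Q i → P i) → # P? ≡ # Q?
  #-cong P⇒Q Q⇒P = ≤-antisym (#-mono P? Q? P⇒Q) (#-mono Q? P? Q⇒P)

  #-squeeze : (∀ i → P i → Q i) → # Q? ≤ # P? → ∀ i → Q i → P i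
  #-squeeze P⇒Q #Q≤#P i Qi with P? i
  ... | yes Pi = Pi
  ... | no ¬Pi = ⊥-elim (<⇒≱ (#-mono-< P? Q? P⇒Q i Qi ¬Pi) #Q≤#P)

#-none : {P : Fin n → Set} (P? : Decidable P) → (∀ i → ¬ P i) → # P? ≡ 0
#-none P? ¬P = ∑-zero (λ i → χ-no (P? i) (¬P i))

#-some : {P : Fin n → Set} (P? : Decidable P) → ∀ i → P i → 0 < # P?
#-some P? i Pi = ≤-trans (≤-reflexive (sym (χ-yes (P? i) Pi))) (≤-∑ (λ j → χ (P? j)) i)

#-find : {P : Fin n → Set} (P? : Decidable P) → 0 < # P? → ∃ P
#-find P? 0<#P with any? P?
... | yes p = p
... | no ¬p = ⊥-elim (<⇒≢ 0<#P (sym (#-none P? (λ i Pi → ¬p (i , Pi)))))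

#-singleton : {P : Fin n → Set} (P? : Decidable P) (j : Fin n) → (∀ i → P i → i ≡ j) → # P? ≡ χ (P? j)
#-singleton P? j P⇒≡ = ∑-single j (λ i i≢j → χ-no (P? i) (λ Pi → i≢j (P⇒≡ i Pi)))

#-remove : {P : Fin n → Set} (P? : Decidable P) (j : Fin n) →
           # P? ≡ χ (P? j) + # (λ i → P? i ×-dec ¬? (i ≟F j))
#-remove P? j = trans (#-split P? (_≟F j)) (cong (_+ # (λ i → P? i ×-dec ¬? (i ≟F j)))
  (trans (#-singleton (λ i → P? i ×-dec (i ≟F j)) j (λ i → proj₂))
    (≤-antisym (χ-mono (P? j ×-dec (j ≟F j)) (P? j) proj₁) (χ-mono (P? j) (P? j ×-dec (j ≟F j)) (λ Pj → Pj , refl)))))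

#-fibres : {P : Fin m → Set} (P? : Decidable P) (g : Fin m → Fin n) →
           ∑ (λ j → # (λ i → P? i ×-dec (g i ≟F j))) ≡ # P?
#-fibres P? g = trans (∑-swap (λ j i → χ (P? i ×-dec (g i ≟F j)))) (∑-cong (λ i →
  trans (∑-single (g i) (λ j j≢ → χ-no (P? i ×-dec (g i ≟F j)) (λ { (_ , refl) → j≢ refl })))
    (≤-antisym (χ-mono (P? i ×-dec (g i ≟F g i)) (P? i) proj₁) (χ-mono (P? i) (P? i ×-dec (g i ≟F g i)) (λ Pi → Pi , refl)))))

∑-χ* : {P : Fin n → Set} (P? : Decidable P) (t : ℕ) → ∑ (λ i → χ (P? i) * t) ≡ # P? * t
∑-χ* {zero} P? t = trans (∑-[] _) (sym (cong (_* t) (∑-[] _)))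
∑-χ* {suc n} P? t = trans (∑-∷ _) (trans (cong (χ (P? zero) * t +_) (∑-χ* (P? ∘ suc) t))
  (trans (sym (*-distribʳ-+ t (χ (P? zero)) _)) (cong (_* t) (sym (∑-∷ _)))))

#-all : {P : Fin n → Set} (P? : Decidable P) → (∀ i → P i) → # P? ≡ n
#-all {zero} P? allP = ∑-[] _
#-all {suc n} P? allP = trans (∑-∷ _) (cong₂ _+_ (χ-yes (P? zero) (allP zero)) (#-all (P? ∘ suc) (allP ∘ suc)))

⟪_⟫ : {P : Fin n → Set} → Decidable P → Subset n
⟪ P? ⟫ = tabulate (λ i → ⌊ P? i ⌋)

module _ {P : Fin n → Set} (P? : Decidable P) {i : Fin n} where

  ∈⟪⟫⁺ : P i → i ∈ ⟪ P? ⟫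
  ∈⟪⟫⁺ Pi = lookup⇒[]= i _ (trans (lookup∘tabulate _ i) (isYes-true (P? i)))
    where
    isYes-true : (d : Dec (P i)) → ⌊ d ⌋ ≡ true
    isYes-true (yes _) = refl
    isYes-true (no ¬Pi) = ⊥-elim (¬Pi Pi)

  ∈⟪⟫⁻ : i ∈ ⟪ P? ⟫ → P i
  ∈⟪⟫⁻ i∈ with P? i | trans (sym (lookup∘tabulate (λ i → ⌊ P? i ⌋) i)) ([]=⇒lookup i∈)
  ... | yes Pi | _ = Pi
  ... | no _ | ()

∣∣≡# : (X : Subset n) → ∣ X ∣ ≡ # (_∈? X)
∣∣≡# [] = sym (∑-[] _)
∣∣≡# (inside ∷ X) = trans (cong suc (trans (∣∣≡# X) (#-cong (_∈? X) (λ i → suc i ∈? (inside ∷ X)) (λ i → there) (λ { i (there p) → p })))) (sym (∑-∷ _))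
∣∣≡# (outside ∷ X) = trans (trans (∣∣≡# X) (#-cong (_∈? X) (λ i → suc i ∈? (outside ∷ X)) (λ i → there) (λ { i (there p) → p }))) (sym (∑-∷ _))

∣⟪⟫∣≡# : {P : Fin n → Set} (P? : Decidable P) → ∣ ⟪ P? ⟫ ∣ ≡ # P?
∣⟪⟫∣≡# P? = trans (∣∣≡# ⟪ P? ⟫) (#-cong (_∈? ⟪ P? ⟫) P? (λ _ → ∈⟪⟫⁻ P?) (λ _ → ∈⟪⟫⁺ P?))

#≥2 : {P : Fin n → Set} (P? : Decidable P) (u w : Fin n) → u ≢ w → P u → P w → 2 ≤ # P?
#≥2 P? u w u≢w Pu Pw = ≤-trans
  (+-mono-≤ (≤-reflexive (sym (χ-yes (P? u) Pu))) (#-some (λ i → P? i ×-dec ¬? (i ≟F u)) w (Pw , u≢w ∘ sym)))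
  (≤-reflexive (sym (#-remove P? u)))

#≥2⁻ : {P : Fin n → Set} (P? : Decidable P) → 2 ≤ # P? → ∀ u → ∃[ w ] (P w × w ≢ u)
#≥2⁻ P? 2≤ u = #-find (λ i → P? i ×-dec ¬? (i ≟F u)) (+-cancelˡ-≤ 1 _ _
  (≤-trans (≤-trans 2≤ (≤-reflexive (#-remove P? u))) (+-monoˡ-≤ _ (χ≤1 (P? u)))))
  where
  χ≤1 : {A : Set} (A? : Dec A) → χ A? ≤ 1
  χ≤1 (yes _) = ≤-refl
  χ≤1 (no _) = z≤n

¬¬-lem : {A : Set} → ((A ⊎ ¬ A) → ⊥) → ⊥
¬¬-lem f = f (inj₂ (λ a → f (inj₁ a)))

-- Excluded middle may be used finitely often when the goal is `⊥`. It lets reachability be treated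
-- as decidable there.
¬¬-dec : (P : Fin n → Set) → ((∀ i → Dec (P i)) → ⊥) → ⊥
¬¬-dec {zero} P f = f (λ ())
¬¬-dec {suc n} P f = ¬¬-lem λ
  { (inj₁ p) → ¬¬-dec (P ∘ suc) (λ d → f (λ { zero → yes p ; (suc i) → d i }))
  ; (inj₂ ¬p) → ¬¬-dec (P ∘ suc) (λ d → f (λ { zero → no ¬p ; (suc i) → d i })) }

-- Colourings with a hole

module _ (H : PreHypergraph) where

  dIn : Subset (nV H) → Fin (nV H) → ℕ
  dIn Y v = # (λ e → (v ∈? inc H e) ×-dec (inc H e ⊆? Y))

  ∈incident⁺ : ∀ {v e} → v ∈ inc H e → e ∈ incidentTo H v
  ∈incident⁺ {v} {e} v∈e = lookup⇒[]= e _ (trans (lookup∘tabulate _ e) ([]=⇒lookup v∈e))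

  ∈incident⁻ : ∀ {v e} → e ∈ incidentTo H v → v ∈ inc H e
  ∈incident⁻ {v} {e} e∈ = lookup⇒[]= v _ (trans (sym (lookup∘tabulate _ e)) ([]=⇒lookup e∈))

  degH≡# : ∀ v → degH H v ≡ # (λ e → v ∈? inc H e)
  degH≡# v = trans (∣∣≡# (incidentTo H v)) (#-cong (_∈? incidentTo H v) (λ e → v ∈? inc H e) (λ _ → ∈incident⁻) (λ _ → ∈incident⁺))

  deg≡# : ∀ F v → deg H F v ≡ # (λ e → (v ∈? inc H e) ×-dec (e ∈? F))
  deg≡# F v = trans (∣∣≡# (F ∩ incidentTo H v)) (#-cong (_∈? (F ∩ incidentTo H v)) _
    (λ e e∈ → let (p , q) = x∈p∩q⁻ F _ e∈ in ∈incident⁻ q , p)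
    (λ e (p , q) → x∈p∩q⁺ (q , ∈incident⁺ p)))

  deg-induced : ∀ Y v → deg H (inducedEdges H Y) v ≡ dIn Y v
  deg-induced Y v = trans (deg≡# (inducedEdges H Y) v) (#-cong
    (λ e → (v ∈? inc H e) ×-dec (e ∈? inducedEdges H Y)) (λ e → (v ∈? inc H e) ×-dec (inc H e ⊆? Y))
    (λ e (p , q) → p , λ {x} → ∈⟪⟫⁻ (λ e → inc H e ⊆? Y) q {x})
    (λ e (p , q) → p , ∈⟪⟫⁺ (λ e → inc H e ⊆? Y) q))

  -- The codegree counts hyperedges of every size. It is the multiplicity of an ordinary edge once
  -- the pair is known to be `Plain`.
  cod : Fin (nV H) → Fin (nV H) → ℕ
  cod u v = # (λ e → (u ∈? inc H e) ×-dec (v ∈? inc H e))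

  cod-sym : ∀ u v → cod u v ≡ cod v u
  cod-sym u v = #-cong (λ e → (u ∈? inc H e) ×-dec (v ∈? inc H e)) (λ e → (v ∈? inc H e) ×-dec (u ∈? inc H e))
    (λ e (p , q) → q , p) (λ e (p , q) → q , p)

  Adj : Fin (nV H) → Fin (nV H) → Set
  Adj u v = u ≢ v × ∃[ e ] (u ∈ inc H e × v ∈ inc H e)

  Adj-sym : ∀ {u v} → Adj u v → Adj v u
  Adj-sym (u≢v , e , u∈e , v∈e) = u≢v ∘ sym , e , v∈e , u∈e

  Adj⇒cod : ∀ {u v} → Adj u v → 0 < cod u v
  Adj⇒cod {u} {v} (_ , e , p) = #-some (λ e → (u ∈? inc H e) ×-dec (v ∈? inc H e)) e p

  cod⇒Adj : ∀ {u v} → u ≢ v → 0 < cod u v → Adj u v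
  cod⇒Adj {u} {v} u≢v 0< = u≢v , #-find (λ e → (u ∈? inc H e) ×-dec (v ∈? inc H e)) 0<

  -- Through this condition the hypergraph is shown, pair by pair, to be a multigraph.
  Plain : Fin (nV H) → Fin (nV H) → Set
  Plain u v = ∀ e → u ∈ inc H e → v ∈ inc H e → ∀ x → x ∈ inc H e → x ≡ u ⊎ x ≡ v

  Plain-sym : ∀ {u v} → Plain u v → Plain v u
  Plain-sym pl e v∈e u∈e x x∈e with pl e u∈e v∈e x x∈e
  ... | inj₁ eq = inj₂ eq
  ... | inj₂ eq = inj₁ eq

  module _ {p : ℕ} (f : VecFun H p) where

    -- It suffices to test the induced edge sets, which maximise the degrees.
    GoodOn : (Fin (nV H) → Set) → (Fin (nV H) → Fin p) → Set
    GoodOn D c = ∀ (Y : Subset (nV H)) i → Nonempty Y → (∀ v → v ∈ Y → D v × c v ≡ i) →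
      ∃[ v ] (v ∈ Y × dIn Y v < f v i)

    Good : (Fin (nV H) → Fin p) → Set
    Good = GoodOn (λ _ → ⊤)

    -- The colour that c assigns to the hole z is irrelevant.
    Config : Fin (nV H) → (Fin (nV H) → Fin p) → Set
    Config z = GoodOn (_≢ z)

    Partitionable : Set
    Partitionable = ∃ Good

    GoodOn-resp : ∀ {D D′ c c′} → (∀ v → D′ v → D v × c v ≡ c′ v) → GoodOn D c → GoodOn D′ c′
    GoodOn-resp D′⇒ good Y i ne mono = good Y i ne (λ v v∈Y →
      let (D′v , eq) = mono v v∈Y ; (Dv , eq′) = D′⇒ v D′v in Dv , trans eq′ eq)

opaque

  upd : ∀ {n} {A : Set} → (Fin n → A) → Fin n → A → Fin n → A
  upd c z i v with v ≟F z
  ... | yes _ = i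
  ... | no _ = c v

  upd-≡ : ∀ {n} {A : Set} (c : Fin n → A) z i → upd c z i z ≡ i
  upd-≡ c z i with z ≟F z
  ... | yes _ = refl
  ... | no z≢z = ⊥-elim (z≢z refl)

  upd-≢ : ∀ {n} {A : Set} (c : Fin n → A) {z} i {v} → v ≢ z → upd c z i v ≡ c v
  upd-≢ c {z} i {v} v≢z with v ≟F z
  ... | yes v≡z = ⊥-elim (v≢z v≡z)
  ... | no _ = refl

upd-cong : ∀ {n} {A : Set} {c c′ : Fin n → A} {z i i′ v} → i ≡ i′ → (v ≢ z → c v ≡ c′ v) → upd c z i v ≡ upd c′ z i′ v
upd-cong {c = c} {c′} {z} {i} {i′} {v} i≡i′ same with v ≟F z
... | yes refl = trans (upd-≡ c v i) (trans i≡i′ (sym (upd-≡ c′ v i′)))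
... | no v≢z = trans (upd-≢ c i v≢z) (trans (same v≢z) (sym (upd-≢ c′ i′ v≢z)))

-- The condition that edges have at least two vertices, in the form in which it is used: it chooses
-- a vertex whose colour represents the edge as seen from `v`.
HasOther : PreHypergraph → Set
HasOther H = ∀ e v → ∃[ w ] (w ∈ inc H e × w ≢ v)

opaque

  IsHypergraph⇒HasOther : ∀ H → IsHypergraph H → HasOther H
  IsHypergraph⇒HasOther H hyp e v = #≥2⁻ (_∈? inc H e) (subst (2 ≤_) (∣∣≡# (inc H e)) (hyp e)) v

module Extension (H : PreHypergraph) (has-other : HasOther H) {p : ℕ} (f : VecFun H p) where

  private
    V = Fin (nV H)
    E = Fin (nE H)

  other : E → V → V
  other e v = proj₁ (has-other e v)

  other∈ : ∀ e v → other e v ∈ inc H e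
  other∈ e v = proj₁ (proj₂ (has-other e v))

  other≢ : ∀ e v → other e v ≢ v
  other≢ e v = proj₂ (proj₂ (has-other e v))

  -- With `D` the vertices of colour `i`, these are the edges that become monochromatic once `z`
  -- receives `i`.
  Star : (V → Set) → V → E → Set
  Star D z e = z ∈ inc H e × (∀ u → u ∈ inc H e → u ≢ z → D u)

  Star? : {D : V → Set} → Decidable D → ∀ z → Decidable (Star D z)
  Star? D? z e = (z ∈? inc H e) ×-dec all? (λ u → (u ∈? inc H e) →-dec (¬? (u ≟F z) →-dec D? u))

  Colour : (V → Set) → (V → Fin p) → Fin p → V → Set
  Colour D c i v = D v × c v ≡ i

  Colour? : {D : V → Set} → Decidable D → ∀ c i → Decidable (Colour D c i)
  Colour? D? c i v = D? v ×-dec (c v ≟F i)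

  Star-mono : ∀ {D D′ : V → Set} {z} → (∀ u → u ≢ z → D u → D′ u) → ∀ e → Star D z e → Star D′ z e
  Star-mono D⇒D′ e (z∈e , s) = z∈e , λ u u∈e u≢z → D⇒D′ u u≢z (s u u∈e u≢z)

  opaque

    -- The domain `v ≢ z → D v` is `D` with `z` added. A test set containing `z` has `z` itself as
    -- witness, since its edges at `z` lie in the star; any other test set is handled by the old
    -- colouring.
    extend : ∀ {D : V → Set} (D? : Decidable D) {c z i} → GoodOn H f D c →
             # (Star? (Colour? D? c i) z) < f z i →
             GoodOn H f (λ v → v ≢ z → D v) (upd c z i)
    extend {D} D? {c} {z} {i} good lt Y j ne mono with z ∈? Y
    ... | yes z∈Y with trans (sym (proj₂ (mono z z∈Y))) (upd-≡ c z i)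
    ... | refl = z , z∈Y , ≤-<-trans (#-mono (λ e → (z ∈? inc H e) ×-dec (inc H e ⊆? Y)) (Star? (Colour? D? c i) z)
        (λ e (z∈e , e⊆Y) → z∈e , λ u u∈e u≢z → proj₁ (mono u (e⊆Y u∈e)) u≢z ,
          trans (sym (upd-≢ c i u≢z)) (proj₂ (mono u (e⊆Y u∈e))))) lt
    extend {D} D? {c} {z} {i} good lt Y j ne mono | no z∉Y = good Y j ne (λ v v∈Y →
      let v≢z = λ { refl → z∉Y v∈Y } in
      proj₁ (mono v v∈Y) v≢z , trans (sym (upd-≢ c i v≢z)) (proj₂ (mono v v∈Y)))

    -- The colour of the representative `other e z` tells the stars of different colours apart.
    -- Edges of mixed colour lie in none of them, whence only an inequality.
    ∑-Star : ∀ {D : V → Set} (D? : Decidable D) c z → ∑ (λ i → # (Star? (Colour? D? c i) z)) ≤ # (Star? D? z)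
    ∑-Star D? c z = ≤-trans
      (∑-mono (λ i → #-mono (Star? (Colour? D? c i) z) (λ e → Star? D? z e ×-dec (c (other e z) ≟F i))
        (λ e s → Star-mono (λ _ _ → proj₁) e s , proj₂ (proj₂ s (other e z) (other∈ e z) (other≢ e z)))))
      (≤-reflexive (#-fibres (Star? D? z) (λ e → c (other e z))))

    extendable : ∀ {D : V → Set} (D? : Decidable D) {c z} → GoodOn H f D c →
                 # (Star? D? z) < ∑ (f z) → ∃[ i ] GoodOn H f (λ v → v ≢ z → D v) (upd c z i)
    extendable D? {c} {z} good lt with ∑-find-< (≤-<-trans (∑-Star D? c z) lt)
    ... | i , lt′ = i , extend D? good lt′

module Greedy (H : PreHypergraph) (has-other : HasOther H) (conn : Connected H) {p : ℕ} (1≤p : 1 ≤ p)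
              (f : VecFun H p) (d≤f : ∀ v → # (λ e → v ∈? inc H e) ≤ ∑ (f v)) where

  open Extension H has-other f

  opaque

    -- `R` is the part left uncoloured. Connectivity gives `w` outside `R` on an edge that meets
    -- `R`, and `w` is coloured last. That edge is missing from its coloured star, so the star is
    -- smaller than the degree of `w` and some colour has room.
    greedy : ∀ k (R : Subset (nV H)) → Nonempty R → # (λ v → ¬? (v ∈? R)) ≤ k → ∃[ c ] GoodOn H f (_∉ R) c
    greedy k R ne le with any? (λ w → ¬? (w ∈? R))
    -- The domain is empty here, so any colouring serves; `1≤p` supplies a colour.
    greedy k R ne le | no none = (λ _ → fromℕ< 1≤p) ,
      λ { Y i (v , v∈Y) mono → ⊥-elim (none (v , proj₁ (mono v v∈Y))) }
    greedy k R ne le | yes out with proj₂ conn R ne out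
    greedy zero R ne le | yes out | e , (u , u∈e , u∈R) , (w , w∈e , w∉R) =
      ⊥-elim (<⇒≱ (#-some (λ v → ¬? (v ∈? R)) w w∉R) le)
    greedy (suc k) R (r , r∈R) le | yes out | e , (u , u∈e , u∈R) , (w , w∈e , w∉R) =
      let i , good′ = extendable (λ v → ¬? (v ∈? R′)) (proj₂ ih) (<-≤-trans lt (d≤f w)) in
      upd (proj₁ ih) w i , GoodOn-resp H f (λ v v∉R → (λ v≢w v∈R′ → back v∉R v≢w v∈R′) , refl) good′
      where
      R′ : Subset (nV H)
      R′ = R ∪ ⁅ w ⁆
      back : ∀ {v} → v ∉ R → v ≢ w → v ∉ R′
      back v∉R v≢w v∈R′ with x∈p∪q⁻ R ⁅ w ⁆ v∈R′
      ... | inj₁ v∈R = v∉R v∈R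
      ... | inj₂ v∈w = v≢w (x∈⁅y⁆⇒x≡y w v∈w)
      ih : ∃[ c ] GoodOn H f (_∉ R′) c
      ih = greedy k R′ (r , x∈p∪q⁺ (inj₁ r∈R)) (≤-pred (<-≤-trans
        (#-mono-< (λ v → ¬? (v ∈? R′)) (λ v → ¬? (v ∈? R)) (λ v v∉R′ v∈R → v∉R′ (x∈p∪q⁺ (inj₁ v∈R)))
          w w∉R (λ w∉R′ → w∉R′ (x∈p∪q⁺ (inj₂ (x∈⁅x⁆ w))))) le))
      lt : # (Star? (λ v → ¬? (v ∈? R′)) w) < # (λ e → w ∈? inc H e)
      lt = #-mono-< (Star? (λ v → ¬? (v ∈? R′)) w) (λ e → w ∈? inc H e) (λ _ → proj₁) e w∈e
        (λ (_ , s) → s u u∈e (λ { refl → w∉R u∈R }) (x∈p∪q⁺ (inj₁ u∈R)))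

    config-at : ∀ z → ∃[ c ] Config H f z c
    config-at z = let c , good = greedy _ ⁅ z ⁆ (z , x∈⁅x⁆ z) ≤-refl in
      c , GoodOn-resp H f (λ v v≢z → (λ v∈z → v≢z (x∈⁅y⁆⇒x≡y z v∈z)) , refl) good

module Configs (H : PreHypergraph) (has-other : HasOther H) {p : ℕ} (f : VecFun H p)
               (d≤f : ∀ v → # (λ e → v ∈? inc H e) ≤ ∑ (f v)) (unpart : ¬ Partitionable H f) where

  open Extension H has-other f public

  private
    V = Fin (nV H)
    E = Fin (nE H)

  -- An edge at `z` is filed under the colour of one representative before it is known to be
  -- monochromatic away from `z`. `mono-other` shows afterwards that the choice does not matter.
  CAt : (V → Fin p) → V → Fin p → E → Set
  CAt c z i e = z ∈ inc H e × c (other e z) ≡ i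

  CAt? : ∀ c z i → Decidable (CAt c z i)
  CAt? c z i e = (z ∈? inc H e) ×-dec (c (other e z) ≟F i)

  module _ {z c} (cfg : Config H f z c) where

    private
      S? : ∀ i → Decidable (Star (Colour (_≢ z) c i) z)
      S? i = Star? (Colour? (λ v → ¬? (v ≟F z)) c i) z

      f≤S : ∀ i → f z i ≤ # (S? i)
      f≤S i = ≮⇒≥ (λ lt → unpart (_ , GoodOn-resp H f (λ v _ → id , refl) (extend (λ v → ¬? (v ≟F z)) cfg lt)))

      S⇒C : ∀ i e → Star (Colour (_≢ z) c i) z e → CAt c z i e
      S⇒C i e (z∈e , s) = z∈e , proj₂ (s (other e z) (other∈ e z) (other≢ e z))

      S≤C : ∀ i → # (S? i) ≤ # (CAt? c z i)
      S≤C i = #-mono (S? i) (CAt? c z i) (S⇒C i)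

    -- Each star has at least `f z i` edges, otherwise `z` could take colour `i`, and is contained
    -- in the edges filed under `i`. The latter add up to the degree of `z`, which is at most the
    -- sum of `f z`, so every inequality is tight.
    f≡C : ∀ i → f z i ≡ # (CAt? c z i)
    f≡C = ∑-squeeze (λ i → ≤-trans (f≤S i) (S≤C i))
      (≤-trans (≤-reflexive (#-fibres (λ e → z ∈? inc H e) (λ e → c (other e z)))) (d≤f z))

    ∑f≡deg : ∑ (f z) ≡ # (λ e → z ∈? inc H e)
    ∑f≡deg = trans (∑-cong f≡C) (#-fibres (λ e → z ∈? inc H e) (λ e → c (other e z)))

    -- The same tightness leaves no edge that is filed under a colour without belonging to its star.
    mono-other : ∀ {e u} → z ∈ inc H e → u ∈ inc H e → u ≢ z → c u ≡ c (other e z)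
    mono-other {e} {u} z∈e u∈e u≢z = proj₂ (proj₂
      (#-squeeze (S? i) (CAt? c z i) (S⇒C i) (≤-trans (≤-reflexive (sym (f≡C i))) (f≤S i)) e (z∈e , refl)) u u∈e u≢z)
      where i = c (other e z)

    mono : ∀ {e u w} → z ∈ inc H e → u ∈ inc H e → w ∈ inc H e → u ≢ z → w ≢ z → c u ≡ c w
    mono z∈e u∈e w∈e u≢z w≢z = trans (mono-other z∈e u∈e u≢z) (sym (mono-other z∈e w∈e w≢z))

    opaque

      -- The star of `z` in colour `c u` has exactly `f z (c u)` edges. Uncolouring `u` removes the
      -- edge through `u` from it, which makes room for `z` to take that colour.
      slide : ∀ {u} → Adj H z u → Config H f u (upd c z (c u))
      slide {u} (z≢u , e , z∈e , u∈e) = GoodOn-resp H f (λ v v≢u → (λ v≢z → v≢z , v≢u) , refl)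
        (extend D? (GoodOn-resp H f (λ v (v≢z , _) → v≢z , refl) cfg)
          (<-≤-trans (#-mono-< (Star? (Colour? D? c (c u)) z) (CAt? c z (c u))
            (λ e (z∈e , s) → z∈e , proj₂ (s (other e z) (other∈ e z) (other≢ e z))) e (z∈e , sym (mono-other z∈e u∈e (z≢u ∘ sym)))
            (λ (_ , s) → proj₂ (proj₁ (s u u∈e (z≢u ∘ sym))) refl))
            (≤-reflexive (sym (f≡C (c u))))))
        where
        D? : Decidable (λ v → v ≢ z × v ≢ u)
        D? v = ¬? (v ≟F z) ×-dec ¬? (v ≟F u)

  module _ {y c c′} (cfg : Config H f y c) (cfg′ : Config H f y c′) where

    -- Both configurations show `f y β` edges of colour `β` at `y`, so an inclusion between these
    -- two edge sets is an equality.
    colour-transfer : ∀ β → (∀ x → Adj H y x → c x ≡ β → c′ x ≡ β) → ∀ x → Adj H y x → c′ x ≡ β → c x ≡ β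
    colour-transfer β c⇒c′ x (y≢x , e , y∈e , x∈e) c′x≡β = trans (mono-other cfg y∈e x∈e (y≢x ∘ sym)) (proj₂
      (#-squeeze (CAt? c y β) (CAt? c′ y β)
        (λ e (y∈e , eq) → y∈e , c⇒c′ (other e y) ((λ eq → other≢ e y (sym eq)) , e , y∈e , other∈ e y) eq)
        (≤-reflexive (trans (sym (f≡C cfg′ β)) (f≡C cfg β))) e
        (y∈e , trans (sym (mono-other cfg′ y∈e x∈e (y≢x ∘ sym))) c′x≡β)))

    module Swap {a b} (a≢y : a ≢ y) (b≢y : b ≢ y) (same : ∀ x → Adj H y x → x ≢ a → x ≢ b → c x ≡ c′ x)
                (c′a : c′ a ≡ c b) (c′b : c′ b ≡ c a) (ca≢cb : c a ≢ c b) where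

      -- A further vertex `x` on an edge through `y` and `a` shares the colour of `a` in both
      -- configurations. The colour of `a` changes while that of `x` stays, and `x = b` fails
      -- already under `c`.
      swap-plain : Plain H y a
      swap-plain e y∈e a∈e x x∈e with x ≟F y | x ≟F a | x ≟F b
      ... | yes eq | _ | _ = inj₁ eq
      ... | _ | yes eq | _ = inj₂ eq
      ... | no _ | no _ | yes refl = ⊥-elim (ca≢cb (mono cfg y∈e a∈e x∈e a≢y b≢y))
      ... | no x≢y | no x≢a | no x≢b = ⊥-elim (ca≢cb (begin
        c a   ≡⟨ mono cfg y∈e a∈e x∈e a≢y x≢y ⟩
        c x   ≡⟨ same x (x≢y ∘ sym , e , y∈e , x∈e) x≢a x≢b ⟩
        c′ x  ≡⟨ mono cfg′ y∈e x∈e a∈e x≢y a≢y ⟩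
        c′ a  ≡⟨ c′a ⟩
        c b   ∎))
        where open ≡-Reasoning

      -- The edges at `y` of colour `c a` are those through `a` under `c`, those through `b` under
      -- `c′`, and the same remainder in both cases. In particular adjacency to `y` passes from `a`
      -- to `b`.
      swap-cod : cod H y a ≡ cod H y b
      swap-cod = +-cancelʳ-≡ _ _ _ (begin
        cod H y a + # rest?  ≡⟨ cong (_+ # rest?) (#-cong _ (λ e → CAt? c y i e ×-dec (a ∈? inc H e))
             (λ e (y∈e , a∈e) → (y∈e , sym (mono-other cfg y∈e a∈e a≢y)) , a∈e) (λ e ((y∈e , _) , a∈e) → y∈e , a∈e)) ⟩
        # (λ e → CAt? c y i e ×-dec (a ∈? inc H e)) + # rest?  ≡⟨ sym (#-split (CAt? c y i) (λ e → a ∈? inc H e)) ⟩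
        # (CAt? c y i)  ≡⟨ trans (sym (f≡C cfg i)) (f≡C cfg′ i) ⟩
        # (CAt? c′ y i)  ≡⟨ #-split (CAt? c′ y i) (λ e → b ∈? inc H e) ⟩
        # (λ e → CAt? c′ y i e ×-dec (b ∈? inc H e)) + # rest′?  ≡⟨ cong₂ _+_
           (#-cong (λ e → CAt? c′ y i e ×-dec (b ∈? inc H e)) (λ e → (y ∈? inc H e) ×-dec (b ∈? inc H e))
             (λ e ((y∈e , _) , b∈e) → y∈e , b∈e) (λ e (y∈e , b∈e) → (y∈e , trans (sym (mono-other cfg′ y∈e b∈e b≢y)) c′b) , b∈e))
           (#-cong rest′? rest? to from) ⟩
        cod H y b + # rest?  ∎)
        where
        open ≡-Reasoning
        i = c a
        rest? : Decidable (λ e → CAt c y i e × ¬ (a ∈ inc H e))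
        rest? e = CAt? c y i e ×-dec ¬? (a ∈? inc H e)
        rest′? : Decidable (λ e → CAt c′ y i e × ¬ (b ∈ inc H e))
        rest′? e = CAt? c′ y i e ×-dec ¬? (b ∈? inc H e)
        nbr : ∀ e → y ∈ inc H e → Adj H y (other e y)
        nbr e y∈e = (λ eq → other≢ e y (sym eq)) , e , y∈e , other∈ e y
        miss : ∀ {e x} → x ∉ inc H e → other e y ≢ x
        miss {e} x∉e refl = x∉e (other∈ e y)
        to : ∀ e → CAt c′ y i e × ¬ (b ∈ inc H e) → CAt c y i e × ¬ (a ∈ inc H e)
        to e ((y∈e , eq) , b∉e) = (y∈e , trans (same _ (nbr e y∈e) (miss a∉e) (miss b∉e)) eq) , a∉e
          where
          a∉e : a ∉ inc H e
          a∉e a∈e = ca≢cb (trans (sym eq) (trans (sym (mono-other cfg′ y∈e a∈e a≢y)) c′a))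
        from : ∀ e → CAt c y i e × ¬ (a ∈ inc H e) → CAt c′ y i e × ¬ (b ∈ inc H e)
        from e ((y∈e , eq) , a∉e) = (y∈e , trans (sym (same _ (nbr e y∈e) (miss a∉e) (miss b∉e))) eq) , b∉e
          where
          b∉e : b ∉ inc H e
          b∉e b∈e = ca≢cb (trans (sym eq) (sym (mono-other cfg y∈e b∈e b≢y)))

-- Paths and separating vertices

mkSeparating : ∀ (H : PreHypergraph) {P Q : Fin (nV H) → Set} (P? : Decidable P) (Q? : Decidable Q) w →
  (∀ v → P v ⊎ Q v) → P w → Q w → (∀ v → P v → Q v → v ≡ w) →
  ∃[ u ] (P u × u ≢ w) → ∃[ u ] (Q u × u ≢ w) →
  (∀ e → (∀ x → x ∈ inc H e → P x) ⊎ (∀ x → x ∈ inc H e → Q x)) →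
  Separating H w
mkSeparating H {P} {Q} P? Q? w cover Pw Qw unique (u , Pu , u≢w) (x , Qx , x≢w) edges =
  ⟪ P? ⟫ , ⟪ Q? ⟫ , cover′ , ⊆-antisym to from , two P? Pu Pw u≢w , two Q? Qx Qw x≢w , edges′
  where
  cover′ : ∀ v → v ∈ ⟪ P? ⟫ ⊎ v ∈ ⟪ Q? ⟫
  cover′ v with cover v
  ... | inj₁ Pv = inj₁ (∈⟪⟫⁺ P? Pv)
  ... | inj₂ Qv = inj₂ (∈⟪⟫⁺ Q? Qv)
  to : ⟪ P? ⟫ ∩ ⟪ Q? ⟫ ⊆ ⁅ w ⁆
  to {v} v∈ with x∈p∩q⁻ ⟪ P? ⟫ ⟪ Q? ⟫ v∈
  ... | v∈P , v∈Q with unique v (∈⟪⟫⁻ P? v∈P) (∈⟪⟫⁻ Q? v∈Q)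
  ... | refl = x∈⁅x⁆ v
  from : ⁅ w ⁆ ⊆ ⟪ P? ⟫ ∩ ⟪ Q? ⟫
  from v∈ with x∈⁅y⁆⇒x≡y w v∈
  ... | refl = x∈p∩q⁺ (∈⟪⟫⁺ P? Pw , ∈⟪⟫⁺ Q? Qw)
  two : ∀ {R : Fin (nV H) → Set} (R? : Decidable R) {u} → R u → R w → u ≢ w → 2 ≤ ∣ ⟪ R? ⟫ ∣
  two R? Ru Rw u≢w = subst (2 ≤_) (sym (∣⟪⟫∣≡# R?)) (#≥2 R? _ _ u≢w Ru Rw)
  edges′ : ∀ e → inc H e ⊆ ⟪ P? ⟫ ⊎ inc H e ⊆ ⟪ Q? ⟫
  edges′ e with edges e
  ... | inj₁ all = inj₁ (λ {x} x∈e → ∈⟪⟫⁺ P? (all x x∈e))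
  ... | inj₂ all = inj₂ (λ {x} x∈e → ∈⟪⟫⁺ Q? (all x x∈e))

module _ (H : PreHypergraph) where

  -- Kept as a derivation because pairs of configurations are carried along it step by step.
  data Reach (C : Fin (nV H) → Set) (y₀ : Fin (nV H)) : Fin (nV H) → Set where
    start : ¬ C y₀ → Reach C y₀ y₀
    step  : ∀ {y y′} → Reach C y₀ y → Adj H y y′ → ¬ C y′ → Reach C y₀ y′

  Reach⇒∉ : ∀ {C y₀ y} → Reach C y₀ y → ¬ C y
  Reach⇒∉ (start ∉C) = ∉C
  Reach⇒∉ (step _ _ ∉C) = ∉C

  -- If the component of `y₀` outside `C` were attached to `C` at `w` alone, this component with `w`
  -- added and the complement of the component would exhibit `w` as separating; `x₀` makes the
  -- second part large enough.
  reach-another : (∀ v → ¬ Separating H v) → {C : Fin (nV H) → Set} → Decidable C →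
    ∀ {w x₀ y₀} → C w → C x₀ → x₀ ≢ w → ¬ C y₀ →
    (∀ y x → Reach C y₀ y → C x → x ≢ w → Adj H y x → ⊥) → ⊥
  reach-another nosep {C} C? {w} {x₀} {y₀} Cw Cx₀ x₀≢w ¬Cy₀ escape = ¬¬-dec (Reach C y₀) λ R? → nosep w
    (mkSeparating H (λ v → R? v ⊎-dec (v ≟F w)) (λ v → ¬? (R? v)) w
      (λ v → cover R? v) (inj₂ refl) (λ r → Reach⇒∉ r Cw)
      (λ { v (inj₁ r) ¬r → ⊥-elim (¬r r) ; v (inj₂ eq) _ → eq })
      (y₀ , inj₁ (start ¬Cy₀) , λ { refl → ¬Cy₀ Cw })
      (x₀ , (λ r → Reach⇒∉ r Cx₀) , x₀≢w) (edges R?))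
    where
    cover : Decidable (Reach C y₀) → ∀ v → (Reach C y₀ v ⊎ v ≡ w) ⊎ ¬ Reach C y₀ v
    cover R? v with R? v
    ... | yes r = inj₁ (inj₁ r)
    ... | no ¬r = inj₂ ¬r
    edges : Decidable (Reach C y₀) → ∀ e → (∀ x → x ∈ inc H e → Reach C y₀ x ⊎ x ≡ w) ⊎ (∀ x → x ∈ inc H e → ¬ Reach C y₀ x)
    edges R? e with any? (λ u → R? u ×-dec (u ∈? inc H e))
    ... | no none = inj₂ (λ x x∈e r → none (x , r , x∈e))
    ... | yes (u , ru , u∈e) = inj₁ side
      where
      side : ∀ x → x ∈ inc H e → Reach C y₀ x ⊎ x ≡ w
      side x x∈e with R? x | x ≟F w
      ... | yes r | _ = inj₁ r
      ... | no _ | yes eq = inj₂ eq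
      ... | no ¬r | no x≢w with C? x
      ... | yes Cx = ⊥-elim (escape u x ru Cx x≢w ((λ { refl → ¬r ru }) , e , u∈e , x∈e))
      ... | no ¬Cx = inj₁ (step ru ((λ { refl → ¬r ru }) , e , u∈e , x∈e) ¬Cx)

  -- A walk of `l` steps: repeated vertices are allowed here and excluded later by minimality.
  -- Values of `Y` beyond `l` are arbitrary.
  record Path (z a b : Fin (nV H)) (l : ℕ) : Set where
    field
      Y     : ℕ → Fin (nV H)
      first : Y 0 ≡ a
      last  : Y l ≡ b
      avoid : ∀ i → i ≤ l → Y i ≢ z
      adj   : ∀ i → i < l → Adj H (Y i) (Y (suc i))

  path-[] : ∀ {z a} → a ≢ z → Path z a a 0
  path-[] {z} {a} a≢z = record { Y = λ _ → a ; first = refl ; last = refl ; avoid = λ _ _ → a≢z ; adj = λ _ () }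

  path-∷ : ∀ {z a a′ b l} → a′ ≢ z → Adj H a′ a → Path z a b l → Path z a′ b (suc l)
  path-∷ {z} {a} {a′} a′≢z adj₀ P = record
    { Y = Y′ ; first = refl ; last = P.last
    ; avoid = λ { zero _ → a′≢z ; (suc i) (s≤s i≤l) → P.avoid i i≤l }
    ; adj = λ { zero _ → subst (Adj H a′) (sym P.first) adj₀ ; (suc i) (s≤s i<l) → P.adj i i<l } }
    where
    module P = Path P
    Y′ : ℕ → Fin (nV H)
    Y′ zero = a′
    Y′ (suc i) = P.Y i

  Reach⇒Path : ∀ {C y₀ y z} → C z → Reach C y₀ y → ∃[ l ] Path z y y₀ l
  Reach⇒Path Cz (start ¬C) = 0 , path-[] (λ { refl → ¬C Cz })
  Reach⇒Path Cz (step r a ¬C) = let l , P = Reach⇒Path Cz r in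
    suc l , path-∷ (λ { refl → ¬C Cz }) (Adj-sym H a) P

module _ (H : PreHypergraph) where

  ∈pair : ∀ {n} {x u v : Fin n} → x ∈ (⁅ u ⁆ ∪ ⁅ v ⁆) → x ≡ u ⊎ x ≡ v
  ∈pair {x = x} {u} {v} x∈ with x∈p∪q⁻ ⁅ u ⁆ ⁅ v ⁆ x∈
  ... | inj₁ x∈u = inj₁ (x∈⁅y⁆⇒x≡y u x∈u)
  ... | inj₂ x∈v = inj₂ (x∈⁅y⁆⇒x≡y v x∈v)

  u∈pair : ∀ {n} (u v : Fin n) → u ∈ (⁅ u ⁆ ∪ ⁅ v ⁆)
  u∈pair u v = x∈p∪q⁺ (inj₁ (x∈⁅x⁆ u))

  v∈pair : ∀ {n} (u v : Fin n) → v ∈ (⁅ u ⁆ ∪ ⁅ v ⁆)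
  v∈pair u v = x∈p∪q⁺ (inj₂ (x∈⁅x⁆ v))

  plain-inc : ∀ {u v e} → Plain H u v → u ∈ inc H e → v ∈ inc H e → inc H e ≡ ⁅ u ⁆ ∪ ⁅ v ⁆
  plain-inc {u} {v} {e} plain u∈e v∈e = ⊆-antisym to from
    where
    to : inc H e ⊆ ⁅ u ⁆ ∪ ⁅ v ⁆
    to {x} x∈e with plain e u∈e v∈e x x∈e
    ... | inj₁ refl = u∈pair u v
    ... | inj₂ refl = v∈pair u v
    from : ⁅ u ⁆ ∪ ⁅ v ⁆ ⊆ inc H e
    from x∈ with ∈pair x∈
    ... | inj₁ refl = u∈e
    ... | inj₂ refl = v∈e

  joinCount≡# : ∀ u v → joinCount H u v ≡ # (λ e → inc H e ≟ₛ (⁅ u ⁆ ∪ ⁅ v ⁆))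
  joinCount≡# u v = ∣⟪⟫∣≡# (λ e → inc H e ≟ₛ (⁅ u ⁆ ∪ ⁅ v ⁆))

  plain-joinCount : ∀ {u v} → Plain H u v → joinCount H u v ≡ cod H u v
  plain-joinCount {u} {v} plain = trans (joinCount≡# u v)
    (#-cong (λ e → inc H e ≟ₛ (⁅ u ⁆ ∪ ⁅ v ⁆)) (λ e → (u ∈? inc H e) ×-dec (v ∈? inc H e))
      (λ e eq → subst (u ∈_) (sym eq) (u∈pair u v) , subst (v ∈_) (sym eq) (v∈pair u v))
      (λ e (u∈e , v∈e) → plain-inc plain u∈e v∈e))

module _ (H : PreHypergraph) where

  Adj? : ∀ u v → Dec (Adj H u v)
  Adj? u v = ¬? (u ≟F v) ×-dec any? (λ e → (u ∈? inc H e) ×-dec (v ∈? inc H e))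

  -- The `d` steps between the two visits to one vertex are left out, which is how a shortest walk
  -- is seen to have no repetitions.
  splice : ∀ {z a b} d k i → i ≤ k → (P : Path H z a b (d + k)) → Path.Y P i ≡ Path.Y P (d + i) → Path H z a b k
  splice {z} d k i i≤k P eq = record
    { Y = Y′ ; first = trans first′ P.first ; last = trans (at-≥ i≤k) P.last ; avoid = avoid′ ; adj = adj′ }
    where
    module P = Path P
    Y′ : ℕ → Fin (nV H)
    Y′ t with t <? i
    ... | yes _ = P.Y t
    ... | no _ = P.Y (d + t)
    at-< : ∀ {t} → t < i → Y′ t ≡ P.Y t
    at-< {t} t<i with t <? i
    ... | yes _ = refl
    ... | no t≮i = ⊥-elim (t≮i t<i)
    at-≥ : ∀ {t} → i ≤ t → Y′ t ≡ P.Y (d + t)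
    at-≥ {t} i≤t with t <? i
    ... | yes t<i = ⊥-elim (<⇒≱ t<i i≤t)
    ... | no _ = refl
    at-≤ : ∀ {t} → t ≤ i → Y′ t ≡ P.Y t
    at-≤ {t} t≤i with m≤n⇒m<n∨m≡n t≤i
    ... | inj₁ t<i = at-< t<i
    ... | inj₂ refl = trans (at-≥ ≤-refl) (sym eq)
    first′ : Y′ 0 ≡ P.Y 0
    first′ = at-≤ z≤n
    avoid′ : ∀ t → t ≤ k → Y′ t ≢ z
    avoid′ t t≤k with <-≤-connex t i
    ... | inj₁ t<i = λ e → P.avoid t (≤-trans t≤k (m≤n+m k d)) (trans (sym (at-< t<i)) e)
    ... | inj₂ i≤t = λ e → P.avoid (d + t) (+-monoʳ-≤ d t≤k) (trans (sym (at-≥ i≤t)) e)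
    adj′ : ∀ t → t < k → Adj H (Y′ t) (Y′ (suc t))
    adj′ t t<k with <-≤-connex t i
    ... | inj₁ t<i = subst (Adj H (Y′ t)) (sym (at-≤ t<i)) (subst (λ x → Adj H x (P.Y (suc t))) (sym (at-< t<i)) (P.adj t (≤-trans t<k (m≤n+m k d))))
    ... | inj₂ i≤t = subst (Adj H (Y′ t)) (sym (trans (at-≥ (m≤n⇒m≤1+n i≤t)) (cong P.Y (+-suc d t))))
      (subst (λ x → Adj H x (P.Y (suc (d + t)))) (sym (at-≥ i≤t)) (P.adj (d + t) (+-monoʳ-< d t<k)))

-- Blocks

module Block (H : PreHypergraph) (hyp : IsHypergraph H) (conn : Connected H) (nosep : ∀ v → ¬ Separating H v)
             {p : ℕ} (1≤p : 1 ≤ p) (f : VecFun H p) (d≤f : ∀ v → # (λ e → v ∈? inc H e) ≤ ∑ (f v))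
             (unpart : ¬ Partitionable H f) where

  has-other : HasOther H
  has-other = IsHypergraph⇒HasOther H hyp

  open Configs H has-other f d≤f unpart public
  open Greedy H has-other conn 1≤p f d≤f using (config-at) public

  private
    V = Fin (nV H)

  module _ {C : V → Set} {w y₀ c c̃} (Cw : C w) (w~y₀ : Adj H w y₀) (cfg : Config H f w c) (cfg̃ : Config H f w c̃)
           (same : ∀ v → ¬ C v → c v ≡ c̃ v) where

    -- Two configurations that differ only on `C` take the same slides along a walk outside `C`.
    -- They keep their colours on `C` apart from `w`, stay equal elsewhere, and can thus be compared
    -- at the distant hole `y`.
    carry : ∀ {y} → Reach H C y₀ y → ∃[ c₁ ] ∃[ c₂ ] (Config H f y c₁ × Config H f y c₂ ×
      (∀ v → C v → v ≢ w → c₁ v ≡ c v × c₂ v ≡ c̃ v) × (∀ v → (C v → v ≡ w) → c₁ v ≡ c₂ v))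
    carry (start ¬C) = upd c w (c y₀) , upd c̃ w (c̃ y₀) , slide cfg w~y₀ , slide cfg̃ w~y₀ ,
      (λ v Cv v≢w → upd-≢ c _ v≢w , upd-≢ c̃ _ v≢w) , off
      where
      off : ∀ v → (C v → v ≡ w) → upd c w (c y₀) v ≡ upd c̃ w (c̃ y₀) v
      off v out = upd-cong (same y₀ ¬C) (λ v≢w → same v (v≢w ∘ out))
    carry (step {y} {y′} r a ¬C) with carry r
    ... | c₁ , c₂ , cfg₁ , cfg₂ , on , off = upd c₁ y (c₁ y′) , upd c₂ y (c₂ y′) , slide cfg₁ a , slide cfg₂ a ,
      (λ v Cv v≢w → let v≢y = λ { refl → Reach⇒∉ H r Cv } in
        trans (upd-≢ c₁ _ v≢y) (proj₁ (on v Cv v≢w)) , trans (upd-≢ c₂ _ v≢y) (proj₂ (on v Cv v≢w))) , off′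
      where
      off′ : ∀ v → (C v → v ≡ w) → upd c₁ y (c₁ y′) v ≡ upd c₂ y (c₂ y′) v
      off′ v out = upd-cong (off y′ (⊥-elim ∘ ¬C)) (λ _ → off v out)

  -- Hole and configuration are fields, so minimality of `l` ranges over all of them. This is what
  -- later permits contradictions at other holes.
  record BiPath (l : ℕ) : Set where
    field
      {z} {a} {b} : V
      {c}   : V → Fin p
      cfg   : Config H f z c
      path  : Path H z a b l
      z~a   : Adj H z a
      z~b   : Adj H z b
      ca≢cb : c a ≢ c b

  Min : ℕ → Set
  Min l = ∀ l′ → l′ < l → ¬ BiPath l′

  -- Existence of a `BiPath` of given length is not decided, so a least length is available only to
  -- a continuation.
  minimal : ∀ {l} → BiPath l → (∀ l → BiPath l → Min l → ⊥) → ⊥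
  minimal {l} P k = below (suc l) l ≤-refl P
    where
    below : ∀ l → Min l
    below (suc l) l′ (s≤s l′≤l) P = k l′ P (λ l″ l″<l′ → below l l″ (≤-trans l″<l′ l′≤l))

  config-pos : ∀ {z c u} → Config H f z c → u ≢ z → 0 < f u (c u)
  config-pos {z} {c} {u} cfg u≢z with cfg ⁅ u ⁆ (c u) (u , x∈⁅x⁆ u) (λ { v v∈ → case v v∈ })
    where
    case : ∀ v → v ∈ ⁅ u ⁆ → v ≢ z × c v ≡ c u
    case v v∈ with x∈⁅y⁆⇒x≡y u v∈
    ... | refl = u≢z , refl
  ... | v , v∈ , lt with x∈⁅y⁆⇒x≡y u v∈
  ... | refl = ≤-<-trans z≤n lt

  -- Let `u` and `w` be neighbours of the hole in colours `i` and `j`. With `C` consisting of `z`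
  -- and `w`, the component of `u` must attach to `C` elsewhere than at `z`, hence at `w`.
  two-colours⇒BiPath : ∀ {z i j} → i ≢ j → 0 < f z i → 0 < f z j → (∀ l → BiPath l → ⊥) → ⊥
  two-colours⇒BiPath {z} {i} {j} i≢j 0<fi 0<fj k with config-at z
  ... | c , cfg with #-find (CAt? c z i) (subst (0 <_) (f≡C cfg i) 0<fi) | #-find (CAt? c z j) (subst (0 <_) (f≡C cfg j) 0<fj)
  ... | e , z∈e , cu≡i | e′ , z∈e′ , cw≡j =
    reach-another H nosep {C = λ v → v ≡ z ⊎ v ≡ w} (λ v → (v ≟F z) ⊎-dec (v ≟F w))
      (inj₁ refl) (inj₂ refl) (other≢ e′ z) (λ { (inj₁ eq) → other≢ e z eq ; (inj₂ eq) → u≢w eq })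
      λ { y x r (inj₁ eq) x≢z y~x → x≢z eq
        ; y x r (inj₂ refl) x≢z y~x → let l , P = Reach⇒Path H (inj₁ refl) r in
            k (suc l) record { cfg = cfg ; path = path-∷ H x≢z (Adj-sym H y~x) P
              ; z~a = (λ eq → other≢ e′ z (sym eq)) , e′ , z∈e′ , other∈ e′ z
              ; z~b = (λ eq → other≢ e z (sym eq)) , e , z∈e , other∈ e z
              ; ca≢cb = λ eq → i≢j (trans (sym cu≡i) (trans (sym eq) cw≡j)) } }
    where
    u = other e z
    w = other e′ z
    u≢w : u ≢ w
    u≢w eq = i≢j (trans (sym cu≡i) (trans (cong c eq) cw≡j))

  -- Blocks in which no vertex has two nonzero entries

  module Mono (single : ∀ z i j → 0 < f z i → 0 < f z j → i ≡ j) where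

    v₀ : V
    v₀ = fromℕ< (proj₁ conn)

    supp : ∃[ j ] (∀ i → 0 < f v₀ i → i ≡ j)
    supp with any? (λ j → 0 <? f v₀ j)
    ... | yes (j , 0<) = j , λ i 0<i → single v₀ i j 0<i 0<
    -- If `f v₀` vanishes entirely, every colour qualifies.
    ... | no none = fromℕ< 1≤p , λ i 0<i → ⊥-elim (none (i , 0<i))

    j : Fin p
    j = proj₁ supp

    Only : V → Set
    Only v = ∀ i → i ≢ j → f v i ≡ 0

    Only? : Decidable Only
    Only? v = all? (λ i → ¬? (i ≟F j) →-dec (f v i ≟ 0))

    -- The property spreads along edges. With the hole at `x`, a neighbour `u` supported on `j` must
    -- have colour `j`, so the common edge makes `f x j` positive, and `single` leaves `x` no other
    -- nonzero entry.
    only : ∀ v → Only v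
    only v with Only? v
    ... | yes o = o
    ... | no ¬o with proj₂ conn ⟪ Only? ⟫ (v₀ , ∈⟪⟫⁺ Only? (λ i i≢j → n≤0⇒n≡0 (≮⇒≥ (λ lt → i≢j (proj₂ supp i lt))))) (v , λ v∈ → ¬o (∈⟪⟫⁻ Only? v∈))
    ... | e , (u , u∈e , u∈) , (x , x∈e , x∉) = ⊥-elim (x∉ (∈⟪⟫⁺ Only? x-only))
      where
      u≢x : u ≢ x
      u≢x refl = x∉ u∈
      c = proj₁ (config-at x)
      cfg = proj₂ (config-at x)
      cu≡j : c u ≡ j
      cu≡j with c u ≟F j
      ... | yes eq = eq
      ... | no neq = ⊥-elim (<⇒≢ (config-pos cfg u≢x) (sym (∈⟪⟫⁻ Only? u∈ (c u) neq)))
      0<fxj : 0 < f x j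
      0<fxj = subst (0 <_) (sym (f≡C cfg j)) (#-some (CAt? c x j) e (x∈e , trans (sym (mono-other cfg x∈e u∈e u≢x)) cu≡j))
      x-only : Only x
      x-only i i≢j = n≤0⇒n≡0 (≮⇒≥ (λ lt → i≢j (single x i j lt 0<fxj)))

    hard : HardPair H f
    hard = hardM hyp (conn , nosep) j (λ v → trans (sym (∑-single j (only v)))
      (trans (∑f≡deg (proj₂ (config-at v))) (sym (degH≡# H v)))) only

  -- Rotating the hole once around the triangle z a b swaps the colours of a and b.
  record Transposition (z a b : V) (c : V → Fin p) : Set where
    constructor transposition
    field
      {c′} : V → Fin p
      cfg′ : Config H f z c′
      c′a  : c′ a ≡ c b
      c′b  : c′ b ≡ c a
      rest : ∀ v → v ≢ a → v ≢ b → v ≢ z → c′ v ≡ c v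

  opaque

    transpose : ∀ {z a b c} → Config H f z c → Adj H z a → Adj H a b → Adj H b z → Transposition z a b c
    transpose {z} {a} {b} {c} cfg z~a a~b b~z = transposition {c′ = c₃} (slide (slide (slide cfg z~a) a~b) b~z)
      (trans (upd-≢ c₂ _ a≢b) (trans (upd-≡ c₁ a _) (upd-≢ c _ b≢z)))
      (trans (upd-≡ c₂ b _) (trans (upd-≢ c₁ _ (proj₁ z~a)) (upd-≡ c z _)))
      (λ v v≢a v≢b v≢z → trans (upd-≢ c₂ _ v≢b) (trans (upd-≢ c₁ _ v≢a) (upd-≢ c _ v≢z)))
      where
      c₁ c₂ c₃ : V → Fin p
      c₁ = upd c z (c a)
      c₂ = upd c₁ a (c₁ b)
      c₃ = upd c₂ b (c₂ z)
      a≢b : a ≢ b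
      a≢b = proj₁ a~b
      b≢z : b ≢ z
      b≢z = proj₁ b~z

  triangle : ∀ {z a b c} → Config H f z c → Adj H z a → Adj H a b → Adj H b z → c a ≢ c b →
    Plain H z a × Plain H z b × cod H z a ≡ cod H z b
  triangle {z} {a} {b} {c} cfg z~a a~b b~z ca≢cb with transpose cfg z~a a~b b~z
  ... | transposition {c′} cfg′ c′a c′b rest = S.swap-plain , S′.swap-plain , S.swap-cod
    where
    a≢z : a ≢ z
    a≢z a≡z = proj₁ z~a (sym a≡z)
    same : ∀ x → Adj H z x → x ≢ a → x ≢ b → c x ≡ c′ x
    same x z~x x≢a x≢b = sym (rest x x≢a x≢b (λ x≡z → proj₁ z~x (sym x≡z)))
    module S = Swap cfg cfg′ {a} {b} a≢z (proj₁ b~z) same c′a c′b ca≢cb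
    module S′ = Swap cfg cfg′ {b} {a} (proj₁ b~z) a≢z (λ x z~x x≢b x≢a → same x z~x x≢a x≢b) c′b c′a (λ eq → ca≢cb (sym eq))

  -- Cliques carrying two colours

  record Hole (Q : Subset (nV H)) (z : V) (c : V → Fin p) : Set where
    field
      cfg : Config H f z c
      z∈Q : z ∈ Q
      {a b} : V
      a∈Q : a ∈ Q
      b∈Q : b ∈ Q
      a≢z : a ≢ z
      b≢z : b ≢ z
      ca≢cb : c a ≢ c b

    a≢b : a ≢ b
    a≢b eq = ca≢cb (cong c eq)

    -- Exchanging along a triangle requires two different colours; this finds a second vertex of `Q`
    -- against any given colour.
    partner : ∀ i → ∃[ q ] (q ∈ Q × q ≢ z × i ≢ c q)
    partner i with i ≟F c a
    ... | no i≢ = a , a∈Q , a≢z , i≢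
    ... | yes refl = b , b∈Q , b≢z , ca≢cb

    third : ∀ q → ∃[ r ] (r ∈ Q × r ≢ z × r ≢ q)
    third q with a ≟F q
    ... | no a≢q = a , a∈Q , a≢z , a≢q
    ... | yes refl = b , b∈Q , b≢z , a≢b ∘ sym

  record Clique (Q : Subset (nV H)) (t : ℕ) : Set where
    field
      0<t   : 0 < t
      plain : ∀ {u v} → u ∈ Q → v ∈ Q → u ≢ v → Plain H u v
      codt  : ∀ {u v} → u ∈ Q → v ∈ Q → u ≢ v → cod H u v ≡ t
      {z}   : V
      {c}   : V → Fin p
      hole  : Hole Q z c

    adj : ∀ {u v} → u ∈ Q → v ∈ Q → u ≢ v → Adj H u v
    adj u∈Q v∈Q u≢v = cod⇒Adj H u≢v (subst (0 <_) (sym (codt u∈Q v∈Q u≢v)) 0<t)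

    opaque

      -- The vertex that receives the hole hands its colour to the old hole, so both colours remain
      -- visible in `Q`.
      move : ∀ q → q ∈ Q → ∃[ c′ ] Hole Q q c′
      move q q∈Q with q ≟F z
      ... | yes refl = c , hole
      ... | no q≢z = upd c z (c q) , hole′
        where
        open Hole hole
        cfg′ : Config H f q (upd c z (c q))
        cfg′ = slide cfg (adj z∈Q q∈Q (q≢z ∘ sym))
        hole′ : Hole Q q (upd c z (c q))
        hole′ with q ≟F a | q ≟F b
        ... | no q≢a | no q≢b = record { cfg = cfg′ ; z∈Q = q∈Q ; a∈Q = a∈Q ; b∈Q = b∈Q ; a≢z = q≢a ∘ sym ; b≢z = q≢b ∘ sym
          ; ca≢cb = λ eq → ca≢cb (trans (sym (upd-≢ c _ a≢z)) (trans eq (upd-≢ c _ b≢z))) }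
        ... | yes refl | _ = record { cfg = cfg′ ; z∈Q = q∈Q ; a∈Q = z∈Q ; b∈Q = b∈Q ; a≢z = a≢z ∘ sym ; b≢z = a≢b ∘ sym
          ; ca≢cb = λ eq → ca≢cb (trans (sym (upd-≡ c z _)) (trans eq (upd-≢ c _ b≢z))) }
        ... | no _ | yes refl = record { cfg = cfg′ ; z∈Q = q∈Q ; a∈Q = z∈Q ; b∈Q = a∈Q ; a≢z = b≢z ∘ sym ; b≢z = a≢b
          ; ca≢cb = λ eq → ca≢cb (sym (trans (sym (upd-≡ c z _)) (trans eq (upd-≢ c _ a≢z)))) }

    module Outside {y} (y∉Q : y ∉ Q) where

      ≢y : ∀ {q} → q ∈ Q → q ≢ y
      ≢y q∈Q refl = y∉Q q∈Q

      -- Turning around the triangle `w q q′` exchanges the colours of `q` and `q′`. Sliding from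
      -- `w` to `y` before and after the turn gives two configurations with hole `y` to which `Swap`
      -- applies.
      near : ∀ {w c q q′} → Hole Q w c → Adj H w y → q ∈ Q → q′ ∈ Q → q ≢ w → q′ ≢ w → c q ≢ c q′ →
             Plain H y q × cod H y q ≡ cod H y q′
      near {w} {c} {q} {q′} hole w~y q∈Q q′∈Q q≢w q′≢w cq≢cq′
        with transpose (Hole.cfg hole) (adj (Hole.z∈Q hole) q∈Q (q≢w ∘ sym)) (adj q∈Q q′∈Q (cq≢cq′ ∘ cong c)) (adj q′∈Q (Hole.z∈Q hole) q′≢w)
      ... | transposition {c′} cfg′ c′q c′q′ rest = S.swap-plain , S.swap-cod
        where
        c′y : c′ y ≡ c y
        c′y = rest y (≢y q∈Q ∘ sym) (≢y q′∈Q ∘ sym) (proj₁ w~y ∘ sym)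
        same : ∀ x → Adj H y x → x ≢ q → x ≢ q′ → upd c w (c y) x ≡ upd c′ w (c′ y) x
        same x _ x≢q x≢q′ = upd-cong (sym c′y) (λ x≢w → sym (rest x x≢q x≢q′ x≢w))
        module S = Swap (slide (Hole.cfg hole) w~y) (slide cfg′ w~y) (≢y q∈Q) (≢y q′∈Q) same
          (trans (upd-≢ c′ _ q≢w) (trans c′q (sym (upd-≢ c _ q′≢w)))) (trans (upd-≢ c′ _ q′≢w) (trans c′q′ (sym (upd-≢ c _ q≢w))))
          (λ eq → cq≢cq′ (trans (sym (upd-≢ c _ q≢w)) (trans eq (upd-≢ c _ q′≢w))))

      -- Vertices of equal colour are compared through a partner of the other colour.
      near-all : ∀ {w c q} → Hole Q w c → Adj H w y → q ∈ Q → q ≢ w →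
             ∀ {r} → r ∈ Q → r ≢ w → Plain H y r × cod H y r ≡ cod H y q
      near-all {w} {c} {q} hole w~y q∈Q q≢w {r} r∈Q r≢w with c r ≟F c q | Hole.partner hole (c q)
      ... | no cr≢cq | _ = near hole w~y r∈Q q∈Q r≢w q≢w cr≢cq
      ... | yes cr≡cq | q′ , q′∈Q , q′≢w , cq≢cq′ =
        let pl , eq = near hole w~y r∈Q q′∈Q r≢w q′≢w (λ eq → cq≢cq′ (trans (sym cr≡cq) eq)) in
        pl , trans eq (sym (proj₂ (near hole w~y q∈Q q′∈Q q≢w q′≢w cq≢cq′)))

      module _ {q₁ q₂} (q₁∈Q : q₁ ∈ Q) (q₂∈Q : q₂ ∈ Q) (q₁≢q₂ : q₁ ≢ q₂) (y~q₁ : Adj H y q₁) (y~q₂ : Adj H y q₂) where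

        private
          hole₁ = proj₂ (move q₁ q₁∈Q)
          hole₂ = proj₂ (move q₂ q₂∈Q)
          module h₁ = Hole hole₁

          q₁~y = Adj-sym H y~q₁
          q₂~y = Adj-sym H y~q₂

          from₁ : ∀ {r} → r ∈ Q → r ≢ q₁ → Plain H y r × cod H y r ≡ cod H y q₂
          from₁ = near-all hole₁ q₁~y q₂∈Q (q₁≢q₂ ∘ sym)

          from₂ : ∀ {r} → r ∈ Q → r ≢ q₂ → Plain H y r × cod H y r ≡ cod H y q₁
          from₂ = near-all hole₂ q₂~y q₁∈Q q₁≢q₂

          -- Each of `from₁` and `from₂` omits one of the two vertices; a third vertex of `Q` links
          -- them.
          cod₁≡cod₂ : cod H y q₁ ≡ cod H y q₂
          cod₁≡cod₂ with h₁.third q₂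
          ... | r , r∈Q , r≢q₁ , r≢q₂ = trans (sym (proj₂ (from₂ r∈Q r≢q₂))) (proj₂ (from₁ r∈Q r≢q₁))

          -- The common multiplicity towards `y` still has to be compared with that inside `Q`. For
          -- this the hole is put at `q₁` and `q` is chosen with a colour unlike that of `y`, so
          -- that `q₁ y q` is a triangle to turn around.
          t≡cod : t ≡ cod H y q₁
          t≡cod with h₁.partner (proj₁ (move q₁ q₁∈Q) y)
          ... | q , q∈Q , q≢q₁ , neq = trans (sym (codt q₁∈Q q∈Q (q≢q₁ ∘ sym)))
            (trans (sym (proj₂ (proj₂ (triangle h₁.cfg q₁~y (cod⇒Adj H (≢y q∈Q ∘ sym) y~q) (adj q∈Q q₁∈Q q≢q₁) neq)))) (cod-sym H q₁ y))
            where
            y~q : 0 < cod H y q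
            y~q = subst (0 <_) (sym (proj₂ (from₁ q∈Q q≢q₁))) (Adj⇒cod H y~q₂)

          all : ∀ {r} → r ∈ Q → Plain H y r × cod H y r ≡ t
          all {r} r∈Q with r ≟F q₁
          ... | yes refl = proj₁ (from₂ r∈Q q₁≢q₂) , sym t≡cod
          ... | no r≢q₁ = let pl , eq = from₁ r∈Q r≢q₁ in pl , trans eq (trans (sym cod₁≡cod₂) (sym t≡cod))

        enlarge : Clique (Q ∪ ⁅ y ⁆) t
        enlarge = record
          { 0<t = 0<t
          ; plain = plain′
          ; codt = codt′
          ; hole = record { cfg = Hole.cfg hole ; z∈Q = in′ (Hole.z∈Q hole) ; a∈Q = in′ (Hole.a∈Q hole) ; b∈Q = in′ (Hole.b∈Q hole)
            ; a≢z = Hole.a≢z hole ; b≢z = Hole.b≢z hole ; ca≢cb = Hole.ca≢cb hole } }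
          where
          in′ : ∀ {x} → x ∈ Q → x ∈ Q ∪ ⁅ y ⁆
          in′ x∈Q = x∈p∪q⁺ (inj₁ x∈Q)
          out′ : ∀ {x} → x ∈ Q ∪ ⁅ y ⁆ → x ∈ Q ⊎ x ≡ y
          out′ x∈ with x∈p∪q⁻ Q ⁅ y ⁆ x∈
          ... | inj₁ x∈Q = inj₁ x∈Q
          ... | inj₂ x∈y = inj₂ (x∈⁅y⁆⇒x≡y y x∈y)
          plain′ : ∀ {u v} → u ∈ Q ∪ ⁅ y ⁆ → v ∈ Q ∪ ⁅ y ⁆ → u ≢ v → Plain H u v
          plain′ u∈ v∈ u≢v with out′ u∈ | out′ v∈
          ... | inj₁ u∈Q | inj₁ v∈Q = plain u∈Q v∈Q u≢v
          ... | inj₁ u∈Q | inj₂ refl = Plain-sym H (proj₁ (all u∈Q))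
          ... | inj₂ refl | inj₁ v∈Q = proj₁ (all v∈Q)
          ... | inj₂ refl | inj₂ refl = ⊥-elim (u≢v refl)
          codt′ : ∀ {u v} → u ∈ Q ∪ ⁅ y ⁆ → v ∈ Q ∪ ⁅ y ⁆ → u ≢ v → cod H u v ≡ t
          codt′ u∈ v∈ u≢v with out′ u∈ | out′ v∈
          ... | inj₁ u∈Q | inj₁ v∈Q = codt u∈Q v∈Q u≢v
          ... | inj₁ u∈Q | inj₂ refl = trans (cod-sym H _ _) (proj₂ (all u∈Q))
          ... | inj₂ refl | inj₁ v∈Q = proj₂ (all v∈Q)
          ... | inj₂ refl | inj₂ refl = ⊥-elim (u≢v refl)

    -- A component outside `Q` that is attached at `w` also reaches some `q ≢ w`, through a vertex
    -- `y`. Carrying to `y` the configurations before and after a turn around `w q q′` shows that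
    -- `y` sees `q′` just as often as `q`. Two neighbours in `Q` suffice for `enlarge`.
    grow : ∀ {x} → x ∉ Q → (∀ y → y ∉ Q → Clique (Q ∪ ⁅ y ⁆) t → ⊥) → ⊥
    grow {x} x∉Q k with proj₂ conn Q (z , Hole.z∈Q hole) (x , x∉Q)
    ... | e , (w , w∈e , w∈Q) , (y₀ , y₀∈e , y₀∉Q) with move w w∈Q
    ... | c , hole with Hole.third hole w
    ... | x₀ , x₀∈Q , x₀≢w , _ = reach-another H nosep (_∈? Q) w∈Q x₀∈Q x₀≢w y₀∉Q spread
      where
      w~y₀ : Adj H w y₀
      w~y₀ = (λ { refl → y₀∉Q w∈Q }) , e , w∈e , y₀∈e
      spread : ∀ y q → Reach H (_∈ Q) y₀ y → q ∈ Q → q ≢ w → Adj H y q → ⊥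
      spread y q r q∈Q q≢w y~q with Hole.partner hole (c q)
      ... | q′ , q′∈Q , q′≢w , cq≢cq′
        with transpose (Hole.cfg hole) (adj w∈Q q∈Q (q≢w ∘ sym)) (adj q∈Q q′∈Q (cq≢cq′ ∘ cong c)) (adj q′∈Q w∈Q q′≢w)
      ... | transposition {c̃} cfg̃ c̃q c̃q′ rest
        with carry w∈Q w~y₀ (Hole.cfg hole) cfg̃
               (λ v v∉Q → sym (rest v (λ { refl → v∉Q q∈Q }) (λ { refl → v∉Q q′∈Q }) (λ { refl → v∉Q w∈Q }))) r
      ... | c₁ , c₂ , cfg₁ , cfg₂ , on , off = k y y∉Q (Outside.enlarge y∉Q q∈Q q′∈Q (cq≢cq′ ∘ cong c) y~q (cod⇒Adj H (≢y q′∈Q) y~q′))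
        where
        y∉Q : y ∉ Q
        y∉Q = Reach⇒∉ H r
        ≢y : ∀ {x} → x ∈ Q → y ≢ x
        ≢y x∈Q refl = y∉Q x∈Q
        same : ∀ x → Adj H y x → x ≢ q → x ≢ q′ → c₁ x ≡ c₂ x
        same x _ x≢q x≢q′ with x ∈? Q | x ≟F w
        ... | no x∉Q | _ = off x (⊥-elim ∘ x∉Q)
        ... | yes x∈Q | yes x≡w = off x (λ _ → x≡w)
        ... | yes x∈Q | no x≢w = trans (proj₁ (on x x∈Q x≢w)) (trans (sym (rest x x≢q x≢q′ x≢w)) (sym (proj₂ (on x x∈Q x≢w))))
        module S = Swap cfg₁ cfg₂ (≢y q∈Q ∘ sym) (≢y q′∈Q ∘ sym) same
          (trans (proj₂ (on q q∈Q q≢w)) (trans c̃q (sym (proj₁ (on q′ q′∈Q q′≢w)))))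
          (trans (proj₂ (on q′ q′∈Q q′≢w)) (trans c̃q′ (sym (proj₁ (on q q∈Q q≢w)))))
          (λ eq → cq≢cq′ (trans (sym (proj₁ (on q q∈Q q≢w))) (trans eq (proj₁ (on q′ q′∈Q q′≢w)))))
        y~q′ : 0 < cod H y q′
        y~q′ = subst (0 <_) S.swap-cod (Adj⇒cod H y~q)

  saturate : ∀ k {Q t} → # (λ v → ¬? (v ∈? Q)) ≤ k → Clique Q t → (∀ Q t → (∀ v → v ∈ Q) → Clique Q t → ⊥) → ⊥
  saturate k {Q} le clique done with any? (λ v → ¬? (v ∈? Q))
  ... | no none = done _ _ (λ v → decidable-stable (v ∈? Q) (λ v∉Q → none (v , v∉Q))) clique
  saturate zero {Q} le clique done | yes (x , x∉Q) = <⇒≱ (#-some (λ v → ¬? (v ∈? Q)) x x∉Q) le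
  saturate (suc k) {Q} le clique done | yes (x , x∉Q) = Clique.grow clique x∉Q λ y y∉Q clique′ →
    saturate k (≤-pred (<-≤-trans (#-mono-< (λ v → ¬? (v ∈? (Q ∪ ⁅ y ⁆))) (λ v → ¬? (v ∈? Q))
      (λ v v∉ v∈ → v∉ (x∈p∪q⁺ (inj₁ v∈))) y y∉Q (λ y∉ → y∉ (x∈p∪q⁺ (inj₂ (x∈⁅x⁆ y))))) le)) clique′ done

  module _ (B : BiPath 1) where

    open BiPath B

    private
      module P = Path path

      a~b : Adj H a b
      a~b = subst (λ x → Adj H x b) P.first (subst (Adj H (P.Y 0)) P.last (P.adj 0 (s≤s z≤n)))

      b~z : Adj H b z
      b~z = Adj-sym H z~b

      z≢a : z ≢ a
      z≢a = proj₁ z~a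

      z≢b : z ≢ b
      z≢b = proj₁ z~b

      at-z : Plain H z a × Plain H z b × cod H z a ≡ cod H z b
      at-z = triangle cfg z~a a~b b~z ca≢cb

      -- With the hole at `a`, the vertex `z` wears the former colour of `a`, so `z` and `b` still
      -- differ in colour.
      at-a : Plain H a b × Plain H a z × cod H a b ≡ cod H a z
      at-a = triangle (slide cfg z~a) a~b b~z z~a (λ eq → ca≢cb (sym (trans (sym (upd-≢ c _ (proj₁ b~z))) (trans eq (upd-≡ c z _)))))

      data Corner (v : V) : Set where
        is-z : v ≡ z → Corner v
        is-a : v ≡ a → Corner v
        is-b : v ≡ b → Corner v

      corner? : Decidable Corner
      corner? v with v ≟F z | v ≟F a | v ≟F b
      ... | yes eq | _ | _ = yes (is-z eq)
      ... | no _ | yes eq | _ = yes (is-a eq)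
      ... | no _ | no _ | yes eq = yes (is-b eq)
      ... | no ¬z | no ¬a | no ¬b = no λ { (is-z eq) → ¬z eq ; (is-a eq) → ¬a eq ; (is-b eq) → ¬b eq }

      Q : Subset (nV H)
      Q = ⟪ corner? ⟫

      corner-pair : ∀ {u v} → Corner u → Corner v → u ≢ v → Plain H u v × cod H u v ≡ cod H z a
      corner-pair (is-z refl) (is-z refl) u≢v = ⊥-elim (u≢v refl)
      corner-pair (is-a refl) (is-a refl) u≢v = ⊥-elim (u≢v refl)
      corner-pair (is-b refl) (is-b refl) u≢v = ⊥-elim (u≢v refl)
      corner-pair (is-z refl) (is-a refl) u≢v = proj₁ at-z , refl
      corner-pair (is-z refl) (is-b refl) u≢v = proj₁ (proj₂ at-z) , sym (proj₂ (proj₂ at-z))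
      corner-pair (is-a refl) (is-z refl) u≢v = proj₁ (proj₂ at-a) , cod-sym H _ _
      corner-pair (is-a refl) (is-b refl) u≢v = proj₁ at-a , trans (proj₂ (proj₂ at-a)) (cod-sym H _ _)
      corner-pair (is-b refl) (is-z refl) u≢v = Plain-sym H (proj₁ (proj₂ at-z)) , trans (cod-sym H _ _) (sym (proj₂ (proj₂ at-z)))
      corner-pair (is-b refl) (is-a refl) u≢v = Plain-sym H (proj₁ at-a) , trans (cod-sym H _ _) (trans (proj₂ (proj₂ at-a)) (cod-sym H _ _))

    triangle-clique : Clique Q (cod H z a)
    triangle-clique = record
      { 0<t = Adj⇒cod H z~a
      ; plain = λ u∈ v∈ u≢v → proj₁ (corner-pair (∈⟪⟫⁻ corner? u∈) (∈⟪⟫⁻ corner? v∈) u≢v)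
      ; codt = λ u∈ v∈ u≢v → proj₂ (corner-pair (∈⟪⟫⁻ corner? u∈) (∈⟪⟫⁻ corner? v∈) u≢v)
      ; hole = record { cfg = cfg ; z∈Q = ∈⟪⟫⁺ corner? (is-z refl) ; a∈Q = ∈⟪⟫⁺ corner? (is-a refl) ; b∈Q = ∈⟪⟫⁺ corner? (is-b refl)
                      ; a≢z = λ eq → z≢a (sym eq) ; b≢z = λ eq → z≢b (sym eq) ; ca≢cb = ca≢cb } }

  module Spanning {Q t} (all∈Q : ∀ v → v ∈ Q) (K : Clique Q t) where

    open Clique K
    open Hole hole

    private
      plain! : ∀ {u v} → u ≢ v → Plain H u v
      plain! u≢v = plain (all∈Q _) (all∈Q _) u≢v

      cod! : ∀ {u v} → u ≢ v → cod H u v ≡ t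
      cod! u≢v = codt (all∈Q _) (all∈Q _) u≢v

      ordinary : ∀ e → Ordinary H e
      ordinary e = u , v , u≢v , plain-inc H (plain! u≢v) (other∈ e z) (other∈ e u)
        where
        u v : V
        u = other e z
        v = other e u
        u≢v : u ≢ v
        u≢v eq = other≢ e u (sym eq)

      count : (V → Fin p) → V → Fin p → ℕ
      count c y i = # (λ x → (c x ≟F i) ×-dec ¬? (x ≟F y))

      f≡count : ∀ {y c} → Config H f y c → ∀ i → f y i ≡ t * count c y i
      f≡count {y} {c} cfg i = begin
        f y i  ≡⟨ f≡C cfg i ⟩
        # (CAt? c y i)  ≡⟨ sym (#-fibres (CAt? c y i) (λ e → other e y)) ⟩
        ∑ (λ x → # (fibre? x))  ≡⟨ ∑-cong fibre ⟩
        ∑ (λ x → χ ((c x ≟F i) ×-dec ¬? (x ≟F y)) * t)  ≡⟨ ∑-χ* (λ x → (c x ≟F i) ×-dec ¬? (x ≟F y)) t ⟩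
        count c y i * t  ≡⟨ *-comm (count c y i) t ⟩
        t * count c y i  ∎
        where
        open ≡-Reasoning
        fibre? : ∀ x → Decidable (λ e → CAt c y i e × other e y ≡ x)
        fibre? x e = CAt? c y i e ×-dec (other e y ≟F x)
        fibre : ∀ x → # (fibre? x) ≡ χ ((c x ≟F i) ×-dec ¬? (x ≟F y)) * t
        fibre x with c x ≟F i | x ≟F y
        ... | no neq | _ = #-none (fibre? x) (λ { e ((_ , eq) , refl) → neq eq })
        ... | yes _ | yes refl = #-none (fibre? x) (λ e (_ , eq) → other≢ e y eq)
        ... | yes eq | no x≢y = trans (#-cong (fibre? x) (λ e → (y ∈? inc H e) ×-dec (x ∈? inc H e))
          (λ { e ((y∈e , _) , refl) → y∈e , other∈ e y }) (λ e (y∈e , x∈e) → (y∈e , trans (sym (mono-other cfg y∈e x∈e x≢y)) eq) , is-x e y∈e x∈e))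
          (trans (cod! (λ eq → x≢y (sym eq))) (sym (*-identityˡ t)))
          where
          is-x : ∀ e → y ∈ inc H e → x ∈ inc H e → other e y ≡ x
          is-x e y∈e x∈e with plain! (λ eq → x≢y (sym eq)) e y∈e x∈e (other e y) (other∈ e y)
          ... | inj₁ eq = ⊥-elim (other≢ e y eq)
          ... | inj₂ eq = eq

      -- When the hole moves to `y`, the vertex `z` replaces `y` in the same colour class. Hence the
      -- class sizes, the future `ns`, do not depend on the hole.
      count-slide : ∀ {y} → y ≢ z → ∀ i → count (upd c z (c y)) y i ≡ count c z i
      count-slide {y} y≢z i = begin
        # L?  ≡⟨ #-remove L? z ⟩
        χ (L? z) + # (λ x → L? x ×-dec ¬? (x ≟F z))  ≡⟨ cong₂ _+_ one rest ⟩
        χ (R? y) + # (λ x → R? x ×-dec ¬? (x ≟F y))  ≡⟨ sym (#-remove R? y) ⟩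
        # R?  ∎
        where
        open ≡-Reasoning
        c′ : V → Fin p
        c′ = upd c z (c y)
        L? : Decidable (λ x → c′ x ≡ i × ¬ (x ≡ y))
        L? x = (c′ x ≟F i) ×-dec ¬? (x ≟F y)
        R? : Decidable (λ x → c x ≡ i × ¬ (x ≡ z))
        R? x = (c x ≟F i) ×-dec ¬? (x ≟F z)
        one : χ (L? z) ≡ χ (R? y)
        one = ≤-antisym (χ-mono (L? z) (R? y) (λ (eq , _) → trans (sym (upd-≡ c z _)) eq , y≢z))
                        (χ-mono (R? y) (L? z) (λ (eq , _) → trans (upd-≡ c z _) eq , λ eq → y≢z (sym eq)))
        rest : # (λ x → L? x ×-dec ¬? (x ≟F z)) ≡ # (λ x → R? x ×-dec ¬? (x ≟F y))
        rest = #-cong (λ x → L? x ×-dec ¬? (x ≟F z)) (λ x → R? x ×-dec ¬? (x ≟F y))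
          (λ x ((eq , x≢y) , x≢z) → (trans (sym (upd-≢ c _ x≢z)) eq , x≢z) , x≢y)
          (λ x ((eq , x≢z) , x≢y) → (trans (upd-≢ c _ x≢z) eq , x≢y) , x≢z)

      f≡ : ∀ v i → f v i ≡ t * count c z i
      f≡ v i with v ≟F z
      ... | yes refl = f≡count cfg i
      ... | no v≢z = trans (f≡count (slide cfg (adj z∈Q (all∈Q v) (λ eq → v≢z (sym eq)))) i) (cong (t *_) (count-slide v≢z i))

      nV≡ : nV H ≡ suc (# (λ x → ¬? (x ≟F z)))
      nV≡ = begin
        nV H  ≡⟨ sym (#-all {P = λ _ → ⊤} (λ _ → yes tt) (λ _ → tt)) ⟩
        # {P = λ _ → ⊤} (λ _ → yes tt)  ≡⟨ #-remove {P = λ _ → ⊤} (λ _ → yes tt) z ⟩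
        suc (# (λ x → yes tt ×-dec ¬? (x ≟F z)))  ≡⟨ cong suc (#-cong (λ x → yes tt ×-dec ¬? (x ≟F z)) (λ x → ¬? (x ≟F z)) (λ _ → proj₂) (λ _ x≢z → tt , x≢z)) ⟩
        suc (# (λ x → ¬? (x ≟F z)))  ∎
        where open ≡-Reasoning

      nonzero : ∀ {x} → x ≢ z → count c z (c x) ≢ 0
      nonzero {x} x≢z eq = <⇒≢ (#-some (λ y → (c y ≟F c x) ×-dec ¬? (y ≟F z)) x (refl , x≢z)) (sym eq)

      total : sum (tabulate (count c z)) ≡ nV H ∸ 1
      total = begin
        sum (tabulate (count c z))  ≡⟨ sum-tabulate (count c z) ⟩
        ∑ (count c z)  ≡⟨ ∑-cong (λ i → #-cong (λ x → (c x ≟F i) ×-dec ¬? (x ≟F z)) (λ x → ¬? (x ≟F z) ×-dec (c x ≟F i))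
                            (λ x (p , q) → q , p) (λ x (p , q) → q , p)) ⟩
        ∑ (λ i → # (λ x → ¬? (x ≟F z) ×-dec (c x ≟F i)))  ≡⟨ #-fibres (λ x → ¬? (x ≟F z)) c ⟩
        # (λ x → ¬? (x ≟F z))  ≡⟨ cong (_∸ 1) (sym nV≡) ⟩
        nV H ∸ 1  ∎
        where open ≡-Reasoning

    hard : HardPair H f
    hard = hardK t 0<t
      (subst (3 ≤_) (sym nV≡) (s≤s (#≥2 (λ x → ¬? (x ≟F z)) a b a≢b a≢z b≢z)))
      (ordinary , λ u v u≢v → trans (plain-joinCount H (plain! u≢v)) (cod! u≢v))
      (count c z) (c a , c b , ca≢cb , nonzero a≢z , nonzero b≢z) total f≡

  triangle-hard : BiPath 1 → (HardPair H f → ⊥) → ⊥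
  triangle-hard B k = saturate _ ≤-refl (triangle-clique B) (λ Q t all∈Q K → k (Spanning.hard all∈Q K))

  -- Odd cycles from a shortest path of length at least two

  module _ {l : ℕ} (2≤l : 2 ≤ l) (min : Min l) where

    -- The cycle has the `l + 1` vertices of the path and the hole.
    N : ℕ
    N = suc (suc l)

    -- The cycle is a periodic sequence on ℕ with the hole at index 0, so that moving the hole
    -- forward is a shift of the index.
    record Cyc (c : V → Fin p) (Z : ℕ → V) : Set where
      field
        cfg : Config H f (Z 0) c
        per : ∀ i → Z (i + N) ≡ Z i
        adj : ∀ i → Adj H (Z i) (Z (suc i))
        inj : ∀ i d → 0 < d → d < N → Z (i + d) ≢ Z i
        bi  : c (Z 1) ≢ c (Z (suc l))

    module FromPath (B : BiPath l) where

      open BiPath B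
      module P = Path path

      next : ℕ → ℕ
      next r with r ≟ suc l
      ... | yes _ = 0
      ... | no _ = suc r

      next-< : ∀ {r} → r ≢ suc l → next r ≡ suc r
      next-< {r} r≢ with r ≟ suc l
      ... | yes eq = ⊥-elim (r≢ eq)
      ... | no _ = refl

      next-last : next (suc l) ≡ 0
      next-last with suc l ≟ suc l
      ... | yes _ = refl
      ... | no ¬eq = ⊥-elim (¬eq refl)

      next-inj : ∀ r s → next r ≡ next s → r ≡ s
      next-inj r s eq with r ≟ suc l | s ≟ suc l
      ... | yes r≡ | yes s≡ = trans r≡ (sym s≡)
      ... | no _ | no _ = suc-injective eq
      next-inj r s () | yes _ | no _
      next-inj r s () | no _ | yes _

      -- The residue modulo `N`, obtained by iterating the cyclic successor so that it commutes with
      -- `suc` by definition.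
      idx : ℕ → ℕ
      idx zero = 0
      idx (suc i) = next (idx i)

      idx-< : ∀ i → idx i < N
      idx-< zero = s≤s z≤n
      idx-< (suc i) with idx i ≟ suc l | idx-< i
      ... | yes _ | _ = s≤s z≤n
      ... | no ne | lt = s≤s (≤∧≢⇒< (≤-pred lt) ne)

      idx-small : ∀ i → i < N → idx i ≡ i
      idx-small zero _ = refl
      idx-small (suc i) si<N = trans (cong next (idx-small i (<-trans (n<1+n i) si<N))) (next-< (λ { refl → <-irrefl refl si<N }))

      idx-per : ∀ i → idx (i + N) ≡ idx i
      idx-per zero = trans (cong next (idx-small (suc l) ≤-refl)) next-last
      idx-per (suc i) = cong next (idx-per i)

      idx-inj : ∀ i d → 0 < d → d < N → idx (i + d) ≢ idx i
      idx-inj zero d 0<d d<N eq = <⇒≢ 0<d (sym (trans (sym (idx-small d d<N)) eq))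
      idx-inj (suc i) d 0<d d<N eq = idx-inj i d 0<d d<N (next-inj _ _ eq)

      at : ℕ → V
      at zero = z
      at (suc q) = P.Y q

      -- A repeated vertex could be spliced out, against minimality.
      Y-inj : ∀ {i j} → i < j → j ≤ l → P.Y i ≢ P.Y j
      Y-inj {i} i<j j≤l eq with m≤n⇒∃[o]m+o≡n i<j
      ... | o , refl with m≤n⇒∃[o]m+o≡n j≤l
      ... | r , refl = min k k<l record { BiPath B hiding (path) ; path = splice H (suc o) k i (m≤m+n i r)
              (subst (Path H z a b) (sym l≡) path) (trans (Y≡ i) (trans eq (trans (cong P.Y (cong suc (+-comm i o))) (sym (Y≡ (suc o + i)))))) }
        where
        k : ℕ
        k = i + r
        l≡ : suc o + k ≡ suc (i + o + r)
        l≡ = cong suc (trans (sym (+-assoc o i r)) (cong (_+ r) (+-comm o i)))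
        k<l : k < suc (i + o + r)
        k<l = s≤s (+-monoˡ-≤ r (m≤m+n i o))
        Y-subst : ∀ {m m′} (eq : m ≡ m′) (Q : Path H z a b m) j → Path.Y (subst (Path H z a b) eq Q) j ≡ Path.Y Q j
        Y-subst refl Q j = refl
        Y≡ : ∀ j → Path.Y (subst (Path H z a b) (sym l≡) path) j ≡ P.Y j
        Y≡ = Y-subst (sym l≡) path

      at-inj : ∀ r s → r < N → s < N → at r ≡ at s → r ≡ s
      at-inj zero zero _ _ _ = refl
      at-inj zero (suc s) _ (s≤s s<) eq = ⊥-elim (P.avoid s (≤-pred s<) (sym eq))
      at-inj (suc r) zero (s≤s r<) _ eq = ⊥-elim (P.avoid r (≤-pred r<) eq)
      at-inj (suc r) (suc s) (s≤s r<) (s≤s s<) eq with <-cmp r s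
      ... | tri< r<s _ _ = ⊥-elim (Y-inj r<s (≤-pred s<) eq)
      ... | tri≈ _ r≡s _ = cong suc r≡s
      ... | tri> _ _ s<r = ⊥-elim (Y-inj s<r (≤-pred r<) (sym eq))

      at-adj : ∀ r → r < N → Adj H (at r) (at (next r))
      at-adj r r<N with r ≟ suc l
      at-adj .(suc l) r<N | yes refl = Adj-sym H (subst (Adj H z) (sym P.last) z~b)
      at-adj zero r<N | no _ = subst (Adj H z) (sym P.first) z~a
      at-adj (suc q) (s≤s q≤l) | no ne = P.adj q (≤∧≢⇒< (≤-pred q≤l) (λ eq → ne (cong suc eq)))

      cyc : Cyc c (λ i → at (idx i))
      cyc = record
        { cfg = cfg
        ; per = λ i → cong at (idx-per i)
        ; adj = λ i → at-adj (idx i) (idx-< i)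
        ; inj = λ i d 0<d d<N eq → idx-inj i d 0<d d<N (at-inj _ _ (idx-< (i + d)) (idx-< i) eq)
        ; bi = λ eq → ca≢cb (trans (cong c (trans (sym P.first) (sym (cong at (idx-small 1 (s≤s (s≤s z≤n)))))))
                 (trans eq (cong c (trans (cong at (idx-small (suc l) ≤-refl)) P.last)))) }

    module Rotate {c Z} (C : Cyc c Z) where

      open Cyc C public

      apart : ∀ {i j} → i < j → j < N → Z i ≢ Z j
      apart {i} i<j j<N eq with m≤n⇒∃[o]m+o≡n i<j
      ... | o , refl = inj i (suc o) (s≤s z≤n) (≤-<-trans (s≤s (m≤n+m o i)) j<N) (trans (cong Z (+-suc i o)) (sym eq))

      -- A chord from the hole ends in a vertex whose colour differs from that of `Z 1` or from that
      -- of `Z (suc l)`. The corresponding arc is then a shorter path between differently coloured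
      -- neighbours of the hole.
      nbr : ∀ i → i ≤ l → Adj H (Z 0) (Z (suc i)) → i ≡ 0 ⊎ i ≡ l
      nbr i i≤l Z₀~ with i ≟ 0 | i ≟ l
      ... | yes eq | _ = inj₁ eq
      ... | no _ | yes eq = inj₂ eq
      ... | no i≢0 | no i≢l with c (Z 1) ≟F c (Z (suc i))
      ... | no neq = ⊥-elim (min i (≤∧≢⇒< i≤l i≢l) record { cfg = cfg ; z~a = adj 0 ; z~b = Z₀~ ; ca≢cb = neq ; path = record
             { Y = λ t → Z (suc t) ; first = refl ; last = refl
             ; avoid = λ t t≤i → λ eq → apart (s≤s z≤n) (s≤s (s≤s (≤-trans t≤i i≤l))) (sym eq) ; adj = λ t _ → adj (suc t) } })
      ... | yes same with m≤n⇒∃[o]m+o≡n i≤l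
      ... | k , refl = ⊥-elim (min k (+-monoˡ-≤ k (n≢0⇒n>0 i≢0)) record { cfg = cfg ; z~a = Z₀~
             ; z~b = Adj-sym H (subst (Adj H (Z (suc l))) (per 0) (adj (suc l)))
             ; ca≢cb = λ eq → bi (trans same eq) ; path = record
             { Y = λ t → Z (suc (i + t)) ; first = cong (λ m → Z (suc m)) (+-identityʳ i) ; last = refl
             ; avoid = λ t t≤k eq → apart (s≤s z≤n) (s≤s (s≤s (+-monoʳ-≤ i t≤k))) (sym eq)
             ; adj = λ t _ → subst (λ m → Adj H (Z (suc (i + t))) (Z (suc m))) (sym (+-suc i t)) (adj (suc (i + t))) } })

      turn : ℕ → V → Fin p
      turn zero = c
      turn (suc s) = upd (turn s) (Z s) (turn s (Z (suc s)))

      turn-cfg : ∀ s → Config H f (Z s) (turn s)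
      turn-cfg zero = cfg
      turn-cfg (suc s) = slide (turn-cfg s) (adj s)

      turn-off : ∀ s {v} → (∀ j → j < s → v ≢ Z j) → turn s v ≡ c v
      turn-off zero _ = refl
      turn-off (suc s) ne = trans (upd-≢ (turn s) _ (ne s ≤-refl)) (turn-off s (λ j j<s → ne j (m≤n⇒m≤1+n j<s)))

      turn-on : ∀ s → s < N → ∀ j → j < s → turn s (Z j) ≡ c (Z (suc j))
      turn-on (suc s) s<N j (s≤s j≤s) with m≤n⇒m<n∨m≡n j≤s
      ... | inj₁ j<s = trans (upd-≢ (turn s) _ (apart j<s (<-trans (n<1+n s) s<N))) (turn-on s (<-trans (n<1+n s) s<N) j j<s)
      ... | inj₂ refl = trans (upd-≡ (turn s) _ _) (turn-off s (λ j j<s eq → apart (m≤n⇒m≤1+n j<s) s<N (sym eq)))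

      -- After a full turn the hole is back at `Z 0`, and the colours on `Z 1`, ..., `Z (suc l)` are
      -- shifted cyclically by one place.
      c̃ : V → Fin p
      c̃ = turn N

      opaque

        cfg̃ : Config H f (Z 0) c̃
        cfg̃ = subst (λ v → Config H f v c̃) (per 0) (turn-cfg N)

        c̃-shift : ∀ j → j ≤ l → c̃ (Z j) ≡ c (Z (suc j))
        c̃-shift j j≤l = trans (upd-≢ (turn (suc l)) _ (apart (s≤s j≤l) ≤-refl)) (turn-on (suc l) ≤-refl j (s≤s j≤l))

        c̃-last : c̃ (Z (suc l)) ≡ c (Z 1)
        c̃-last = trans (upd-≡ (turn (suc l)) _ _) (trans (cong (turn (suc l)) (per 0)) (turn-on (suc l) ≤-refl 0 (s≤s z≤n)))

        c̃-off : ∀ {v} → (∀ j → j < N → v ≢ Z j) → c̃ v ≡ c v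
        c̃-off = turn-off N

      data Place (v : V) : Set where
        on  : ∀ j → j < N → v ≡ Z j → Place v
        off : (∀ j → j < N → v ≢ Z j) → Place v

      opaque

        place : ∀ v → Place v
        place v with any? {n = N} (λ j → v ≟F Z (toℕ j))
        ... | yes (j , eq) = on (toℕ j) (toℕ<n j) eq
        ... | no none = off (λ j j<N eq → none (fromℕ< j<N , trans eq (cong Z (sym (toℕ-fromℕ< j<N)))))

      data Nbr (x : V) : Set where
        right : x ≡ Z 1 → Nbr x
        left  : x ≡ Z (suc l) → Nbr x
        outer : (∀ j → j < N → x ≢ Z j) → Nbr x

      opaque

        neighbour : ∀ {x} → Adj H (Z 0) x → Nbr x
        neighbour {x} Z₀~x with place x
        ... | off ne = outer ne
        ... | on zero _ eq = ⊥-elim (proj₁ Z₀~x (sym eq))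
        ... | on (suc i) (s≤s i≤l) refl with nbr i (≤-pred i≤l) Z₀~x
        ... | inj₁ refl = right refl
        ... | inj₂ refl = left refl

        Z₀~left : Adj H (Z 0) (Z (suc l))
        Z₀~left = Adj-sym H (subst (Adj H (Z (suc l))) (per 0) (adj (suc l)))

      1≤l : 1 ≤ l
      1≤l = ≤-trans (s≤s z≤n) 2≤l

      -- Otherwise neither cycle neighbour of the hole would have the colour of `Z (suc l)` after
      -- the turn, although one of them had it before and the vertices off the cycle keep theirs.
      -- This contradicts `colour-transfer`.
      second≡last : c (Z 2) ≡ c (Z (suc l))
      second≡last with c (Z 2) ≟F c (Z (suc l))
      ... | yes eq = eq
      ... | no neq = ⊥-elim (bi (trans (sym c̃-last) (colour-transfer cfg̃ cfg (c (Z (suc l))) c̃⇒c (Z (suc l)) Z₀~left refl)))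
        where
        c̃⇒c : ∀ x → Adj H (Z 0) x → c̃ x ≡ c (Z (suc l)) → c x ≡ c (Z (suc l))
        c̃⇒c x Z₀~x eq with neighbour Z₀~x
        ... | right refl = ⊥-elim (neq (trans (sym (c̃-shift 1 1≤l)) eq))
        ... | left refl = refl
        ... | outer ne = trans (sym (c̃-off ne)) eq

      private
        same : ∀ x → Adj H (Z 0) x → x ≢ Z 1 → x ≢ Z (suc l) → c x ≡ c̃ x
        same x Z₀~x x≢1 x≢l with neighbour Z₀~x
        ... | right eq = ⊥-elim (x≢1 eq)
        ... | left eq = ⊥-elim (x≢l eq)
        ... | outer ne = sym (c̃-off ne)

        -- By `second≡last` the full turn merely exchanges, among the neighbours of the hole, the
        -- colours of its two cycle neighbours.
        module S = Swap cfg cfg̃ {Z 1} {Z (suc l)} (λ eq → proj₁ (adj 0) (sym eq)) (λ eq → proj₁ Z₀~left (sym eq)) same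
          (trans (c̃-shift 1 1≤l) second≡last) c̃-last bi

      plain₀ : Plain H (Z 0) (Z 1)
      plain₀ = S.swap-plain

      cod₀ : cod H (Z 0) (Z 1) ≡ cod H (Z 0) (Z (suc l))
      cod₀ = S.swap-cod

      c′ : V → Fin p
      c′ = upd c (Z 0) (c (Z 1))

      c′-later : ∀ {j} → 0 < j → j < N → c′ (Z j) ≡ c (Z j)
      c′-later 0<j j<N = upd-≢ c _ (λ eq → apart 0<j j<N (sym eq))

      c′-last : c′ (Z N) ≡ c (Z 1)
      c′-last = trans (cong c′ (per 0)) (upd-≡ c _ _)

      -- The new hole `Z 1` lies between `Z 0`, which took the colour of `Z 1`, and `Z 2`, which has
      -- the colour of `Z (suc l)`; these still differ.
      rotate : Cyc c′ (λ i → Z (suc i))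
      rotate = record
        { cfg = slide cfg (adj 0)
        ; per = λ i → per (suc i)
        ; adj = λ i → adj (suc i)
        ; inj = λ i → inj (suc i)
        ; bi = λ eq → bi (trans (sym c′-last) (trans (sym eq) (trans (c′-later (s≤s z≤n) (s≤s (s≤s 1≤l))) second≡last))) }

    -- After one rotation `second≡last` compares `Z 3` with `Z 0`, and `Z 0` then has the old colour
    -- of `Z 1`. Further rotations treat the later vertices.
    alternate : ∀ i {c Z} → Cyc c Z → suc (suc i) ≤ l → c (Z (3 + i)) ≡ c (Z (1 + i))
    alternate zero C 2≤l = trans (sym (Rotate.c′-later C (s≤s z≤n) (s≤s (s≤s 2≤l)))) (trans (Rotate.second≡last (Rotate.rotate C)) (Rotate.c′-last C))
    alternate (suc i) C 3+i≤l = trans (sym (Rotate.c′-later C (s≤s z≤n) (s≤s (s≤s 3+i≤l))))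
      (trans (alternate i (Rotate.rotate C) (≤-trans (n≤1+n _) 3+i≤l)) (Rotate.c′-later C (s≤s z≤n) (s≤s (≤-trans (n≤1+n _) (≤-trans 3+i≤l (n≤1+n _))))))

    alternate-even : ∀ {c Z} → Cyc c Z → ∀ q → q + q ≤ l → c (Z (suc (q + q))) ≡ c (Z 1)
    alternate-even C zero _ = refl
    alternate-even {c} {Z} C (suc q) le = trans (cong (λ m → c (Z (suc (suc m)))) (+-suc q q))
      (trans (alternate (q + q) C le′) (alternate-even C q (≤-trans (≤-trans (n≤1+n _) (n≤1+n _)) le′)))
      where
      le′ : suc (suc (q + q)) ≤ l
      le′ = subst (_≤ l) (cong suc (+-suc q q)) le

    parity : ∀ m → (∃[ q ] m ≡ q + q) ⊎ (∃[ q ] m ≡ suc (q + q))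
    parity zero = inj₁ (0 , refl)
    parity (suc m) with parity m
    ... | inj₁ (q , refl) = inj₂ (q , refl)
    ... | inj₂ (q , refl) = inj₁ (suc q , cong suc (sym (+-suc q q)))

    -- For even `l`, alternation would give the two neighbours of the hole one colour. The cycle
    -- length `l + 2` has the parity of `l`.
    odd : ∀ {c Z} → Cyc c Z → ∃[ q ] l ≡ suc (q + q)
    odd {c} {Z} C with parity l
    ... | inj₂ p = p
    ... | inj₁ (q , l≡) = ⊥-elim (Cyc.bi C (sym (trans (cong (λ m → c (Z (suc m))) l≡) (alternate-even C q (≤-reflexive (sym l≡))))))

    -- Parity excludes `l = 2`. This yields a cycle length of at least 5 and makes any path of
    -- length 2 too short.
    3≤l : ∀ {c Z} → Cyc c Z → 3 ≤ l
    3≤l C with odd C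
    ... | zero , refl = ⊥-elim (<⇒≱ 2≤l ≤-refl)
    ... | suc q , refl = s≤s (s≤s (≤-trans (s≤s z≤n) (m≤n+m (suc q) q)))

    module Colours {c Z} (C : Cyc c Z) where

      open Rotate C

      α β : Fin p
      α = c (Z 1)
      β = c (Z (suc l))

      pairs : ∀ j → suc j ≤ l → (c (Z (1 + j)) ≡ α × c (Z (2 + j)) ≡ β) ⊎ (c (Z (1 + j)) ≡ β × c (Z (2 + j)) ≡ α)
      pairs zero _ = inj₁ (refl , second≡last)
      pairs (suc j) le with pairs j (≤-trans (n≤1+n _) le)
      ... | inj₁ (a , b) = inj₂ (b , trans (alternate j C le) a)
      ... | inj₂ (b , a) = inj₁ (a , trans (alternate j C le) b)

      -- Because the colours alternate, the cyclic shift of a full turn exchanges the two colours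
      -- all along the path.
      colours : ∀ j → j ≤ l → (c (Z (suc j)) ≡ α × c̃ (Z (suc j)) ≡ β) ⊎ (c (Z (suc j)) ≡ β × c̃ (Z (suc j)) ≡ α)
      colours j j≤l with m≤n⇒m<n∨m≡n j≤l
      ... | inj₂ refl = inj₂ (refl , c̃-last)
      ... | inj₁ j<l with pairs j j<l
      ... | inj₁ (a , b) = inj₁ (a , trans (c̃-shift (suc j) j<l) b)
      ... | inj₂ (b , a) = inj₂ (b , trans (c̃-shift (suc j) j<l) a)

    module Closed {c Z} (C : Cyc c Z) {y₀} (y₀∉ : ∀ j → j < N → y₀ ≢ Z j) (Z₀~y₀ : Adj H (Z 0) y₀) where

      open Rotate C
      open Colours C

      OnC : V → Set
      OnC v = ∃[ j ] (j < N × v ≡ Z j)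

      OnC? : Decidable OnC
      OnC? v with place v
      ... | on j j<N eq = yes (j , j<N , eq)
      ... | off ne = no (λ (j , j<N , eq) → ne j j<N eq)

      inner : ∀ {x} → OnC x → x ≢ Z 0 → ∃[ i ] (i ≤ l × x ≡ Z (suc i))
      inner (zero , _ , eq) x≢ = ⊥-elim (x≢ eq)
      inner (suc i , s≤s i≤l , eq) _ = i , ≤-pred i≤l , eq

      on-inner : ∀ {i} → i ≤ l → OnC (Z (suc i)) × Z (suc i) ≢ Z 0
      on-inner i≤l = (_ , s≤s (s≤s i≤l) , refl) , λ eq → apart (s≤s z≤n) (s≤s (s≤s i≤l)) (sym eq)

      module _ {y c₁ c₂} (y∉ : ¬ OnC y) (cfg₁ : Config H f y c₁) (cfg₂ : Config H f y c₂)
               (on-eq : ∀ v → OnC v → v ≢ Z 0 → c₁ v ≡ c v × c₂ v ≡ c̃ v) (off-eq : ∀ v → (OnC v → v ≡ Z 0) → c₁ v ≡ c₂ v) where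

        at₁ : ∀ i → i ≤ l → c₁ (Z (suc i)) ≡ c (Z (suc i))
        at₁ i i≤l = proj₁ (on-eq _ (proj₁ (on-inner i≤l)) (proj₂ (on-inner i≤l)))

        at₂ : ∀ i → i ≤ l → c₂ (Z (suc i)) ≡ c̃ (Z (suc i))
        at₂ i i≤l = proj₂ (on-eq _ (proj₁ (on-inner i≤l)) (proj₂ (on-inner i≤l)))

        -- If `y` saw no cycle vertex of colour `b`, its neighbours of colour `b` under `c₁` would
        -- keep it under `c₂`. Equality of the counts then forbids `Z (suc i)` to acquire colour
        -- `b`.
        both-colours : ∀ {a b i} → a ≢ b → i ≤ l → Adj H y (Z (suc i)) → c (Z (suc i)) ≡ a → c̃ (Z (suc i)) ≡ b →
          ∃[ j ] (j ≤ l × Adj H y (Z (suc j)) × c (Z (suc j)) ≡ b)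
        both-colours {a} {b} {i} a≢b i≤l y~ ca cb
          with any? {n = suc l} (λ j → Adj? H y (Z (suc (toℕ j))) ×-dec (c (Z (suc (toℕ j))) ≟F b))
        ... | yes (j , y~j , eq) = toℕ j , ≤-pred (toℕ<n j) , y~j , eq
        ... | no none = ⊥-elim (a≢b (trans (sym ca) (trans (sym (at₁ i i≤l))
              (colour-transfer cfg₁ cfg₂ b c₁⇒c₂ (Z (suc i)) y~ (trans (at₂ i i≤l) cb)))))
          where
          c₁⇒c₂ : ∀ x → Adj H y x → c₁ x ≡ b → c₂ x ≡ b
          c₁⇒c₂ x y~x eq with OnC? x | x ≟F Z 0
          ... | no x∉ | _ = trans (sym (off-eq x (λ x∈ → ⊥-elim (x∉ x∈)))) eq
          ... | yes _ | yes x≡ = trans (sym (off-eq x (λ _ → x≡))) eq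
          ... | yes x∈ | no x≢ with inner x∈ x≢
          ... | j , j≤l , refl = ⊥-elim (none (fromℕ< (s≤s j≤l) ,
                subst (λ m → Adj H y (Z (suc m)) × c (Z (suc m)) ≡ b) (sym (toℕ-fromℕ< (s≤s j≤l)))
                  (y~x , trans (sym (at₁ j j≤l)) eq)))

        -- The arc between the two contacts joins differently coloured neighbours of the hole `y`,
        -- so by minimality it is the whole path. Then `y` is adjacent to both `Z 1` and
        -- `Z (suc l)`, and the detour through `y` is a path of length 2 for the hole `Z 0`.
        ordered : ∀ {i j} → i < j → j ≤ l → Adj H y (Z (suc i)) → Adj H y (Z (suc j)) → c (Z (suc i)) ≢ c (Z (suc j)) → ⊥
        ordered {i} {j} i<j j≤l y~i y~j neq with m≤n⇒∃[o]m+o≡n (<⇒≤ i<j)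
        ... | d , refl = finish (≮⇒≥ (λ d<l → min d d<l around))
          where
          around : BiPath d
          around = record { cfg = cfg₁ ; z~a = y~i ; z~b = y~j
            ; ca≢cb = λ eq → neq (trans (sym (at₁ i (≤-trans (<⇒≤ i<j) j≤l))) (trans eq (at₁ (i + d) j≤l)))
            ; path = record { Y = λ t → Z (suc (i + t)) ; first = cong (λ m → Z (suc m)) (+-identityʳ i) ; last = refl
              ; avoid = λ t t≤d eq → y∉ (suc (i + t) , s≤s (s≤s (≤-trans (+-monoʳ-≤ i t≤d) j≤l)) , sym eq)
              ; adj = λ t _ → subst (λ m → Adj H (Z (suc (i + t))) (Z (suc m))) (sym (+-suc i t)) (adj (suc (i + t))) } }
          y≢Z₀ : y ≢ Z 0
          y≢Z₀ eq = y∉ (0 , s≤s z≤n , eq)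
          finish : l ≤ d → ⊥
          finish l≤d = min 2 (3≤l C) record { cfg = cfg ; z~a = adj 0 ; z~b = Z₀~left ; ca≢cb = bi
            ; path = path-∷ H (λ eq → apart (s≤s z≤n) (s≤s (s≤s z≤n)) (sym eq)) (Adj-sym H (subst (λ m → Adj H y (Z (suc m))) i≡0 y~i))
                (path-∷ H y≢Z₀ (subst (λ m → Adj H y (Z (suc m))) i+d≡l y~j) (path-[] H (λ eq → proj₁ Z₀~left (sym eq)))) }
            where
            i+d≡l : i + d ≡ l
            i+d≡l = ≤-antisym j≤l (≤-trans l≤d (m≤n+m d i))
            i≡0 : i ≡ 0
            i≡0 = n≤0⇒n≡0 (+-cancelʳ-≤ d i 0 (≤-trans j≤l l≤d))

        unordered : ∀ {i j} → i ≤ l → j ≤ l → Adj H y (Z (suc i)) → Adj H y (Z (suc j)) → c (Z (suc i)) ≢ c (Z (suc j)) → ⊥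
        unordered {i} {j} i≤l j≤l y~i y~j neq with <-cmp i j
        ... | tri< i<j _ _ = ordered i<j j≤l y~i y~j neq
        ... | tri≈ _ refl _ = neq refl
        ... | tri> _ _ j<i = ordered j<i i≤l y~j y~i (λ eq → neq (sym eq))

        no-contact : ∀ {i} → i ≤ l → Adj H y (Z (suc i)) → ⊥
        no-contact {i} i≤l y~ with colours i i≤l
        ... | inj₁ (a , b) with both-colours bi i≤l y~ a b
        ... | j , j≤l , y~j , cj = unordered i≤l j≤l y~ y~j (λ eq → bi (trans (sym a) (trans eq cj)))
        no-contact {i} i≤l y~ | inj₂ (b , a) with both-colours (λ eq → bi (sym eq)) i≤l y~ b a
        ... | j , j≤l , y~j , cj = unordered i≤l j≤l y~ y~j (λ eq → bi (trans (sym cj) (trans (sym eq) b)))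

      -- Since `Z 0` does not separate, the component of `y₀` touches the cycle a second time. The
      -- configurations before and after a full turn, carried to that contact, exclude it.
      absurd : ⊥
      absurd = reach-another H nosep OnC? {Z 0} {Z 1} {y₀} (0 , s≤s z≤n , refl) (1 , s≤s (s≤s z≤n) , refl)
        (λ eq → proj₁ (adj 0) (sym eq)) (λ (j , j<N , eq) → y₀∉ j j<N eq) contact
        where
        contact : ∀ y x → Reach H OnC y₀ y → OnC x → x ≢ Z 0 → Adj H y x → ⊥
        contact y x r x∈ x≢ y~x with inner x∈ x≢
        ... | i , i≤l , refl
          with carry {C = OnC} (0 , s≤s z≤n , refl) Z₀~y₀ cfg cfg̃ (λ v v∉ → sym (c̃-off (λ j j<N eq → v∉ (j , j<N , eq)))) r
        ... | c₁ , c₂ , cfg₁ , cfg₂ , on-eq , off-eq = no-contact (Reach⇒∉ H r) cfg₁ cfg₂ on-eq off-eq i≤l y~x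

    shift : ℕ → (ℕ → V) → ℕ → V
    shift zero Z = Z
    shift (suc r) Z = shift r (λ i → Z (suc i))

    shift-at : ∀ r Z i → shift r Z i ≡ Z (i + r)
    shift-at zero Z i = cong Z (sym (+-identityʳ i))
    shift-at (suc r) Z i = trans (shift-at r _ i) (cong Z (sym (+-suc i r)))

    -- Unordered, since each rotation interchanges the sides on which the two colours appear.
    SameColours : Fin p → Fin p → (V → Fin p) → (ℕ → V) → Set
    SameColours a b c Z = (c (Z 1) ≡ a × c (Z (suc l)) ≡ b) ⊎ (c (Z 1) ≡ b × c (Z (suc l)) ≡ a)

    opaque

      rotations : ∀ r {a b c Z} → Cyc c Z → SameColours a b c Z → ∃[ c′ ] (Cyc c′ (shift r Z) × SameColours a b c′ (shift r Z))
      rotations zero C s = _ , C , s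
      rotations (suc r) {c = c} {Z} C s = rotations r (R.rotate) (swap s)
        where
        module R = Rotate C
        to-second : R.c′ (Z 2) ≡ c (Z (suc l))
        to-second = trans (R.c′-later (s≤s z≤n) (s≤s (s≤s R.1≤l))) R.second≡last
        swap : ∀ {a b} → SameColours a b c Z → SameColours a b R.c′ (λ i → Z (suc i))
        swap (inj₁ (x , y)) = inj₂ (trans to-second y , trans R.c′-last x)
        swap (inj₂ (x , y)) = inj₁ (trans to-second y , trans R.c′-last x)

    module Covering {c Z} (C : Cyc c Z) where

      open Cyc C
      private
        module R₀ = Rotate C

      at : ∀ r → ∃[ c′ ] (Cyc c′ (shift r Z) × SameColours (c (Z 1)) (c (Z (suc l))) c′ (shift r Z))
      at r = rotations r C (inj₁ (refl , refl))

      per* : ∀ q m → Z (m + q * N) ≡ Z m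
      per* zero m = cong Z (+-identityʳ m)
      per* (suc q) m = trans (cong Z (trans (cong (m +_) (+-comm N (q * N))) (sym (+-assoc m (q * N) N))))
        (trans (per (m + q * N)) (per* q m))

      opaque

        reduce : ∀ i → ∃[ r ] (r < N × (∀ k → Z (k + i) ≡ Z (k + r)))
        reduce i = i % N , m%n<n i N , λ k → trans (cong (λ m → Z (k + m)) (m≡m%n+[m/n]*n i N))
          (trans (cong Z (sym (+-assoc k (i % N) _))) (per* (i / N) (k + i % N)))

      opaque

        OnC? : Decidable (λ v → ∃[ j ] (j < N × v ≡ Z j))
        OnC? v with R₀.place v
        ... | R₀.on j j<N eq = yes (j , j<N , eq)
        ... | R₀.off ne = no (λ (j , j<N , eq) → ne j j<N eq)

        -- If a vertex were missing, connectivity would give an edge leaving the cycle at some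
        -- `Z r`. Rotating the hole to `Z r` brings this to the situation refuted by `Closed`.
        onto : ∀ v → ∃[ r ] (r < N × v ≡ Z r)
        onto v with OnC? v
        ... | yes p = p
        ... | no v∉ with proj₂ conn ⟪ OnC? ⟫ (Z 0 , ∈⟪⟫⁺ OnC? (0 , s≤s z≤n , refl)) (v , λ v∈ → v∉ (∈⟪⟫⁻ OnC? v∈))
        ... | e , (u , u∈e , u∈) , (y₀ , y₀∈e , y₀∉) with ∈⟪⟫⁻ OnC? u∈
        ... | r , r<N , refl = ⊥-elim (Closed.absurd (proj₁ (proj₂ (at r))) avoids
            (subst (λ x → Adj H x y₀) (sym (shift-at r Z 0)) ((λ { refl → y₀∉ u∈ }) , e , u∈e , y₀∈e)))
          where
          avoids : ∀ j → j < N → y₀ ≢ shift r Z j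
          avoids j _ eq with reduce (j + r)
          ... | s , s<N , same = y₀∉ (∈⟪⟫⁺ OnC? (s , s<N , trans eq (trans (shift-at r Z j) (same 0))))

      at-end : ∀ {e} → Z 0 ∈ inc H e → other e (Z 0) ≡ Z 1 ⊎ other e (Z 0) ≡ Z (suc l)
      at-end {e} Z₀∈e with R₀.neighbour ((λ eq → other≢ e (Z 0) (sym eq)) , e , Z₀∈e , other∈ e (Z 0))
      ... | R₀.right eq = inj₁ eq
      ... | R₀.left eq = inj₂ eq
      ... | R₀.outer ne with onto (other e (Z 0))
      ... | r , r<N , eq = ⊥-elim (ne r r<N eq)

      f-right : f (Z 0) (c (Z 1)) ≡ cod H (Z 0) (Z 1)
      f-right = trans (f≡C cfg _) (#-cong (CAt? c (Z 0) (c (Z 1))) (λ e → (Z 0 ∈? inc H e) ×-dec (Z 1 ∈? inc H e)) to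
        (λ e (Z₀∈e , Z₁∈e) → Z₀∈e , sym (mono-other cfg Z₀∈e Z₁∈e (λ eq → proj₁ (adj 0) (sym eq)))))
        where
        to : ∀ e → CAt c (Z 0) (c (Z 1)) e → Z 0 ∈ inc H e × Z 1 ∈ inc H e
        to e (Z₀∈e , eq) with at-end Z₀∈e
        ... | inj₁ o≡ = Z₀∈e , subst (_∈ inc H e) o≡ (other∈ e (Z 0))
        ... | inj₂ o≡ = ⊥-elim (bi (trans (sym eq) (cong c o≡)))

      f-left : f (Z 0) (c (Z (suc l))) ≡ cod H (Z 0) (Z 1)
      f-left = trans (trans (f≡C cfg _) (#-cong (CAt? c (Z 0) (c (Z (suc l)))) (λ e → (Z 0 ∈? inc H e) ×-dec (Z (suc l) ∈? inc H e)) to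
        (λ e (Z₀∈e , Z₁∈e) → Z₀∈e , sym (mono-other cfg Z₀∈e Z₁∈e (λ eq → proj₁ R₀.Z₀~left (sym eq)))))) (sym R₀.cod₀)
        where
        to : ∀ e → CAt c (Z 0) (c (Z (suc l))) e → Z 0 ∈ inc H e × Z (suc l) ∈ inc H e
        to e (Z₀∈e , eq) with at-end Z₀∈e
        ... | inj₂ o≡ = Z₀∈e , subst (_∈ inc H e) o≡ (other∈ e (Z 0))
        ... | inj₁ o≡ = ⊥-elim (bi (trans (sym (cong c o≡)) eq))

      f-else : ∀ i → i ≢ c (Z 1) → i ≢ c (Z (suc l)) → f (Z 0) i ≡ 0
      f-else i i≢₁ i≢₂ = trans (f≡C cfg i) (#-none (CAt? c (Z 0) i) none)
        where
        none : ∀ e → ¬ CAt c (Z 0) i e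
        none e (Z₀∈e , eq) with at-end Z₀∈e
        ... | inj₁ o≡ = i≢₁ (trans (sym eq) (cong c o≡))
        ... | inj₂ o≡ = i≢₂ (trans (sym eq) (cong c o≡))

    module Spanned {c Z} (C : Cyc c Z) where

      open Cyc C
      open Covering C using (at; onto)
      private
        module R₀ = Rotate C

      α β : Fin p
      α = c (Z 1)
      β = c (Z (suc l))

      t : ℕ
      t = cod H (Z 0) (Z 1)

      private
        n≡N : nV H ≡ N
        n≡N = ≤-antisym (injective⇒≤ {f = λ v → fromℕ< (proj₁ (proj₂ (onto v)))} index-inj)
                        (injective⇒≤ {f = λ (i : Fin N) → Z (toℕ i)} Z-inj)
          where
          index-inj : ∀ {u v} → fromℕ< (proj₁ (proj₂ (onto u))) ≡ fromℕ< (proj₁ (proj₂ (onto v))) → u ≡ v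
          index-inj {u} {v} eq = trans (proj₂ (proj₂ (onto u))) (trans (cong Z (fromℕ<-injective _ _ _ _ eq)) (sym (proj₂ (proj₂ (onto v)))))
          Z-inj : ∀ {i j : Fin N} → Z (toℕ i) ≡ Z (toℕ j) → i ≡ j
          Z-inj {i} {j} eq with <-cmp (toℕ i) (toℕ j)
          ... | tri< i<j _ _ = ⊥-elim (R₀.apart i<j (toℕ<n j) eq)
          ... | tri≈ _ eq _ = toℕ-injective eq
          ... | tri> _ _ j<i = ⊥-elim (R₀.apart j<i (toℕ<n i) (sym eq))

        index : V → Fin (nV H)
        index v = fromℕ< (subst (proj₁ (onto v) <_) (sym n≡N) (proj₁ (proj₂ (onto v))))

        Z-index : ∀ v → Z (toℕ (index v)) ≡ v
        Z-index v = trans (cong Z (toℕ-fromℕ< _)) (sym (proj₂ (proj₂ (onto v))))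

        index-Z : ∀ i → index (Z (toℕ i)) ≡ i
        index-Z i with <-cmp (toℕ (index (Z (toℕ i)))) (toℕ i)
        ... | tri< lt _ _ = ⊥-elim (R₀.apart lt (subst (toℕ i <_) n≡N (toℕ<n i)) (Z-index (Z (toℕ i))))
        ... | tri≈ _ eq _ = toℕ-injective eq
        ... | tri> _ _ gt = ⊥-elim (R₀.apart gt (subst (toℕ (index (Z (toℕ i))) <_) n≡N (toℕ<n _)) (sym (Z-index (Z (toℕ i)))))

        σ : Permutation′ (nV H)
        σ = permutation (λ i → Z (toℕ i)) index Z-index index-Z

        plain : ∀ r → Plain H (Z r) (Z (suc r))
        plain r = subst₂ (Plain H) (shift-at r Z 0) (shift-at r Z 1) (Rotate.plain₀ (proj₁ (proj₂ (at r))))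

        -- With the hole at `Z (suc r)`, its two sides have equal multiplicity, which passes the
        -- value `t` on from one pair to the next.
        codt : ∀ r → cod H (Z r) (Z (suc r)) ≡ t
        codt zero = refl
        codt (suc r) = begin
          cod H (Z (suc r)) (Z (suc (suc r)))  ≡⟨ sym (cong₂ (cod H) (shift-at (suc r) Z 0) (shift-at (suc r) Z 1)) ⟩
          cod H (Z′ 0) (Z′ 1)  ≡⟨ Rotate.cod₀ (proj₁ (proj₂ (at (suc r)))) ⟩
          cod H (Z′ 0) (Z′ (suc l))  ≡⟨ cong₂ (cod H) (shift-at (suc r) Z 0) (trans (shift-at (suc r) Z (suc l)) (trans (cong Z lemma) (per r))) ⟩
          cod H (Z (suc r)) (Z r)  ≡⟨ cod-sym H _ _ ⟩
          cod H (Z r) (Z (suc r))  ≡⟨ codt r ⟩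
          t  ∎
          where
          open ≡-Reasoning
          Z′ : ℕ → V
          Z′ = shift (suc r) Z
          lemma : suc l + suc r ≡ r + N
          lemma = trans (+-comm (suc l) (suc r)) (sym (+-suc r (suc l)))

        0<t : 0 < t
        0<t = Adj⇒cod H (adj 0)

        opaque

          next : ∀ r → r < N → ∃[ i ] ∃[ j ] (NextCyc {nV H} i j × Z (toℕ i) ≡ Z r × Z (toℕ j) ≡ Z (suc r))
          next r r<N with m≤n⇒m<n∨m≡n r<N
          ... | inj₁ sr<N = fromℕ< r<n , fromℕ< sr<n ,
                inj₁ (trans (cong suc (toℕ-fromℕ< r<n)) (sym (toℕ-fromℕ< sr<n))) , cong Z (toℕ-fromℕ< r<n) , cong Z (toℕ-fromℕ< sr<n)
            where
            r<n : r < nV H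
            r<n = subst (r <_) (sym n≡N) r<N
            sr<n : suc r < nV H
            sr<n = subst (suc r <_) (sym n≡N) sr<N
          ... | inj₂ sr≡N = fromℕ< r<n , fromℕ< 0<n ,
                inj₂ (trans (cong suc (toℕ-fromℕ< r<n)) (trans sr≡N (sym n≡N)) , toℕ-fromℕ< 0<n) , cong Z (toℕ-fromℕ< r<n) ,
                trans (cong Z (toℕ-fromℕ< 0<n)) (sym (trans (cong Z sr≡N) (per 0)))
            where
            r<n : r < nV H
            r<n = subst (r <_) (sym n≡N) r<N
            0<n : 0 < nV H
            0<n = subst (0 <_) (sym n≡N) (s≤s z≤n)

          consecutive : ∀ e → ∃[ r ] (Z r ∈ inc H e × Z (suc r) ∈ inc H e)
          consecutive e = go (onto (other e v₀)) (onto (other e (other e v₀)))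
            where
            v₀ u v : V
            v₀ = fromℕ< (proj₁ conn)
            u = other e v₀
            v = other e u
            u≢v : u ≢ v
            u≢v eq = other≢ e u (sym eq)
            go : ∃[ r ] (r < N × u ≡ Z r) → ∃[ r ] (r < N × v ≡ Z r) → ∃[ r ] (Z r ∈ inc H e × Z (suc r) ∈ inc H e)
            go (r , r<N , u≡) (s , s<N , v≡) with Rotate.neighbour (proj₁ (proj₂ (at r)))
              (subst (λ x → Adj H x v) (trans u≡ (sym (shift-at r Z 0))) (u≢v , e , other∈ e v₀ , other∈ e u))
            ... | Rotate.right eq = r , subst (_∈ inc H e) u≡ (other∈ e v₀) , subst (_∈ inc H e) (trans eq (shift-at r Z 1)) (other∈ e u)
            -- The predecessor of `Z r` is indexed one period later, as `Z (suc l + r)`, to avoid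
            -- subtraction.
            ... | Rotate.left eq = suc l + r , subst (_∈ inc H e) (trans eq (shift-at r Z (suc l))) (other∈ e u) ,
                  subst (_∈ inc H e) (trans u≡ (trans (sym (per r)) (cong Z (+-comm r N)))) (other∈ e v₀)
            ... | Rotate.outer ne = let j , j<N , eq = Covering.onto (proj₁ (proj₂ (at r))) v in ⊥-elim (ne j j<N eq)

        tc : IsTC t H
        tc = σ , edges , joins
          where
          edges : ∀ e → ∃[ i ] ∃[ j ] (NextCyc i j × inc H e ≡ ⁅ Z (toℕ i) ⁆ ∪ ⁅ Z (toℕ j) ⁆)
          edges e with consecutive e
          ... | r , Zr∈ , Zsr∈ with Covering.reduce C r
          ... | s , s<N , same with next s s<N
          ... | i , j , nc , eqi , eqj = i , j , nc , trans (plain-inc H (plain r) Zr∈ Zsr∈)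
            (cong₂ (λ x y → ⁅ x ⁆ ∪ ⁅ y ⁆) (trans (same 0) (sym eqi)) (trans (same 1) (sym eqj)))
          joins : ∀ i j → NextCyc i j → joinCount H (Z (toℕ i)) (Z (toℕ j)) ≡ t
          joins i j nc = subst (λ x → joinCount H (Z (toℕ i)) x ≡ t) (sym (Zj nc))
            (trans (plain-joinCount H (plain (toℕ i))) (codt (toℕ i)))
            where
            Zj : NextCyc i j → Z (toℕ j) ≡ Z (suc (toℕ i))
            Zj (inj₁ eq) = cong Z (sym eq)
            Zj (inj₂ (eq , eq₀)) = trans (cong Z eq₀) (sym (trans (cong Z (trans eq n≡N)) (per 0)))

        values : ∀ v → f v α ≡ t × f v β ≡ t × (∀ i → i ≢ α → i ≢ β → f v i ≡ 0)
        values v with onto v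
        ... | r , _ , refl with at r
        ... | c′ , C′ , same = subst (λ x → f x α ≡ t × f x β ≡ t × (∀ i → i ≢ α → i ≢ β → f x i ≡ 0)) (shift-at r Z 0) (go same)
          where
          module C′ = Covering C′
          t′≡t : cod H (shift r Z 0) (shift r Z 1) ≡ t
          t′≡t = trans (cong₂ (cod H) (shift-at r Z 0) (shift-at r Z 1)) (codt r)
          go : SameColours α β c′ (shift r Z) → f (shift r Z 0) α ≡ t × f (shift r Z 0) β ≡ t × (∀ i → i ≢ α → i ≢ β → f (shift r Z 0) i ≡ 0)
          go (inj₁ (a , b)) = trans (cong (f (shift r Z 0)) (sym a)) (trans C′.f-right t′≡t) ,
            trans (cong (f (shift r Z 0)) (sym b)) (trans C′.f-left t′≡t) ,
            λ i i≢α i≢β → C′.f-else i (λ eq → i≢α (trans eq a)) (λ eq → i≢β (trans eq b))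
          go (inj₂ (b , a)) = trans (cong (f (shift r Z 0)) (sym a)) (trans C′.f-left t′≡t) ,
            trans (cong (f (shift r Z 0)) (sym b)) (trans C′.f-right t′≡t) ,
            λ i i≢α i≢β → C′.f-else i (λ eq → i≢β (trans eq b)) (λ eq → i≢α (trans eq a))

        nV-odd : ∃[ k ] nV H ≡ suc (2 * k)
        nV-odd with odd C
        ... | q , l≡ = suc q , trans n≡N (trans (cong (λ m → suc (suc m)) l≡)
          (cong (λ m → suc (suc m)) (trans (sym (+-suc q q)) (cong (λ m → q + suc m) (sym (+-identityʳ q))))))

      hard : HardPair H f
      hard = hardC t 0<t (subst (5 ≤_) (sym n≡N) (s≤s (s≤s (3≤l C)))) nV-odd tc α β bi
        (λ v → proj₁ (values v)) (λ v → proj₁ (proj₂ (values v))) (λ v → proj₂ (proj₂ (values v)))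

-- Merging

-- `mergeHG` treats its two arguments unequally. This symmetric description by embeddings of
-- vertices and edges lets every one-sided argument be reused through `flipMerge`.
record AMerge (H H₁ H₂ : PreHypergraph) (v₁ : Fin (nV H₁)) (v₂ : Fin (nV H₂)) : Set₁ where
  field
    ε₁ : Fin (nV H₁) → Fin (nV H)
    ε₂ : Fin (nV H₂) → Fin (nV H)
    glue : ε₁ v₁ ≡ ε₂ v₂
    meet : ∀ {a b} → ε₁ a ≡ ε₂ b → a ≡ v₁ × b ≡ v₂
    ε₁-inj : ∀ {a a′} → ε₁ a ≡ ε₁ a′ → a ≡ a′
    ε₂-inj : ∀ {b b′} → ε₂ b ≡ ε₂ b′ → b ≡ b′
    cover : ∀ v → (∃[ a ] v ≡ ε₁ a) ⊎ (∃[ b ] v ≡ ε₂ b)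
    η₁ : Fin (nE H₁) → Fin (nE H)
    η₂ : Fin (nE H₂) → Fin (nE H)
    coverE : ∀ e → (∃[ e₁ ] e ≡ η₁ e₁) ⊎ (∃[ e₂ ] e ≡ η₂ e₂)
    count : ∀ {P : Fin (nE H) → Set} (P? : Decidable P) → # P? ≡ # (λ e → P? (η₁ e)) + # (λ e → P? (η₂ e))
    push₁ : ∀ {e a} → a ∈ inc H₁ e → ε₁ a ∈ inc H (η₁ e)
    pull₁ : ∀ {e a} → ε₁ a ∈ inc H (η₁ e) → a ∈ inc H₁ e
    push₂ : ∀ {e b} → b ∈ inc H₂ e → ε₂ b ∈ inc H (η₂ e)
    pull₂ : ∀ {e b} → ε₂ b ∈ inc H (η₂ e) → b ∈ inc H₂ e
    out₁ : ∀ {e b} → ε₂ b ∈ inc H (η₁ e) → b ≡ v₂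
    out₂ : ∀ {e a} → ε₁ a ∈ inc H (η₂ e) → a ≡ v₁

  pull : ∀ {e x} → x ∈ inc H (η₁ e) → ∃[ a ] (x ≡ ε₁ a × a ∈ inc H₁ e)
  pull {e} {x} x∈ with cover x
  ... | inj₁ (a , refl) = a , refl , pull₁ x∈
  ... | inj₂ (b , refl) with out₁ x∈
  ... | refl = v₁ , sym glue , pull₁ (subst (_∈ inc H (η₁ e)) (sym glue) x∈)

flipMerge : ∀ {H H₁ H₂ v₁ v₂} → AMerge H H₁ H₂ v₁ v₂ → AMerge H H₂ H₁ v₂ v₁
flipMerge M = record
  { ε₁ = ε₂ ; ε₂ = ε₁ ; glue = sym glue
  ; meet = λ eq → let p , q = meet (sym eq) in q , p
  ; ε₁-inj = ε₂-inj ; ε₂-inj = ε₁-inj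
  ; cover = λ v → ⊎-swap (cover v) ; η₁ = η₂ ; η₂ = η₁ ; coverE = λ e → ⊎-swap (coverE e)
  ; count = λ P? → trans (count P?) (+-comm (# (λ e → P? (η₁ e))) _)
  ; push₁ = push₂ ; pull₁ = pull₂ ; push₂ = push₁ ; pull₂ = pull₁ ; out₁ = out₂ ; out₂ = out₁ }
  where
  open AMerge M

record MergedF {H H₁ H₂ v₁ v₂} (M : AMerge H H₁ H₂ v₁ v₂) {p} (f : VecFun H p) (f₁ : VecFun H₁ p) (f₂ : VecFun H₂ p) : Set where
  open AMerge M
  field
    f-ε₁ : ∀ {a} → a ≢ v₁ → ∀ i → f (ε₁ a) i ≡ f₁ a i
    f-ε₂ : ∀ {b} → b ≢ v₂ → ∀ i → f (ε₂ b) i ≡ f₂ b i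
    f-glue : ∀ i → f (ε₁ v₁) i ≡ f₁ v₁ i + f₂ v₂ i

lookup-tabulated : ∀ {A : Set} {n} {F : Fin n → A} {T : Vec A n} → T ≡ tabulate F → ∀ u → lookup T u ≡ F u
lookup-tabulated {F = F} refl u = lookup∘tabulate F u

-- The second hypergraph is given with `suc k` vertices so that `pred` in the type of the merge
-- computes.
module MergeHG (H₁ : PreHypergraph) {k m₂} (inc₂ : Fin m₂ → Subset (suc k)) (v₁ : Fin (nV H₁)) (v₂ : Fin (suc k)) where

  H₂ : PreHypergraph
  H₂ = record { nV = suc k ; nE = m₂ ; inc = inc₂ }

  private
    M = mergeHG H₁ H₂ v₁ v₂
    n₁ = nV H₁
    m₁ = nE H₁

  inc₁₁ : ∀ e a → lookup (inc M (e ↑ˡ m₂)) (a ↑ˡ k) ≡ lookup (inc H₁ e) a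
  inc₁₁ e a rewrite splitAt-↑ˡ m₁ e m₂ | lookup-tabulated {T = mergeInc₁ (suc k) (inc H₁ e)} refl (a ↑ˡ k) | splitAt-↑ˡ n₁ a k = refl

  inc₁₂ : ∀ e b → lookup (inc M (e ↑ˡ m₂)) (n₁ ↑ʳ b) ≡ false
  inc₁₂ e b rewrite splitAt-↑ˡ m₁ e m₂ | lookup-tabulated {T = mergeInc₁ (suc k) (inc H₁ e)} refl (n₁ ↑ʳ b) | splitAt-↑ʳ n₁ k b = refl

  inc₂₁ : ∀ e a → lookup (inc M (m₁ ↑ʳ e)) (a ↑ˡ k) ≡ ⌊ a ≟F v₁ ⌋ ∧ lookup (inc₂ e) v₂
  inc₂₁ e a rewrite splitAt-↑ʳ m₁ m₂ e | lookup-tabulated {T = mergeInc₂ v₁ v₂ (inc₂ e)} refl (a ↑ˡ k) | splitAt-↑ˡ n₁ a k = refl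

  inc₂₂ : ∀ e b → lookup (inc M (m₁ ↑ʳ e)) (n₁ ↑ʳ b) ≡ lookup (inc₂ e) (punchIn v₂ b)
  inc₂₂ e b rewrite splitAt-↑ʳ m₁ m₂ e | lookup-tabulated {T = mergeInc₂ v₁ v₂ (inc₂ e)} refl (n₁ ↑ʳ b) | splitAt-↑ʳ n₁ k b = refl

  module _ {p} (f₁ : VecFun H₁ p) (f₂ : VecFun H₂ p) where

    mergeF₁ : ∀ {a} → a ≢ v₁ → ∀ i → mergeF f₁ f₂ v₁ v₂ (a ↑ˡ k) i ≡ f₁ a i
    mergeF₁ {a} a≢v₁ i rewrite splitAt-↑ˡ n₁ a k with a ≟F v₁
    ... | yes eq = ⊥-elim (a≢v₁ eq)
    ... | no _ = refl

    mergeF-glue : ∀ i → mergeF f₁ f₂ v₁ v₂ (v₁ ↑ˡ k) i ≡ f₁ v₁ i + f₂ v₂ i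
    mergeF-glue i rewrite splitAt-↑ˡ n₁ v₁ k with v₁ ≟F v₁
    ... | yes _ = refl
    ... | no ne = ⊥-elim (ne refl)

    mergeF₂ : ∀ b i → mergeF f₁ f₂ v₁ v₂ (n₁ ↑ʳ b) i ≡ f₂ (punchIn v₂ b) i
    mergeF₂ b i rewrite splitAt-↑ʳ n₁ k b = refl

  module _ {H : PreHypergraph} (ι : Iso H M) where

    open Iso ι

    private
      ε₁ : Fin n₁ → Fin (nV H)
      ε₁ a = φ ⟨$⟩ˡ (a ↑ˡ k)

      data View : Fin (suc k) → Set where
        at-v₂ : View v₂
        punch : ∀ b → View (punchIn v₂ b)

      view : ∀ b → View b
      view b with v₂ ≟F b
      ... | yes refl = at-v₂
      ... | no v₂≢b = subst View (punchIn-punchOut v₂≢b) (punch (punchOut v₂≢b))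

      ε₂′ : ∀ {b} → View b → Fin (nV H)
      ε₂′ at-v₂ = ε₁ v₁
      ε₂′ (punch b) = φ ⟨$⟩ˡ (n₁ ↑ʳ b)

      ε₂ : Fin (suc k) → Fin (nV H)
      ε₂ b = ε₂′ (view b)

      φ⁻¹-inj : ∀ {x y} → φ ⟨$⟩ˡ x ≡ φ ⟨$⟩ˡ y → x ≡ y
      φ⁻¹-inj eq = trans (sym (inverseʳ φ)) (trans (cong (φ ⟨$⟩ʳ_) eq) (inverseʳ φ))

      ε₂′-unique : ∀ {b} (w w′ : View b) → ε₂′ w ≡ ε₂′ w′
      ε₂′-unique w w′ = go w w′ refl
        where
        go : ∀ {b b′} (w : View b) (w′ : View b′) → b ≡ b′ → ε₂′ w ≡ ε₂′ w′
        go at-v₂ at-v₂ _ = refl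
        go at-v₂ (punch b) eq = ⊥-elim (punchInᵢ≢i v₂ b (sym eq))
        go (punch b) at-v₂ eq = ⊥-elim (punchInᵢ≢i v₂ b eq)
        go (punch b) (punch b′) eq = cong (λ x → φ ⟨$⟩ˡ (n₁ ↑ʳ x)) (punchIn-injective v₂ b b′ eq)

      left≢right : ∀ {a : Fin n₁} {b : Fin k} → a ↑ˡ k ≢ n₁ ↑ʳ b
      left≢right {a} {b} eq with trans (sym (splitAt-↑ˡ n₁ a k)) (trans (cong (splitAt n₁) eq) (splitAt-↑ʳ n₁ k b))
      ... | ()

      η₁ : Fin m₁ → Fin (nE H)
      η₁ e = ψ ⟨$⟩ˡ (e ↑ˡ m₂)

      η₂ : Fin m₂ → Fin (nE H)
      η₂ e = ψ ⟨$⟩ˡ (m₁ ↑ʳ e)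

      lookup-inv : ∀ e x → lookup (inc H (ψ ⟨$⟩ˡ e)) (φ ⟨$⟩ˡ x) ≡ lookup (inc M e) x
      lookup-inv e x = trans (pres _ _) (cong₂ (λ e x → lookup (inc M e) x) (inverseʳ ψ) (inverseʳ φ))

      in-inv : ∀ {e x b} → lookup (inc M e) x ≡ b → φ ⟨$⟩ˡ x ∈ inc H (ψ ⟨$⟩ˡ e) → b ≡ true
      in-inv {e} {x} eq x∈ = trans (sym eq) (trans (sym (lookup-inv e x)) ([]=⇒lookup x∈))

      in-inv⁻ : ∀ {e x b} → lookup (inc M e) x ≡ b → b ≡ true → φ ⟨$⟩ˡ x ∈ inc H (ψ ⟨$⟩ˡ e)
      in-inv⁻ {e} {x} eq b≡ = lookup⇒[]= _ _ (trans (lookup-inv e x) (trans eq b≡))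

      cover : ∀ v → (∃[ a ] v ≡ ε₁ a) ⊎ (∃[ b ] v ≡ ε₂ b)
      cover v with splitAt n₁ (φ ⟨$⟩ʳ v) in eq
      ... | inj₁ a = inj₁ (a , trans (sym (inverseˡ φ)) (cong (φ ⟨$⟩ˡ_) (sym (splitAt⁻¹-↑ˡ eq))))
      ... | inj₂ b = inj₂ (punchIn v₂ b , trans (trans (sym (inverseˡ φ)) (cong (φ ⟨$⟩ˡ_) (sym (splitAt⁻¹-↑ʳ {n₁} eq)))) (ε₂′-unique (punch b) (view _)))

      coverE : ∀ e → (∃[ e₁ ] e ≡ η₁ e₁) ⊎ (∃[ e₂ ] e ≡ η₂ e₂)
      coverE e with splitAt m₁ (ψ ⟨$⟩ʳ e) in eq
      ... | inj₁ a = inj₁ (a , trans (sym (inverseˡ ψ)) (cong (ψ ⟨$⟩ˡ_) (sym (splitAt⁻¹-↑ˡ eq))))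
      ... | inj₂ b = inj₂ (b , trans (sym (inverseˡ ψ)) (cong (ψ ⟨$⟩ˡ_) (sym (splitAt⁻¹-↑ʳ {m₁} eq))))

      meet′ : ∀ {a b} (w : View b) → ε₁ a ≡ ε₂′ w → a ≡ v₁ × b ≡ v₂
      meet′ at-v₂ eq = ↑ˡ-injective k _ _ (φ⁻¹-inj eq) , refl
      meet′ (punch b) eq = ⊥-elim (left≢right (φ⁻¹-inj eq))

      ε₂-inj′ : ∀ {b b′} (w : View b) (w′ : View b′) → ε₂′ w ≡ ε₂′ w′ → b ≡ b′
      ε₂-inj′ at-v₂ at-v₂ _ = refl
      ε₂-inj′ at-v₂ (punch b) eq = ⊥-elim (left≢right (φ⁻¹-inj eq))
      ε₂-inj′ (punch b) at-v₂ eq = ⊥-elim (left≢right (φ⁻¹-inj (sym eq)))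
      ε₂-inj′ (punch b) (punch b′) eq = cong (punchIn v₂) (↑ʳ-injective n₁ b b′ (φ⁻¹-inj eq))

      v₁-yes : ∀ x → ⌊ v₁ ≟F v₁ ⌋ ∧ x ≡ x
      v₁-yes x with v₁ ≟F v₁
      ... | yes _ = refl
      ... | no ne = ⊥-elim (ne refl)

      ∧-true : ∀ {a x} → ⌊ a ≟F v₁ ⌋ ∧ x ≡ true → a ≡ v₁
      ∧-true {a} eq with a ≟F v₁
      ... | yes a≡ = a≡
      ∧-true {a} () | no _

      push₂′ : ∀ {e b} (w : View b) → b ∈ inc₂ e → ε₂′ w ∈ inc H (η₂ e)
      push₂′ {e} at-v₂ b∈ = in-inv⁻ (trans (inc₂₁ e v₁) (v₁-yes _)) ([]=⇒lookup b∈)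
      push₂′ {e} (punch b) b∈ = in-inv⁻ (inc₂₂ e b) ([]=⇒lookup b∈)

      pull₂′ : ∀ {e b} (w : View b) → ε₂′ w ∈ inc H (η₂ e) → b ∈ inc₂ e
      pull₂′ {e} at-v₂ b∈ = lookup⇒[]= _ _ (in-inv (trans (inc₂₁ e v₁) (v₁-yes _)) b∈)
      pull₂′ {e} (punch b) b∈ = lookup⇒[]= _ _ (in-inv (inc₂₂ e b) b∈)

      out₁′ : ∀ {e b} (w : View b) → ε₂′ w ∈ inc H (η₁ e) → b ≡ v₂
      out₁′ at-v₂ _ = refl
      out₁′ {e} (punch b) b∈ with in-inv (inc₁₂ e b) b∈
      ... | ()

    merged : AMerge H H₁ H₂ v₁ v₂
    merged = record
      { ε₁ = ε₁
      ; ε₂ = ε₂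
      ; glue = ε₂′-unique at-v₂ (view v₂)
      ; meet = λ {a} {b} → meet′ (view b)
      ; ε₁-inj = λ eq → ↑ˡ-injective k _ _ (φ⁻¹-inj eq)
      ; ε₂-inj = λ {b} {b′} → ε₂-inj′ (view b) (view b′)
      ; cover = cover
      ; η₁ = η₁
      ; η₂ = η₂
      ; coverE = coverE
      ; count = λ P? → trans (∑-reindex (λ e → χ (P? e)) (flip ψ)) (∑-↑ {m₁} (λ e → χ (P? (ψ ⟨$⟩ˡ e))))
      ; push₁ = λ {e} {a} a∈ → in-inv⁻ (inc₁₁ e a) ([]=⇒lookup a∈)
      ; pull₁ = λ {e} {a} a∈ → lookup⇒[]= _ _ (in-inv (inc₁₁ e a) a∈)
      ; push₂ = λ {e} {b} → push₂′ (view b)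
      ; pull₂ = λ {e} {b} → pull₂′ (view b)
      ; out₁ = λ {e} {b} → out₁′ (view b)
      ; out₂ = λ {e} {a} a∈ → ∧-true (in-inv (inc₂₁ e a) a∈)
      }

    merged-f : ∀ {p} {f : VecFun H p} {f₁ : VecFun H₁ p} {f₂ : VecFun H₂ p} →
      (∀ v i → f v i ≡ mergeF f₁ f₂ v₁ v₂ (φ ⟨$⟩ʳ v) i) → MergedF merged f f₁ f₂
    merged-f {f = f} {f₁} {f₂} f≡ = record
      { f-ε₁ = λ a≢ i → trans (f≡′ _ i) (mergeF₁ f₁ f₂ a≢ i)
      ; f-ε₂ = λ {b} → f-ε₂′ (view b)
      ; f-glue = λ i → trans (f≡′ _ i) (mergeF-glue f₁ f₂ i) }
      where
      f≡′ : ∀ x i → f (φ ⟨$⟩ˡ x) i ≡ mergeF f₁ f₂ v₁ v₂ x i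
      f≡′ x i = trans (f≡ _ i) (cong (λ y → mergeF f₁ f₂ v₁ v₂ y i) (inverseʳ φ))
      f-ε₂′ : ∀ {b} (w : View b) → b ≢ v₂ → ∀ i → f (ε₂′ w) i ≡ f₂ b i
      f-ε₂′ at-v₂ ne i = ⊥-elim (ne refl)
      f-ε₂′ (punch b) _ i = trans (f≡′ _ i) (mergeF₂ f₁ f₂ b i)

    merged-f⁻ : ∀ {p} {f : VecFun H p} {f₁ : VecFun H₁ p} {f₂ : VecFun H₂ p} → MergedF merged f f₁ f₂ →
      ∀ v i → f v i ≡ mergeF f₁ f₂ v₁ v₂ (φ ⟨$⟩ʳ v) i
    merged-f⁻ {f = f} {f₁} {f₂} F v i = go (splitAt n₁ (φ ⟨$⟩ʳ v)) refl
      where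
      open MergedF F
      at-left : ∀ {a} → Dec (a ≡ v₁) → f (ε₁ a) i ≡ mergeF f₁ f₂ v₁ v₂ (a ↑ˡ k) i
      at-left (yes refl) = trans (f-glue i) (sym (mergeF-glue f₁ f₂ i))
      at-left (no a≢) = trans (f-ε₁ a≢ i) (sym (mergeF₁ f₁ f₂ a≢ i))
      at-right : ∀ b → f (φ ⟨$⟩ˡ (n₁ ↑ʳ b)) i ≡ mergeF f₁ f₂ v₁ v₂ (n₁ ↑ʳ b) i
      at-right b = trans (cong (λ x → f x i) (ε₂′-unique (punch b) (view _))) (trans (f-ε₂ (punchInᵢ≢i v₂ b) i) (sym (mergeF₂ f₁ f₂ b i)))
      back : ∀ {x} → f (φ ⟨$⟩ˡ x) i ≡ mergeF f₁ f₂ v₁ v₂ x i → x ≡ φ ⟨$⟩ʳ v → f v i ≡ mergeF f₁ f₂ v₁ v₂ (φ ⟨$⟩ʳ v) i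
      back eq refl = trans (cong (λ u → f u i) (sym (inverseˡ φ))) eq
      go : ∀ s → splitAt n₁ (φ ⟨$⟩ʳ v) ≡ s → f v i ≡ mergeF f₁ f₂ v₁ v₂ (φ ⟨$⟩ʳ v) i
      go (inj₁ a) eq = back (at-left (a ≟F v₁)) (splitAt⁻¹-↑ˡ eq)
      go (inj₂ b) eq = back (at-right b) (splitAt⁻¹-↑ʳ {n₁} eq)

-- Hard pairs have no partition

-- The failure of the degeneracy test in positive form: as an obstruction, it can be glued and
-- searched for.
Bad : ∀ (H : PreHypergraph) {p} (f : VecFun H p) (i : Fin p) (Y : Subset (nV H)) → Set
Bad H f i Y = ∀ v → v ∈ Y → f v i ≤ dIn H Y v

bad-or-good : ∀ (H : PreHypergraph) {p} (f : VecFun H p) i Y → ∃[ v ] (v ∈ Y × dIn H Y v < f v i) ⊎ Bad H f i Y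
bad-or-good H f i Y with any? (λ v → (v ∈? Y) ×-dec (dIn H Y v <? f v i))
... | yes p = inj₁ p
... | no none = inj₂ (λ v v∈Y → ≮⇒≥ (λ lt → none (v , v∈Y , lt)))

Good⇒¬Bad : ∀ (H : PreHypergraph) {p} {f : VecFun H p} {c i Y} → Good H f c → Nonempty Y → (∀ v → v ∈ Y → c v ≡ i) → ¬ Bad H f i Y
Good⇒¬Bad H {i = i} {Y} good ne mono bad with good Y i ne (λ v v∈Y → tt , mono v v∈Y)
... | v , v∈Y , lt = <⇒≱ lt (bad v v∈Y)

module Union {H H₁ H₂ v₁ v₂} (M : AMerge H H₁ H₂ v₁ v₂) (Y₁ : Subset (nV H₁)) (Y₂ : Subset (nV H₂)) where

  open AMerge M

  In : Fin (nV H) → Set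
  In v = (∃[ a ] (a ∈ Y₁ × v ≡ ε₁ a)) ⊎ (∃[ b ] (b ∈ Y₂ × v ≡ ε₂ b))

  In? : Decidable In
  In? v = any? (λ a → (a ∈? Y₁) ×-dec (v ≟F ε₁ a)) ⊎-dec any? (λ b → (b ∈? Y₂) ×-dec (v ≟F ε₂ b))

  Y : Subset (nV H)
  Y = ⟪ In? ⟫

module _ {H H₁ H₂ v₁ v₂} (M : AMerge H H₁ H₂ v₁ v₂) (Y₁ : Subset (nV H₁)) (Y₂ : Subset (nV H₂)) where

  open AMerge M
  open Union M Y₁ Y₂

  union-dIn₁ : ∀ {a} → dIn H₁ Y₁ a ≤ # (λ e → (ε₁ a ∈? inc H (η₁ e)) ×-dec (inc H (η₁ e) ⊆? Y))
  union-dIn₁ {a} = #-mono (λ e → (a ∈? inc H₁ e) ×-dec (inc H₁ e ⊆? Y₁)) (λ e → (ε₁ a ∈? inc H (η₁ e)) ×-dec (inc H (η₁ e) ⊆? Y))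
    (λ e (a∈e , e⊆Y₁) → push₁ a∈e , λ {x} x∈ → sub e⊆Y₁ x∈)
    where
    sub : ∀ {e x} → inc H₁ e ⊆ Y₁ → x ∈ inc H (η₁ e) → x ∈ Y
    sub e⊆Y₁ x∈ with pull x∈
    ... | a , refl , a∈e = ∈⟪⟫⁺ In? (inj₁ (a , e⊆Y₁ a∈e , refl))

module _ {H H₁ H₂ v₁ v₂} (M : AMerge H H₁ H₂ v₁ v₂) {p} {f : VecFun H p} {f₁ : VecFun H₁ p} {f₂ : VecFun H₂ p} (F : MergedF M f f₁ f₂) where

  open AMerge M
  open MergedF F

  module _ {Y₁ : Subset (nV H₁)} {Y₂ : Subset (nV H₂)} (v₁⇒v₂ : v₁ ∈ Y₁ → v₂ ∈ Y₂) (v₂⇒v₁ : v₂ ∈ Y₂ → v₁ ∈ Y₁)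
           {i} (bad₁ : Bad H₁ f₁ i Y₁) (bad₂ : Bad H₂ f₂ i Y₂) where

    open Union M Y₁ Y₂

    private
      Y′ : Subset (nV H)
      Y′ = Union.Y (flipMerge M) Y₂ Y₁

      Y′⊆Y : Y′ ⊆ Y
      Y′⊆Y v∈ with ∈⟪⟫⁻ (Union.In? (flipMerge M) Y₂ Y₁) v∈
      ... | inj₁ x = ∈⟪⟫⁺ In? (inj₂ x)
      ... | inj₂ x = ∈⟪⟫⁺ In? (inj₁ x)

      part₂ : ∀ {b} → dIn H₂ Y₂ b ≤ # (λ e → (ε₂ b ∈? inc H (η₂ e)) ×-dec (inc H (η₂ e) ⊆? Y))
      part₂ {b} = ≤-trans (union-dIn₁ (flipMerge M) Y₂ Y₁) (#-mono (λ e → (ε₂ b ∈? inc H (η₂ e)) ×-dec (inc H (η₂ e) ⊆? Y′))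
        (λ e → (ε₂ b ∈? inc H (η₂ e)) ×-dec (inc H (η₂ e) ⊆? Y)) (λ e (b∈ , sub) → b∈ , λ {x} x∈ → Y′⊆Y (sub x∈)))

      count-dIn : ∀ v → dIn H Y v ≡ _
      count-dIn v = count (λ e → (v ∈? inc H e) ×-dec (inc H e ⊆? Y))

      at-glue : v₁ ∈ Y₁ → f (ε₁ v₁) i ≤ dIn H Y (ε₁ v₁)
      at-glue v₁∈ = begin
        f (ε₁ v₁) i  ≡⟨ f-glue i ⟩
        f₁ v₁ i + f₂ v₂ i  ≤⟨ +-mono-≤ (≤-trans (bad₁ v₁ v₁∈) (union-dIn₁ M Y₁ Y₂)) (≤-trans (bad₂ v₂ (v₁⇒v₂ v₁∈)) part₂) ⟩
        # (λ e → (ε₁ v₁ ∈? inc H (η₁ e)) ×-dec (inc H (η₁ e) ⊆? Y)) + # (λ e → (ε₂ v₂ ∈? inc H (η₂ e)) ×-dec (inc H (η₂ e) ⊆? Y))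
          ≡⟨ cong (λ v → # (λ e → (ε₁ v₁ ∈? inc H (η₁ e)) ×-dec (inc H (η₁ e) ⊆? Y)) + # (λ e → (v ∈? inc H (η₂ e)) ×-dec (inc H (η₂ e) ⊆? Y))) (sym glue) ⟩
        # (λ e → (ε₁ v₁ ∈? inc H (η₁ e)) ×-dec (inc H (η₁ e) ⊆? Y)) + # (λ e → (ε₁ v₁ ∈? inc H (η₂ e)) ×-dec (inc H (η₂ e) ⊆? Y))
          ≡⟨ sym (count-dIn (ε₁ v₁)) ⟩
        dIn H Y (ε₁ v₁)  ∎
        where open ≤-Reasoning

    -- Away from the glued vertex `f` is unchanged and degrees can only grow; at it both degrees and
    -- values of `f` add. A set containing the glued vertex on one side only would lack the other
    -- summand of the degree, whence the two membership hypotheses.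
    union-bad : Bad H f i Y
    union-bad v v∈Y with ∈⟪⟫⁻ In? v∈Y
    ... | inj₁ (a , a∈ , refl) with a ≟F v₁
    ...   | yes refl = at-glue a∈
    ...   | no a≢ = ≤-trans (≤-reflexive (f-ε₁ a≢ i)) (≤-trans (bad₁ a a∈) (≤-trans (union-dIn₁ M Y₁ Y₂) (≤-trans (m≤m+n _ _) (≤-reflexive (sym (count-dIn (ε₁ a)))))))
    union-bad v v∈Y | inj₂ (b , b∈ , refl) with b ≟F v₂
    ...   | yes refl = subst (λ x → f x i ≤ dIn H Y x) glue (at-glue (v₂⇒v₁ b∈))
    ...   | no b≢ = ≤-trans (≤-reflexive (f-ε₂ b≢ i)) (≤-trans (bad₂ b b∈) (≤-trans part₂ (≤-trans (m≤n+m _ _) (≤-reflexive (sym (count-dIn (ε₂ b)))))))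

  -- A good colouring is good on one of the two sides. Otherwise each side has a bad set: one that
  -- misses the glued vertex is bad in `H` by itself, and two that contain it have the same colour,
  -- so their union is bad.
  merge-unpart : ¬ Partitionable H₁ f₁ → ¬ Partitionable H₂ f₂ → ¬ Partitionable H f
  merge-unpart un₁ un₂ (c , good) = un₁ ((λ a → c (ε₁ a)) , good₁)
    where
    good₁ : Good H₁ f₁ (λ a → c (ε₁ a))
    good₁ Y₁ i ne₁ mono₁ with bad-or-good H₁ f₁ i Y₁
    ... | inj₁ p = p
    ... | inj₂ bad₁ = ⊥-elim (un₂ ((λ b → c (ε₂ b)) , good₂))
      where
      refute : ∀ {j Y₁ Y₂} → (v₁ ∈ Y₁ → v₂ ∈ Y₂) → (v₂ ∈ Y₂ → v₁ ∈ Y₁) → Bad H₁ f₁ j Y₁ → Bad H₂ f₂ j Y₂ →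
        (∀ a → a ∈ Y₁ → c (ε₁ a) ≡ j) → (∀ b → b ∈ Y₂ → c (ε₂ b) ≡ j) → Nonempty Y₁ ⊎ Nonempty Y₂ → ⊥
      refute {j} {Y₁} {Y₂} to from b₁ b₂ m₁ m₂ ne = Good⇒¬Bad H good (nonempty ne) mono (union-bad to from b₁ b₂)
        where
        open Union M Y₁ Y₂
        nonempty : Nonempty Y₁ ⊎ Nonempty Y₂ → Nonempty Y
        nonempty (inj₁ (a , a∈)) = ε₁ a , ∈⟪⟫⁺ In? (inj₁ (a , a∈ , refl))
        nonempty (inj₂ (b , b∈)) = ε₂ b , ∈⟪⟫⁺ In? (inj₂ (b , b∈ , refl))
        mono : ∀ v → v ∈ Y → c v ≡ j
        mono v v∈ with ∈⟪⟫⁻ In? v∈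
        ... | inj₁ (a , a∈ , refl) = m₁ a a∈
        ... | inj₂ (b , b∈ , refl) = m₂ b b∈
      good₂ : Good H₂ f₂ (λ b → c (ε₂ b))
      good₂ Y₂ j ne₂ mono₂ with bad-or-good H₂ f₂ j Y₂
      ... | inj₁ p = p
      ... | inj₂ bad₂ with v₁ ∈? Y₁ | v₂ ∈? Y₂
      ... | no v₁∉ | _ = ⊥-elim (refute {i} {Y₁} {∅} (λ v₁∈ → ⊥-elim (v₁∉ v₁∈)) (λ v∈ → ⊥-elim (∉⊥ v∈)) bad₁ (λ v v∈ → ⊥-elim (∉⊥ v∈))
              (λ a a∈ → proj₂ (mono₁ a a∈)) (λ b b∈ → ⊥-elim (∉⊥ b∈)) (inj₁ ne₁))
      ... | yes _ | no v₂∉ = ⊥-elim (refute {j} {∅} {Y₂} (λ v∈ → ⊥-elim (∉⊥ v∈)) (λ v₂∈ → ⊥-elim (v₂∉ v₂∈)) (λ v v∈ → ⊥-elim (∉⊥ v∈)) bad₂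
              (λ b b∈ → ⊥-elim (∉⊥ b∈)) (λ a a∈ → proj₂ (mono₂ a a∈)) (inj₂ ne₂))
      ... | yes v₁∈ | yes v₂∈ with trans (sym (proj₂ (mono₁ v₁ v₁∈))) (trans (cong c glue) (proj₂ (mono₂ v₂ v₂∈)))
      ... | refl = ⊥-elim (refute {i} {Y₁} {Y₂} (λ _ → v₂∈) (λ _ → v₁∈) bad₁ bad₂ (λ a a∈ → proj₂ (mono₁ a a∈)) (λ b b∈ → proj₂ (mono₂ b b∈)) (inj₁ ne₁))

singleton-positive : ∀ (H : PreHypergraph) {p} {f : VecFun H p} {c} → Good H f c → ∀ v → 0 < f v (c v)
singleton-positive H {f = f} {c} good v with good ⁅ v ⁆ (c v) (v , x∈⁅x⁆ v) (λ u u∈ → tt , cong c (x∈⁅y⁆⇒x≡y v u∈))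
... | u , u∈ , lt = subst (λ x → 0 < f x (c v)) (x∈⁅y⁆⇒x≡y v u∈) (≤-<-trans z≤n lt)

-- A zero entry forbids its colour already on a one-vertex set, so all vertices have colour `j`.
-- Then the whole vertex set is bad.
mono-unpart : ∀ (H : PreHypergraph) {p} {f : VecFun H p} → 1 ≤ nV H → (j : Fin p) → (∀ v → f v j ≡ degH H v) →
  (∀ v i → i ≢ j → f v i ≡ 0) → ¬ Partitionable H f
mono-unpart H {f = f} 1≤n j fj f0 (c , good) = Good⇒¬Bad H good (fromℕ< 1≤n , ∈⟪⟫⁺ every? tt) (λ v _ → c≡j v)
  (λ v _ → ≤-reflexive (trans (fj v) (trans (degH≡# H v) (#-cong (λ e → v ∈? inc H e) (λ e → (v ∈? inc H e) ×-dec (inc H e ⊆? ⟪ every? ⟫))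
    (λ e v∈e → v∈e , λ {x} _ → ∈⟪⟫⁺ every? tt) (λ e → proj₁)))))
  where
  every? : Decidable (λ (_ : Fin (nV H)) → ⊤)
  every? _ = yes tt
  c≡j : ∀ v → c v ≡ j
  c≡j v with c v ≟F j
  ... | yes eq = eq
  ... | no neq = ⊥-elim (<⇒≢ (singleton-positive H good v) (sym (f0 v (c v) neq)))

module _ (H : PreHypergraph) where

  pair≤dIn : ∀ {Y u v} → u ∈ Y → v ∈ Y → joinCount H u v ≤ dIn H Y u
  pair≤dIn {Y} {u} {v} u∈Y v∈Y = ≤-trans (≤-reflexive (joinCount≡# H u v))
    (#-mono (λ e → inc H e ≟ₛ (⁅ u ⁆ ∪ ⁅ v ⁆)) (λ e → (u ∈? inc H e) ×-dec (inc H e ⊆? Y))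
      (λ e eq → subst (u ∈_) (sym eq) (u∈pair H u v) , λ {x} x∈ → sub (∈pair H (subst (x ∈_) eq x∈))))
    where
    sub : ∀ {x} → x ≡ u ⊎ x ≡ v → x ∈ Y
    sub (inj₁ refl) = u∈Y
    sub (inj₂ refl) = v∈Y

  joinCount-sym : ∀ u v → joinCount H u v ≡ joinCount H v u
  joinCount-sym u v = cong (λ S → ∣ tabulate (λ e → ⌊ inc H e ≟ₛ S ⌋) ∣) (∪-comm ⁅ u ⁆ ⁅ v ⁆)

  ordinary⇒HasOther : (∀ e → Ordinary H e) → HasOther H
  ordinary⇒HasOther ord e x with ord e
  ... | u , v , u≢v , eq with u ≟F x
  ... | no u≢x = u , subst (u ∈_) (sym eq) (u∈pair H u v) , u≢x
  ... | yes refl = v , subst (v ∈_) (sym eq) (v∈pair H u v) , λ v≡u → u≢v (sym v≡u)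

  clique-dIn : ∀ {t} → IsTK t H → ∀ {Y v} → v ∈ Y → t * # (λ w → (w ∈? Y) ×-dec ¬? (w ≟F v)) ≤ dIn H Y v
  clique-dIn {t} (ord , joins) {Y} {v} v∈Y = begin
    t * # W?  ≡⟨ *-comm t (# W?) ⟩
    # W? * t  ≡⟨ sym (∑-χ* W? t) ⟩
    ∑ (λ w → χ (W? w) * t)  ≤⟨ ∑-mono term ⟩
    ∑ (λ w → # (λ e → D? e ×-dec (other e ≟F w)))  ≡⟨ #-fibres D? other ⟩
    dIn H Y v  ∎
    where
    open ≤-Reasoning
    has : HasOther H
    has = ordinary⇒HasOther ord
    other : Fin (nE H) → Fin (nV H)
    other e = proj₁ (has e v)
    W? : Decidable (λ w → w ∈ Y × ¬ (w ≡ v))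
    W? w = (w ∈? Y) ×-dec ¬? (w ≟F v)
    D? : Decidable (λ e → v ∈ inc H e × inc H e ⊆ Y)
    D? e = (v ∈? inc H e) ×-dec (inc H e ⊆? Y)
    term : ∀ w → χ (W? w) * t ≤ # (λ e → D? e ×-dec (other e ≟F w))
    term w with W? w
    ... | no _ = z≤n
    ... | yes (w∈Y , w≢v) = ≤-trans (≤-reflexive (trans (*-identityˡ t) (trans (sym (joins v w (λ eq → w≢v (sym eq)))) (joinCount≡# H v w))))
      (#-mono (λ e → inc H e ≟ₛ (⁅ v ⁆ ∪ ⁅ w ⁆)) (λ e → D? e ×-dec (other e ≟F w))
        (λ e eq → (subst (v ∈_) (sym eq) (u∈pair H v w) , λ {x} x∈ → sub (∈pair H (subst (x ∈_) eq x∈))) , is-w e eq))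
      where
      sub : ∀ {x} → x ≡ v ⊎ x ≡ w → x ∈ Y
      sub (inj₁ refl) = v∈Y
      sub (inj₂ refl) = w∈Y
      is-w : ∀ e → inc H e ≡ ⁅ v ⁆ ∪ ⁅ w ⁆ → other e ≡ w
      is-w e eq with ∈pair H (subst (other e ∈_) eq (proj₁ (proj₂ (has e v))))
      ... | inj₁ o≡v = ⊥-elim (proj₂ (proj₂ (has e v)) o≡v)
      ... | inj₂ o≡w = o≡w

  -- In a class of `m` vertices every degree is at least `t * (m - 1)`, so the test on the whole
  -- class gives `m ≤ ns i`. The classes then cover at most `n - 1` vertices.
  complete-unpart : ∀ {p} {f : VecFun H p} {t} → 3 ≤ nV H → IsTK t H → (ns : Fin p → ℕ) →
    sum (tabulate ns) ≡ nV H ∸ 1 → (∀ v i → f v i ≡ t * ns i) → ¬ Partitionable H f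
  complete-unpart {p} {f} {t} 3≤n tk ns ∑ns f≡ (c , good) = <⇒≱ (pred< 3≤n) (begin
    nV H  ≡⟨ sym (#-all every? (λ _ → tt)) ⟩
    # every?  ≡⟨ sym (#-fibres every? c) ⟩
    ∑ (λ i → # (λ v → every? v ×-dec (c v ≟F i)))  ≤⟨ ∑-mono class ⟩
    ∑ ns  ≡⟨ sym (sum-tabulate ns) ⟩
    sum (tabulate ns)  ≡⟨ ∑ns ⟩
    nV H ∸ 1  ∎)
    where
    open ≤-Reasoning
    pred< : ∀ {n} → 3 ≤ n → n ∸ 1 < n
    pred< (s≤s _) = ≤-refl
    every? : Decidable (λ (_ : Fin (nV H)) → ⊤)
    every? _ = yes tt
    class : ∀ i → # (λ v → every? v ×-dec (c v ≟F i)) ≤ ns i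
    class i with any? (λ v → c v ≟F i)
    ... | no none = ≤-trans (≤-reflexive (#-none (λ v → every? v ×-dec (c v ≟F i)) (λ v (_ , eq) → none (v , eq)))) z≤n
    ... | yes (u , cu≡i) with good ⟪ I? ⟫ i (u , ∈⟪⟫⁺ I? cu≡i) (λ v v∈ → tt , ∈⟪⟫⁻ I? v∈)
      where
      I? : Decidable (λ v → c v ≡ i)
      I? v = c v ≟F i
    ... | v , v∈Y , lt = begin
      # (λ v → every? v ×-dec (c v ≟F i))  ≡⟨ #-cong (λ v → every? v ×-dec (c v ≟F i)) (_∈? Y) (λ w (_ , eq) → ∈⟪⟫⁺ I? eq) (λ w w∈ → tt , ∈⟪⟫⁻ I? w∈) ⟩
      # (_∈? Y)  ≡⟨ #-remove (_∈? Y) v ⟩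
      χ (v ∈? Y) + # (λ w → (w ∈? Y) ×-dec ¬? (w ≟F v))  ≡⟨ cong (_+ # (λ w → (w ∈? Y) ×-dec ¬? (w ≟F v))) (χ-yes (v ∈? Y) v∈Y) ⟩
      suc (# (λ w → (w ∈? Y) ×-dec ¬? (w ≟F v)))  ≤⟨ *-cancelˡ-< t _ _ (≤-<-trans (clique-dIn tk v∈Y) (<-≤-trans lt (≤-reflexive (f≡ v i)))) ⟩
      ns i  ∎
      where
      I? : Decidable (λ v → c v ≡ i)
      I? v = c v ≟F i
      Y : Subset (nV H)
      Y = ⟪ I? ⟫

  -- Two consecutive vertices of one colour form a bad set, because `t` edges join them and the
  -- entry is `t`. A good colouring would therefore be a proper colouring of an odd cycle with the
  -- two colours `k` and `ℓ`.
  cycle-unpart : ∀ {p} {f : VecFun H p} {t} → 5 ≤ nV H → ∃[ q ] (nV H ≡ suc (2 * q)) → IsTC t H → (k ℓ : Fin p) →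
    (∀ v → f v k ≡ t) → (∀ v → f v ℓ ≡ t) → (∀ v i → i ≢ k → i ≢ ℓ → f v i ≡ 0) → ¬ Partitionable H f
  cycle-unpart {p} {f} {t} 5≤n (q , n≡) (σ , _ , joins) k ℓ fk fℓ f0 (c , good) =
    -- The closing pair `2 * q`, `0`: both positions are even, so alternation gives them the same
    -- colour.
    proper (fromℕ< 2q<n) (fromℕ< 0<n)
      (inj₂ (trans (cong suc (toℕ-fromℕ< 2q<n)) (sym n≡) , toℕ-fromℕ< 0<n))
      (trans (sym (a-≡ 2q<n)) (trans (trans (cong a 2q≡) (even q (≤-<-trans (≤-reflexive (sym 2q≡)) 2q<n))) (a-≡ 0<n)))
    where
    0<n : 0 < nV H
    0<n = ≤-trans (s≤s z≤n) 5≤n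
    2q<n : 2 * q < nV H
    2q<n = ≤-reflexive (sym n≡)
    2q≡ : 2 * q ≡ q + q
    2q≡ = cong (q +_) (+-identityʳ q)
    g : Fin (nV H) → Fin p
    g i = c (σ ⟨$⟩ʳ i)
    f≡t : ∀ v → f v (c v) ≡ t
    f≡t v with c v ≟F k | c v ≟F ℓ
    ... | yes eq | _ = trans (cong (f v) eq) (fk v)
    ... | no _ | yes eq = trans (cong (f v) eq) (fℓ v)
    ... | no ne | no ne′ = ⊥-elim (<⇒≢ (singleton-positive H good v) (sym (f0 v (c v) ne ne′)))
    k-or-ℓ : ∀ v → c v ≡ k ⊎ c v ≡ ℓ
    k-or-ℓ v with c v ≟F k | c v ≟F ℓ
    ... | yes eq | _ = inj₁ eq
    ... | no _ | yes eq = inj₂ eq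
    ... | no ne | no ne′ = ⊥-elim (<⇒≢ (singleton-positive H good v) (sym (f0 v (c v) ne ne′)))
    proper : ∀ i j → NextCyc i j → g i ≢ g j
    proper i j nc gi≡gj with good (⁅ u ⁆ ∪ ⁅ v ⁆) (c u) (u , u∈pair H u v) (λ x x∈ → tt , colour (∈pair H x∈))
      where
      u v : Fin (nV H)
      u = σ ⟨$⟩ʳ i
      v = σ ⟨$⟩ʳ j
      colour : ∀ {x} → x ≡ u ⊎ x ≡ v → c x ≡ c u
      colour (inj₁ refl) = refl
      colour (inj₂ refl) = sym gi≡gj
    ... | x , x∈ , lt with ∈pair H x∈
    ... | inj₁ refl = <⇒≱ lt (≤-trans (≤-reflexive (trans (f≡t u) (sym (joins i j nc)))) (pair≤dIn (u∈pair H u v) (v∈pair H u v)))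
      where
      u v : Fin (nV H)
      u = σ ⟨$⟩ʳ i
      v = σ ⟨$⟩ʳ j
    ... | inj₂ refl = <⇒≱ lt (≤-trans (≤-reflexive (trans (trans (cong (f v) gi≡gj) (f≡t v)) (trans (sym (joins i j nc)) (joinCount-sym u v)))) (pair≤dIn (v∈pair H u v) (u∈pair H u v)))
      where
      u v : Fin (nV H)
      u = σ ⟨$⟩ʳ i
      v = σ ⟨$⟩ʳ j
    two-valued : ∀ {x y z : Fin p} → x ≡ k ⊎ x ≡ ℓ → y ≡ k ⊎ y ≡ ℓ → z ≡ k ⊎ z ≡ ℓ → x ≢ y → y ≢ z → z ≡ x
    two-valued (inj₁ refl) (inj₁ refl) _ ne _ = ⊥-elim (ne refl)
    two-valued (inj₂ refl) (inj₂ refl) _ ne _ = ⊥-elim (ne refl)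
    two-valued _ (inj₁ refl) (inj₁ refl) _ ne = ⊥-elim (ne refl)
    two-valued _ (inj₂ refl) (inj₂ refl) _ ne = ⊥-elim (ne refl)
    two-valued (inj₁ refl) (inj₂ refl) (inj₁ refl) _ _ = refl
    two-valued (inj₂ refl) (inj₁ refl) (inj₂ refl) _ _ = refl
    -- The colours along the cycle, indexed by ℕ for steps of two; the value `k` beyond the last
    -- vertex is a placeholder.
    a : ℕ → Fin p
    a m with m <? nV H
    ... | yes m<n = g (fromℕ< m<n)
    ... | no _ = k
    a-≡ : ∀ {m} (m<n : m < nV H) → a m ≡ g (fromℕ< m<n)
    a-≡ {m} m<n with m <? nV H
    ... | yes _ = refl
    ... | no m≮n = ⊥-elim (m≮n m<n)
    adjacent : ∀ {m} → suc m < nV H → a m ≢ a (suc m)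
    adjacent {m} sm<n eq = proper (fromℕ< m<n) (fromℕ< sm<n)
      (inj₁ (trans (cong suc (toℕ-fromℕ< m<n)) (sym (toℕ-fromℕ< sm<n)))) (trans (sym (a-≡ m<n)) (trans eq (a-≡ sm<n)))
      where
      m<n : m < nV H
      m<n = <-trans (n<1+n m) sm<n
    a-two : ∀ {m} → m < nV H → a m ≡ k ⊎ a m ≡ ℓ
    a-two m<n = subst (λ x → x ≡ k ⊎ x ≡ ℓ) (sym (a-≡ m<n)) (k-or-ℓ _)
    even : ∀ s → s + s < nV H → a (s + s) ≡ a 0
    even zero _ = refl
    even (suc s) lt = trans (cong a (cong suc (+-suc s s))) (trans (two-valued (a-two s₀) (a-two s₁) (a-two s₂) (adjacent s₁) (adjacent s₂)) (even s s₀))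
      where
      s₂ : suc (suc (s + s)) < nV H
      s₂ = subst (_< nV H) (cong suc (+-suc s s)) lt
      s₁ : suc (s + s) < nV H
      s₁ = <-trans (n<1+n _) s₂
      s₀ : s + s < nV H
      s₀ = <-trans (n<1+n _) s₁

hard-unpart : ∀ {p H} {f : VecFun H p} → HardPair H f → ¬ Partitionable H f
hard-unpart {H = H} (hardM _ (conn , _) j fj f0) = mono-unpart H (proj₁ conn) j fj f0
hard-unpart {H = H} (hardK t _ 3≤n tk ns _ ∑ns f≡) = complete-unpart H 3≤n tk ns ∑ns f≡
hard-unpart {H = H} (hardC t _ 5≤n odd tc k ℓ _ fk fℓ f0) = cycle-unpart H 5≤n odd tc k ℓ fk fℓ f0
hard-unpart {p} {H} {f} (hardMerge H₁ H₂ f₁ f₂ v₁ v₂ h₁ h₂ ι f≡) = go (nV H₂) (inc H₂) f₂ v₂ (hard-unpart h₂) ι f≡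
  where
  -- The number of vertices is generalised so that it can be matched against `suc k`; the vertex
  -- `v₂` excludes zero.
  go : ∀ n₂ (inc₂ : Fin (nE H₂) → Subset n₂) (f₂ : Fin n₂ → Fin p → ℕ) (v₂ : Fin n₂) →
    let H₂ = record { nV = n₂ ; nE = nE H₂ ; inc = inc₂ } in
    ¬ Partitionable H₂ f₂ → (ι : Iso H (mergeHG H₁ H₂ v₁ v₂)) →
    (∀ v i → f v i ≡ mergeF f₁ f₂ v₁ v₂ (Iso.φ ι ⟨$⟩ʳ v) i) → ¬ Partitionable H f
  go (suc k) inc₂ f₂ v₂ un₂ ι f≡ = merge-unpart (MergeHG.merged H₁ inc₂ v₁ v₂ ι) (MergeHG.merged-f H₁ inc₂ v₁ v₂ ι f≡) (hard-unpart h₁) un₂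

-- Pairs without a partition are hard

HasOther⇒IsHypergraph : ∀ H → HasOther H → 1 ≤ nV H → IsHypergraph H
HasOther⇒IsHypergraph H other 1≤n e with other e (fromℕ< 1≤n)
... | u , u∈e , _ with other e u
... | w , w∈e , w≢u = subst (2 ≤_) (sym (∣∣≡# (inc H e))) (#≥2 (_∈? inc H e) u w (λ u≡w → w≢u (sym u≡w)) u∈e w∈e)

module Side {H H₁ H₂ v₁ v₂} (M : AMerge H H₁ H₂ v₁ v₂) where

  open AMerge M

  side-other : HasOther H → HasOther H₁
  side-other other e a with other (η₁ e) (ε₁ a)
  ... | x , x∈ , x≢ with pull x∈
  ... | b , refl , b∈ = b , b∈ , λ { refl → x≢ refl }

  -- A vertex set of `H₁` is extended to `H` by placing all the rest on the side of `v₁`. No edge of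
  -- the other part crosses this cut, so the crossing edge belongs to `H₁`.
  side-connected : Connected H → Connected H₁
  side-connected (1≤n , conn) = nonempty v₁ , λ X (u , u∈X) (w , w∉X) → cross X u∈X w∉X
    where
    nonempty : ∀ {n} → Fin n → 1 ≤ n
    nonempty zero = s≤s z≤n
    nonempty (suc _) = s≤s z≤n
    module _ (X : Subset (nV H₁)) {u w} (u∈X : u ∈ X) (w∉X : w ∉ X) where
      In : Fin (nV H) → Set
      In x = (∃[ a ] (x ≡ ε₁ a × a ∈ X)) ⊎ (¬ (∃[ a ] x ≡ ε₁ a) × v₁ ∈ X)
      In? : Decidable In
      In? x = any? (λ a → (x ≟F ε₁ a) ×-dec (a ∈? X)) ⊎-dec (¬? (any? (λ a → x ≟F ε₁ a)) ×-dec (v₁ ∈? X))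
      down : ∀ {a} → In (ε₁ a) → a ∈ X
      down (inj₁ (b , eq , b∈)) = subst (_∈ X) (sym (ε₁-inj eq)) b∈
      down (inj₂ (none , _)) = ⊥-elim (none (_ , refl))
      right⁺ : ∀ {b} → v₁ ∈ X → In (ε₂ b)
      right⁺ {b} v₁∈ with any? (λ a → ε₂ b ≟F ε₁ a)
      ... | no none = inj₂ (none , v₁∈)
      ... | yes (a , eq) = inj₁ (a , eq , subst (_∈ X) (sym (proj₁ (meet (sym eq)))) v₁∈)
      right⁻ : ∀ {b} → In (ε₂ b) → v₁ ∈ X
      right⁻ (inj₁ (a , eq , a∈)) = subst (_∈ X) (proj₁ (meet (sym eq))) a∈
      right⁻ (inj₂ (_ , v₁∈)) = v₁∈
      cross : ∃[ e ] ((∃[ u ] (u ∈ inc H₁ e × u ∈ X)) × (∃[ u ] (u ∈ inc H₁ e × u ∉ X)))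
      cross with conn ⟪ In? ⟫ (ε₁ u , ∈⟪⟫⁺ In? (inj₁ (u , refl , u∈X))) (ε₁ w , λ w∈ → w∉X (down (∈⟪⟫⁻ In? w∈)))
      ... | e , (x , x∈e , x∈) , (y , y∈e , y∉) with coverE e
      ... | inj₁ (e₁ , refl) with pull x∈e | pull y∈e
      ...   | a , refl , a∈ | b , refl , b∈ = e₁ , (a , a∈ , down (∈⟪⟫⁻ In? x∈)) , (b , b∈ , λ b∈X → y∉ (∈⟪⟫⁺ In? (inj₁ (b , refl , b∈X))))
      cross | e , (x , x∈e , x∈) , (y , y∈e , y∉) | inj₂ (e₂ , refl) with AMerge.pull (flipMerge M) x∈e | AMerge.pull (flipMerge M) y∈e
      ...   | a , refl , a∈ | b , refl , b∈ = ⊥-elim (y∉ (∈⟪⟫⁺ In? (right⁺ (right⁻ (∈⟪⟫⁻ In? x∈)))))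

  module SideF (has-other : HasOther H) {p} (f : VecFun H p) (d≤f : ∀ v → # (λ e → v ∈? inc H e) ≤ ∑ (f v))
           (unpart : ¬ Partitionable H f) {v* c} (v*≡ : v* ≡ ε₁ v₁) (cfg : Config H f v* c) where

    open Configs H has-other f d≤f unpart

    f₁ : VecFun H₁ p
    f₁ a i with a ≟F v₁
    ... | yes _ = # (λ e → CAt? c v* i (η₁ e))
    ... | no _ = f (ε₁ a) i

    f₁-glue : ∀ i → f₁ v₁ i ≡ # (λ e → CAt? c v* i (η₁ e))
    f₁-glue i with v₁ ≟F v₁
    ... | yes _ = refl
    ... | no ne = ⊥-elim (ne refl)

    f₁-else : ∀ {a} → a ≢ v₁ → ∀ i → f₁ a i ≡ f (ε₁ a) i
    f₁-else {a} a≢ i with a ≟F v₁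
    ... | yes eq = ⊥-elim (a≢ eq)
    ... | no _ = refl

    d≤f₁ : ∀ a → # (λ e → a ∈? inc H₁ e) ≤ ∑ (f₁ a)
    d≤f₁ a with a ≟F v₁
    ... | yes refl = ≤-reflexive (trans (#-cong (λ e → a ∈? inc H₁ e) (λ e → v* ∈? inc H (η₁ e))
          (λ e a∈ → subst (_∈ inc H (η₁ e)) (sym v*≡) (push₁ a∈)) (λ e v∈ → pull₁ (subst (_∈ inc H (η₁ e)) v*≡ v∈)))
          (sym (#-fibres (λ e → v* ∈? inc H (η₁ e)) (λ e → c (other (η₁ e) v*)))))
    ... | no a≢ = ≤-trans (≤-trans (#-mono (λ e → a ∈? inc H₁ e) (λ e → ε₁ a ∈? inc H (η₁ e)) (λ e → push₁))
          (≤-trans (m≤m+n _ _) (≤-reflexive (sym (count (λ e → ε₁ a ∈? inc H e)))))) (d≤f (ε₁ a))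

    -- A good colouring of `H₁` is completed by `c` on the rest. For a test set meeting `H₁`, the
    -- witness found inside `H₁` remains one: only at the glued vertex are further edges added, and
    -- they are among the `H₂` edges of colour `i` at the hole, exactly the part of `f v* i` that
    -- `f₁` left out.
    unpart₁ : ¬ Partitionable H₁ f₁
    unpart₁ (c₁ , good₁) = unpart (C , good)
      where
      C : Fin (nV H) → Fin p
      C v with any? (λ a → v ≟F ε₁ a)
      ... | yes (a , _) = c₁ a
      ... | no _ = c v
      C-ε₁ : ∀ a → C (ε₁ a) ≡ c₁ a
      C-ε₁ a with any? (λ b → ε₁ a ≟F ε₁ b)
      ... | yes (b , eq) = cong c₁ (sym (ε₁-inj eq))
      ... | no none = ⊥-elim (none (a , refl))
      C-else : ∀ {v} → ¬ (∃[ a ] v ≡ ε₁ a) → C v ≡ c v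
      C-else {v} none with any? (λ a → v ≟F ε₁ a)
      ... | yes p = ⊥-elim (none p)
      ... | no _ = refl
      good : Good H f C
      good Y i ne mn with any? (λ a → ε₁ a ∈? Y)
      ... | no none = cfg Y i ne (λ v v∈Y → (λ { refl → none (v₁ , subst (_∈ Y) v*≡ v∈Y) }) ,
            trans (sym (C-else (λ { (a , refl) → none (a , v∈Y) }))) (proj₂ (mn v v∈Y)))
      ... | yes (a₀ , a₀∈) = finish (good₁ Y₁ i (a₀ , ∈⟪⟫⁺ Y₁? a₀∈) (λ a a∈ → tt , trans (sym (C-ε₁ a)) (proj₂ (mn (ε₁ a) (∈⟪⟫⁻ Y₁? a∈)))))
        where
        Y₁? : Decidable (λ a → ε₁ a ∈ Y)
        Y₁? a = ε₁ a ∈? Y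
        Y₁ : Subset (nV H₁)
        Y₁ = ⟪ Y₁? ⟫
        left? : ∀ v → Decidable (λ e → v ∈ inc H (η₁ e) × inc H (η₁ e) ⊆ Y)
        left? v e = (v ∈? inc H (η₁ e)) ×-dec (inc H (η₁ e) ⊆? Y)
        right? : ∀ v → Decidable (λ e → v ∈ inc H (η₂ e) × inc H (η₂ e) ⊆ Y)
        right? v e = (v ∈? inc H (η₂ e)) ×-dec (inc H (η₂ e) ⊆? Y)
        split-dIn : ∀ v → dIn H Y v ≡ # (left? v) + # (right? v)
        split-dIn v = count (λ e → (v ∈? inc H e) ×-dec (inc H e ⊆? Y))
        left≤ : ∀ a → # (left? (ε₁ a)) ≤ dIn H₁ Y₁ a
        left≤ a = #-mono (left? (ε₁ a)) (λ e → (a ∈? inc H₁ e) ×-dec (inc H₁ e ⊆? Y₁))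
          (λ e (a∈ , sub) → pull₁ a∈ , λ {x} x∈ → ∈⟪⟫⁺ Y₁? (sub (push₁ x∈)))
        right-empty : ∀ {a} → a ≢ v₁ → # (right? (ε₁ a)) ≡ 0
        right-empty a≢ = #-none (right? (ε₁ _)) (λ e (a∈ , _) → a≢ (out₂ a∈))
        right≤ : v* ∈ Y → # (right? v*) ≤ # (λ e → CAt? c v* i (η₂ e))
        right≤ v*∈Y = #-mono (right? v*) (λ e → CAt? c v* i (η₂ e)) to
          where
          to : ∀ e → v* ∈ inc H (η₂ e) × inc H (η₂ e) ⊆ Y → CAt c v* i (η₂ e)
          to e (v*∈ , sub) = v*∈ , trans (sym (C-else off)) (proj₂ (mn o (sub o∈)))
            where
            o : Fin (nV H)
            o = other (η₂ e) v*
            o∈ : o ∈ inc H (η₂ e)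
            o∈ = other∈ (η₂ e) v*
            off : ¬ (∃[ a ] o ≡ ε₁ a)
            off (a , eq) = other≢ (η₂ e) v* (trans eq (trans (cong ε₁ (out₂ (subst (_∈ inc H (η₂ e)) eq o∈))) (sym v*≡)))
        finish : ∃[ a ] (a ∈ Y₁ × dIn H₁ Y₁ a < f₁ a i) → ∃[ v ] (v ∈ Y × dIn H Y v < f v i)
        finish (a , a∈ , lt) = ε₁ a , ∈⟪⟫⁻ Y₁? a∈ , small (a ≟F v₁)
          where
          open ≤-Reasoning
          small : Dec (a ≡ v₁) → dIn H Y (ε₁ a) < f (ε₁ a) i
          small (no a≢) = begin-strict
            dIn H Y (ε₁ a)  ≡⟨ split-dIn (ε₁ a) ⟩
            # (left? (ε₁ a)) + # (right? (ε₁ a))  ≡⟨ trans (cong (# (left? (ε₁ a)) +_) (right-empty a≢)) (+-identityʳ _) ⟩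
            # (left? (ε₁ a))  ≤⟨ left≤ a ⟩
            dIn H₁ Y₁ a  <⟨ lt ⟩
            f₁ a i  ≡⟨ f₁-else a≢ i ⟩
            f (ε₁ a) i  ∎
          small (yes a≡) = subst (λ x → dIn H Y x < f x i) v*≡a (begin-strict
            dIn H Y v*  ≡⟨ split-dIn v* ⟩
            # (left? v*) + # (right? v*)  ≤⟨ +-mono-≤ (subst (λ x → # (left? x) ≤ dIn H₁ Y₁ a) (sym v*≡a) (left≤ a)) (right≤ (subst (_∈ Y) (sym v*≡a) (∈⟪⟫⁻ Y₁? a∈))) ⟩
            dIn H₁ Y₁ a + # (λ e → CAt? c v* i (η₂ e))  <⟨ +-monoˡ-< _ (subst (dIn H₁ Y₁ a <_) (trans (cong (λ x → f₁ x i) a≡) (f₁-glue i)) lt) ⟩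
            # (λ e → CAt? c v* i (η₁ e)) + # (λ e → CAt? c v* i (η₂ e))  ≡⟨ sym (count (CAt? c v* i)) ⟩
            # (CAt? c v* i)  ≡⟨ sym (f≡C cfg i) ⟩
            f v* i  ∎)
            where
            v*≡a : v* ≡ ε₁ a
            v*≡a = trans v*≡ (cong ε₁ (sym a≡))

-- Splitting at a separating vertex

record Halves {n} (P : Fin n → Set) : Set where
  field
    {l r} : ℕ
    to : Fin n → Fin l ⊎ Fin r
    from : Fin l ⊎ Fin r → Fin n
    from-to : ∀ v → from (to v) ≡ v
    to-from : ∀ x → to (from x) ≡ x
    left : ∀ a → P (from (inj₁ a))
    right : ∀ b → ¬ P (from (inj₂ b))

  from-inj : ∀ {x y} → from x ≡ from y → x ≡ y
  from-inj eq = trans (sym (to-from _)) (trans (cong to eq) (to-from _))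

  in-left : ∀ {v} → P v → ∃[ a ] v ≡ from (inj₁ a)
  in-left {v} Pv with to v | from-to v
  ... | inj₁ a | eq = a , sym eq
  ... | inj₂ b | eq = ⊥-elim (right b (subst P (sym eq) Pv))

  in-right : ∀ {v} → ¬ P v → ∃[ b ] v ≡ from (inj₂ b)
  in-right {v} ¬Pv with to v | from-to v
  ... | inj₁ a | eq = ⊥-elim (¬Pv (subst P eq (left a)))
  ... | inj₂ b | eq = b , sym eq

  perm : Permutation n (l + r)
  perm = permutation (λ v → join l r (to v)) (λ x → from (splitAt l x))
    (λ x → trans (cong (join l r) (to-from (splitAt l x))) (join-splitAt l r x))
    (λ v → trans (cong from (splitAt-join l r (to v))) (from-to v))

halves : ∀ {n} {P : Fin n → Set} → Decidable P → Halves P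
halves {zero} P? = record { l = 0 ; r = 0 ; to = λ () ; from = λ { (inj₁ ()) ; (inj₂ ()) } ; from-to = λ () ; to-from = λ { (inj₁ ()) ; (inj₂ ()) }
  ; left = λ () ; right = λ () }
halves {suc n} {P} P? with P? zero | halves (λ i → P? (suc i))
... | yes P₀ | R = record { l = suc R.l ; r = R.r ; to = to ; from = from ; from-to = from-to ; to-from = to-from
    ; left = λ { zero → P₀ ; (suc a) → R.left a } ; right = R.right }
  where
  module R = Halves R
  up : Fin R.l ⊎ Fin R.r → Fin (suc R.l) ⊎ Fin R.r
  up = ⊎-map suc (λ b → b)
  to : Fin (suc n) → Fin (suc R.l) ⊎ Fin R.r
  to zero = inj₁ zero
  to (suc v) = up (R.to v)
  from : Fin (suc R.l) ⊎ Fin R.r → Fin (suc n)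
  from (inj₁ zero) = zero
  from (inj₁ (suc a)) = suc (R.from (inj₁ a))
  from (inj₂ b) = suc (R.from (inj₂ b))
  from-up : ∀ x → from (up x) ≡ suc (R.from x)
  from-up (inj₁ a) = refl
  from-up (inj₂ b) = refl
  from-to : ∀ v → from (to v) ≡ v
  from-to zero = refl
  from-to (suc v) = trans (from-up (R.to v)) (cong suc (R.from-to v))
  to-from : ∀ x → to (from x) ≡ x
  to-from (inj₁ zero) = refl
  to-from (inj₁ (suc a)) = cong up (R.to-from (inj₁ a))
  to-from (inj₂ b) = cong up (R.to-from (inj₂ b))
... | no ¬P₀ | R = record { l = R.l ; r = suc R.r ; to = to ; from = from ; from-to = from-to ; to-from = to-from
    ; left = R.left ; right = λ { zero → ¬P₀ ; (suc b) → R.right b } }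
  where
  module R = Halves R
  up : Fin R.l ⊎ Fin R.r → Fin R.l ⊎ Fin (suc R.r)
  up = ⊎-map (λ a → a) suc
  to : Fin (suc n) → Fin R.l ⊎ Fin (suc R.r)
  to zero = inj₂ zero
  to (suc v) = up (R.to v)
  from : Fin R.l ⊎ Fin (suc R.r) → Fin (suc n)
  from (inj₂ zero) = zero
  from (inj₂ (suc b)) = suc (R.from (inj₂ b))
  from (inj₁ a) = suc (R.from (inj₁ a))
  from-up : ∀ x → from (up x) ≡ suc (R.from x)
  from-up (inj₁ a) = refl
  from-up (inj₂ b) = refl
  from-to : ∀ v → from (to v) ≡ v
  from-to zero = refl
  from-to (suc v) = trans (from-up (R.to v)) (cong suc (R.from-to v))
  to-from : ∀ x → to (from x) ≡ x
  to-from (inj₂ zero) = refl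
  to-from (inj₂ (suc b)) = cong up (R.to-from (inj₂ b))
  to-from (inj₁ a) = cong up (R.to-from (inj₁ a))

bool-≡ : ∀ {x y : Bool} → (x ≡ true → y ≡ true) → (y ≡ true → x ≡ true) → x ≡ y
bool-≡ {true} to from = sym (to refl)
bool-≡ {false} {true} to from = from refl
bool-≡ {false} {false} to from = refl

module Pieces (H : PreHypergraph) {v : Fin (nV H)} (X₁ X₂ : Subset (nV H)) (cover : ∀ u → u ∈ X₁ ⊎ u ∈ X₂) (X₁∩X₂ : X₁ ∩ X₂ ≡ ⁅ v ⁆)
              (edges : ∀ e → inc H e ⊆ X₁ ⊎ inc H e ⊆ X₂) where

  private
    R = halves (_∈? X₁)
    S = halves (λ e → inc H e ⊆? X₁)
    module R = Halves R
    module S = Halves S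

  v∈both : v ∈ X₁ × v ∈ X₂
  v∈both = x∈p∩q⁻ X₁ X₂ (subst (v ∈_) (sym X₁∩X₂) (x∈⁅x⁆ v))

  only-v : ∀ {u} → u ∈ X₁ → u ∈ X₂ → u ≡ v
  only-v u∈₁ u∈₂ = x∈⁅y⁆⇒x≡y v (subst (_ ∈_) X₁∩X₂ (x∈p∩q⁺ (u∈₁ , u∈₂)))

  v₁ : Fin R.l
  v₁ = proj₁ (R.in-left (proj₁ v∈both))

  v≡ : v ≡ R.from (inj₁ v₁)
  v≡ = proj₂ (R.in-left (proj₁ v∈both))

  rightE : ∀ e {x} → x ∈ inc H (S.from (inj₂ e)) → x ∈ X₂
  rightE e x∈ with edges (S.from (inj₂ e))
  ... | inj₁ sub = ⊥-elim (S.right e (λ {x} → sub {x}))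
  ... | inj₂ sub = sub x∈

  -- The second copy of `v` gets index zero, so that `punchIn zero b` computes to `suc b`.
  embed₂ : Fin (suc R.r) → Fin (nV H)
  embed₂ zero = v
  embed₂ (suc b) = R.from (inj₂ b)

  inc₁? : ∀ e → Decidable (λ a → R.from (inj₁ a) ∈ inc H (S.from (inj₁ e)))
  inc₁? e a = R.from (inj₁ a) ∈? inc H (S.from (inj₁ e))

  inc₂? : ∀ e → Decidable (λ b → embed₂ b ∈ inc H (S.from (inj₂ e)))
  inc₂? e b = embed₂ b ∈? inc H (S.from (inj₂ e))

  H₁ : PreHypergraph
  H₁ = record { nV = R.l ; nE = S.l ; inc = λ e → ⟪ inc₁? e ⟫ }

  inc₂ : Fin S.r → Subset (suc R.r)
  inc₂ e = ⟪ inc₂? e ⟫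

  open MergeHG H₁ inc₂ v₁ zero public

  private
    M = mergeHG H₁ H₂ v₁ zero

    agree : ∀ x y → lookup (inc H (S.from x)) (R.from y) ≡ lookup (inc M (join S.l S.r x)) (join R.l R.r y)
    agree (inj₁ e) (inj₁ a) = trans (bool-≡ (λ eq → []=⇒lookup (∈⟪⟫⁺ (inc₁? e) (lookup⇒[]= _ _ eq)))
                                            (λ eq → []=⇒lookup (∈⟪⟫⁻ (inc₁? e) (lookup⇒[]= _ _ eq)))) (sym (inc₁₁ e a))
    agree (inj₁ e) (inj₂ b) = trans (bool-≡ (λ eq → ⊥-elim (R.right b (S.left e (lookup⇒[]= _ _ eq)))) (λ ())) (sym (inc₁₂ e b))
    -- An edge of the second piece lies in `X₂`, so it can meet `X₁` only in `v`.
    agree (inj₂ e) (inj₁ a) = trans (bool-≡ to from) (sym (inc₂₁ e a))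
      where
      to : lookup (inc H (S.from (inj₂ e))) (R.from (inj₁ a)) ≡ true → ⌊ a ≟F v₁ ⌋ ∧ lookup (inc₂ e) zero ≡ true
      to eq with only-v (R.left a) (rightE e (lookup⇒[]= _ _ eq))
      ... | a≡v with a ≟F v₁
      ... | yes refl = []=⇒lookup (∈⟪⟫⁺ (inc₂? e) {zero} (subst (_∈ inc H (S.from (inj₂ e))) a≡v (lookup⇒[]= _ _ eq)))
      ... | no a≢ with R.from-inj {inj₁ a} {inj₁ v₁} (trans a≡v v≡)
      ... | refl = ⊥-elim (a≢ refl)
      from : ⌊ a ≟F v₁ ⌋ ∧ lookup (inc₂ e) zero ≡ true → lookup (inc H (S.from (inj₂ e))) (R.from (inj₁ a)) ≡ true
      from eq with a ≟F v₁
      ... | yes refl = []=⇒lookup (subst (_∈ inc H (S.from (inj₂ e))) v≡ (∈⟪⟫⁻ (inc₂? e) {zero} (lookup⇒[]= _ _ eq)))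
      from () | no _
    agree (inj₂ e) (inj₂ b) = trans (bool-≡ (λ eq → []=⇒lookup (∈⟪⟫⁺ (inc₂? e) {suc b} (lookup⇒[]= _ _ eq)))
                                            (λ eq → []=⇒lookup (∈⟪⟫⁻ (inc₂? e) {suc b} (lookup⇒[]= _ _ eq)))) (sym (inc₂₂ e b))

  ι : Iso H M
  ι = record
    { φ = R.perm
    ; ψ = S.perm
    ; pres = λ e u → trans (cong₂ (λ e u → lookup (inc H e) u) (sym (S.from-to e)) (sym (R.from-to u))) (agree (S.to e) (R.to u)) }

  nV≡ : nV H ≡ R.l + R.r
  nV≡ = ↔⇒≡ R.perm

  smaller₁ : 2 ≤ ∣ X₂ ∣ → nV H₁ < nV H
  smaller₁ 2≤ with #≥2⁻ (_∈? X₂) (subst (2 ≤_) (∣∣≡# X₂) 2≤) v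
  ... | u , u∈ , u≢v = subst (R.l <_) (sym nV≡) (m<m+n R.l (inhabited (proj₁ (R.in-right (λ u∈₁ → u≢v (only-v u∈₁ u∈))))))
    where
    inhabited : ∀ {n} → Fin n → 0 < n
    inhabited zero = s≤s z≤n
    inhabited (suc _) = s≤s z≤n

  smaller₂ : 2 ≤ ∣ X₁ ∣ → nV H₂ < nV H
  smaller₂ 2≤ with #≥2⁻ (_∈? X₁) (subst (2 ≤_) (∣∣≡# X₁) 2≤) v
  ... | u , u∈ , u≢v = subst (suc R.r <_) (sym nV≡) (+-monoˡ-≤ R.r (two v₁ (proj₁ (R.in-left u∈)) (λ eq → u≢v (trans (proj₂ (R.in-left u∈)) (trans (cong (λ a → R.from (inj₁ a)) (sym eq)) (sym v≡))))))
    where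
    two : ∀ {n} (a b : Fin n) → a ≢ b → 2 ≤ n
    two zero zero ne = ⊥-elim (ne refl)
    two zero (suc zero) _ = s≤s (s≤s z≤n)
    two zero (suc (suc _)) _ = s≤s (s≤s z≤n)
    two (suc zero) _ _ = s≤s (s≤s z≤n)
    two (suc (suc _)) _ _ = s≤s (s≤s z≤n)

block-hard : ∀ {H p} {f : VecFun H p} → IsHypergraph H → Connected H → (∀ v → ¬ Separating H v) → 1 ≤ p →
  (∀ v → # (λ e → v ∈? inc H e) ≤ ∑ (f v)) → ¬ Partitionable H f → (HardPair H f → ⊥) → ⊥
block-hard {H} {p} {f} hyp conn nosep 1≤p d≤f unpart k
  with any? (λ z → any? (λ i → any? (λ j → ¬? (i ≟F j) ×-dec ((0 <? f z i) ×-dec (0 <? f z j)))))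
... | no none = k (Bl.Mono.hard (λ z i j 0<i 0<j → decidable-stable (i ≟F j) (λ i≢j → none (z , i , j , i≢j , 0<i , 0<j))))
  where
  module Bl = Block H hyp conn nosep 1≤p f d≤f unpart
... | yes (z , i , j , i≢j , 0<i , 0<j) = Bl.two-colours⇒BiPath i≢j 0<i 0<j (λ l P → Bl.minimal P by-length)
  where
  module Bl = Block H hyp conn nosep 1≤p f d≤f unpart
  by-length : ∀ l → Bl.BiPath l → Bl.Min l → ⊥
  by-length zero P _ = Bl.BiPath.ca≢cb P (cong (Bl.BiPath.c P) (trans (sym (Path.first (Bl.BiPath.path P))) (Path.last (Bl.BiPath.path P))))
  by-length (suc zero) P _ = Bl.triangle-hard P k
  by-length (suc (suc l)) P min = k (Bl.Spanned.hard (s≤s (s≤s z≤n)) min (Bl.FromPath.cyc (s≤s (s≤s z≤n)) min P))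

unpart-hard : ∀ n {H p} {f : VecFun H p} → nV H ≤ n → IsHypergraph H → Connected H → 1 ≤ p →
  (∀ v → # (λ e → v ∈? inc H e) ≤ ∑ (f v)) → ¬ Partitionable H f → (HardPair H f → ⊥) → ⊥
unpart-hard zero nV≤ hyp conn = ⊥-elim (<⇒≱ (proj₁ conn) nV≤)
unpart-hard (suc n) {H} {p} {f} nV≤ hyp conn 1≤p d≤f unpart k = ¬¬-lem {A = ∃[ v ] Separating H v} λ
  { (inj₂ nosep) → block-hard hyp conn (λ v sep → nosep (v , sep)) 1≤p d≤f unpart k
  ; (inj₁ (v , X₁ , X₂ , cover , X₁∩X₂ , 2≤X₁ , 2≤X₂ , edges)) → separated X₁ X₂ cover X₁∩X₂ 2≤X₁ 2≤X₂ edges }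
  where
  module _ {v} (X₁ X₂ : Subset (nV H)) (cover : ∀ u → u ∈ X₁ ⊎ u ∈ X₂) (X₁∩X₂ : X₁ ∩ X₂ ≡ ⁅ v ⁆) (2≤X₁ : 2 ≤ ∣ X₁ ∣) (2≤X₂ : 2 ≤ ∣ X₂ ∣)
           (edges : ∀ e → inc H e ⊆ X₁ ⊎ inc H e ⊆ X₂) where
    module P = Pieces H X₁ X₂ cover X₁∩X₂ edges
    M : AMerge H P.H₁ P.H₂ P.v₁ zero
    M = P.merged P.ι
    has-other : HasOther H
    has-other = IsHypergraph⇒HasOther H hyp
    v* : Fin (nV H)
    v* = AMerge.ε₁ M P.v₁
    cfg : ∃[ c ] Config H f v* c
    cfg = Greedy.config-at H has-other conn 1≤p f d≤f v*
    module L = Side M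
    module R = Side (flipMerge M)
    -- Both sides read the same configuration with hole `v*`, so their values there add up to
    -- `f v*`. `SideF` takes the hole up to an equation in order to allow this.
    module LF = L.SideF has-other f d≤f unpart refl (proj₂ cfg)
    module RF = R.SideF has-other f d≤f unpart (AMerge.glue M) (proj₂ cfg)
    open Configs H has-other f d≤f unpart using (f≡C; CAt?)
    F : MergedF M f LF.f₁ RF.f₁
    F = record
      { f-ε₁ = λ a≢ i → sym (LF.f₁-else a≢ i)
      ; f-ε₂ = λ b≢ i → sym (RF.f₁-else b≢ i)
      ; f-glue = λ i → trans (f≡C (proj₂ cfg) i) (trans (AMerge.count M (CAt? (proj₁ cfg) v* i)) (sym (cong₂ _+_ (LF.f₁-glue i) (RF.f₁-glue i)))) }
    separated : ⊥
    separated = unpart-hard n (≤-pred (≤-trans (P.smaller₁ 2≤X₂) nV≤))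
      (HasOther⇒IsHypergraph P.H₁ (L.side-other has-other) (proj₁ (L.side-connected conn))) (L.side-connected conn) 1≤p LF.d≤f₁ LF.unpart₁ λ h₁ →
      unpart-hard n (≤-pred (≤-trans (P.smaller₂ 2≤X₁) nV≤))
      (HasOther⇒IsHypergraph P.H₂ (R.side-other has-other) (proj₁ (R.side-connected conn))) (R.side-connected conn) 1≤p RF.d≤f₁ RF.unpart₁ λ h₂ →
      k (hardMerge P.H₁ P.H₂ LF.f₁ RF.f₁ P.v₁ zero h₁ h₂ P.ι (P.merged-f⁻ P.ι F))

-- The degree bound

any-vec? : ∀ {p} n {Q : Vec (Fin p) n → Set} → Decidable Q → Dec (∃ Q)
any-vec? zero Q? = map′ (λ q → [] , q) (λ { ([] , q) → q }) (Q? [])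
any-vec? (suc n) Q? = map′ (λ (x , xs , q) → x ∷ xs , q) (λ { (x ∷ xs , q) → x , xs , q }) (any? (λ x → any-vec? n (λ xs → Q? (x ∷ xs))))

module _ (H : PreHypergraph) {p} (f : VecFun H p) where

  good? : Decidable (Good H f)
  good? c = map′ to from (¬? (anySubset? (λ Y → any? (λ i → nonempty? Y ×-dec (all? (λ v → (v ∈? Y) →-dec (c v ≟F i)) ×-dec
              all? (λ v → (v ∈? Y) →-dec (f v i ≤? dIn H Y v)))))))
    where
    Obstruction : Set
    Obstruction = ∃[ Y ] ∃[ i ] (Nonempty Y × (∀ v → v ∈ Y → c v ≡ i) × Bad H f i Y)
    to : ¬ Obstruction → Good H f c
    to none Y i ne mono with bad-or-good H f i Y
    ... | inj₁ ok = ok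
    ... | inj₂ bad = ⊥-elim (none (Y , i , ne , (λ v v∈ → proj₂ (mono v v∈)) , bad))
    from : Good H f c → ¬ Obstruction
    from good (Y , i , ne , mono , bad) = Good⇒¬Bad H good ne mono bad

  -- `unpart-hard` only refutes, so the partition has to be found by search. Colourings are
  -- enumerated as vectors, and goodness depends only on their values.
  partitionable? : Dec (Partitionable H f)
  partitionable? = map′ (λ (cs , good) → lookup cs , good)
    (λ (c , good) → tabulate c , GoodOn-resp H f (λ v _ → tt , sym (lookup∘tabulate c v)) good)
    (any-vec? (nV H) (λ cs → good? (lookup cs)))

-- The effect of changing one summand, stated without subtraction.
∑-update : ∀ {n} {x y : Fin n → ℕ} (j : Fin n) → (∀ i → i ≢ j → x i ≡ y i) → ∑ x + y j ≡ ∑ y + x j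
∑-update {n} {x} {y} j same = begin
  ∑ x + y j  ≡⟨ cong (∑ x +_) (sym (∑-δ (y j))) ⟩
  ∑ x + ∑ (δ (y j))  ≡⟨ sym (∑-+ x (δ (y j))) ⟩
  ∑ (λ i → x i + δ (y j) i)  ≡⟨ ∑-cong pointwise ⟩
  ∑ (λ i → y i + δ (x j) i)  ≡⟨ ∑-+ y (δ (x j)) ⟩
  ∑ y + ∑ (δ (x j))  ≡⟨ cong (∑ y +_) (∑-δ (x j)) ⟩
  ∑ y + x j  ∎
  where
  open ≡-Reasoning
  δ : ℕ → Fin n → ℕ
  δ a i = χ (i ≟F j) * a
  ∑-δ : ∀ a → ∑ (δ a) ≡ a
  ∑-δ a = trans (∑-single j (λ i i≢j → cong (_* a) (χ-no (i ≟F j) i≢j))) (trans (cong (_* a) (χ-yes (j ≟F j) refl)) (*-identityˡ a))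
  pointwise : ∀ i → x i + δ (y j) i ≡ y i + δ (x j) i
  pointwise i with i ≟F j
  ... | yes refl = trans (cong (x i +_) (*-identityˡ (y i))) (trans (+-comm (x i) (y i)) (cong (y i +_) (sym (*-identityˡ (x i)))))
  ... | no i≢j = cong (_+ 0) (same i i≢j)

module Refine (H : PreHypergraph) (has-other : HasOther H) {p} (f : VecFun H p) (d≤f : ∀ v → # (λ e → v ∈? inc H e) ≤ ∑ (f v)) where

  open Extension H has-other f

  private
    V = Fin (nV H)

  class? : ∀ (c : V → Fin p) i → Decidable (λ u → ⊤ × c u ≡ i)
  class? c i = Colour? (λ _ → yes tt) c i

  degIn : (V → Fin p) → Fin p → V → ℕ
  degIn c i v = # (Star? (class? c i) v)

  Mono : (V → Fin p) → Fin (nE H) → Set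
  Mono c e = ∀ u → u ∈ inc H e → ∀ w → w ∈ inc H e → c u ≡ c w

  Mono? : ∀ c → Decidable (Mono c)
  Mono? c e = all? (λ u → (u ∈? inc H e) →-dec all? (λ w → (w ∈? inc H e) →-dec (c u ≟F c w)))

  -- This is minus `f v (c v)`, shifted by a constant of `v` so as to stay in ℕ.
  slack : (V → Fin p) → V → ℕ
  slack c v = ∑ (f v) ∸ f v (c v)

  Φ : (V → Fin p) → ℕ
  Φ c = # (Mono? c) + ∑ (slack c)

  mono-at : ∀ c v → # (λ e → Mono? c e ×-dec (v ∈? inc H e)) ≡ degIn c (c v) v
  mono-at c v = #-cong (λ e → Mono? c e ×-dec (v ∈? inc H e)) (Star? (class? c (c v)) v)
    (λ e (mono , v∈e) → v∈e , λ u u∈e _ → tt , mono u u∈e v v∈e)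
    (λ e (v∈e , s) → (λ u u∈e w w∈e → trans (same e s u u∈e) (sym (same e s w w∈e))) , v∈e)
    where
    same : ∀ e → (∀ u → u ∈ inc H e → u ≢ v → ⊤ × c u ≡ c v) → ∀ u → u ∈ inc H e → c u ≡ c v
    same e s u u∈e with u ≟F v
    ... | yes refl = refl
    ... | no u≢v = proj₂ (s u u∈e u≢v)

  module _ {c v} (good : Good H f c) (over : f v (c v) < degIn c (c v) v) where

    ∑degIn≤∑f : ∑ (λ i → degIn c i v) ≤ ∑ (f v)
    ∑degIn≤∑f = ≤-trans (∑-Star (λ _ → yes tt) c v)
      (≤-trans (#-mono (Star? (λ _ → yes tt) v) (λ e → v ∈? inc H e) (λ _ → proj₁)) (d≤f v))

    -- The counts over all colours add up to at most the sum of `f v`. One of them exceeds its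
    -- entry, so another falls short.
    room : ∃[ j ] degIn c j v < f v j
    room with any? (λ j → degIn c j v <? f v j)
    ... | yes r = r
    ... | no none = ⊥-elim (<⇒≱ (∑-mono-< (λ j → ≮⇒≥ (λ lt → none (j , lt))) (c v) over) ∑degIn≤∑f)

    j : Fin p
    j = proj₁ room

    c′ : V → Fin p
    c′ = upd c v j

    good′ : Good H f c′
    -- `v` is dropped from the domain first and then put back in colour `j` by `extend`.
    good′ = GoodOn-resp H f (λ u _ → (λ u≢v → u≢v) , refl) (extend D? (GoodOn-resp H f (λ u _ → tt , refl) good)
      (≤-<-trans (#-mono (Star? (Colour? D? c j) v) (Star? (class? c j) v) (Star-mono (λ _ _ (_ , eq) → tt , eq))) (proj₂ room)))
      where
      D? : Decidable (_≢ v)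
      D? u = ¬? (u ≟F v)

    rest≡ : # (λ e → Mono? c e ×-dec ¬? (v ∈? inc H e)) ≡ # (λ e → Mono? c′ e ×-dec ¬? (v ∈? inc H e))
    rest≡ = #-cong (λ e → Mono? c e ×-dec ¬? (v ∈? inc H e)) (λ e → Mono? c′ e ×-dec ¬? (v ∈? inc H e))
      (λ e (mono , v∉e) → (λ u u∈ w w∈ → trans (off v∉e u∈) (trans (mono u u∈ w w∈) (sym (off v∉e w∈)))) , v∉e)
      (λ e (mono , v∉e) → (λ u u∈ w w∈ → trans (sym (off v∉e u∈)) (trans (mono u u∈ w w∈) (off v∉e w∈))) , v∉e)
      where
      off : ∀ {e u} → v ∉ inc H e → u ∈ inc H e → c′ u ≡ c u
      off v∉e u∈e = upd-≢ c j (λ { refl → v∉e u∈e })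

    new≡ : degIn c′ (c′ v) v ≡ degIn c j v
    new≡ = #-cong (Star? (class? c′ (c′ v)) v) (Star? (class? c j) v)
      (Star-mono (λ u u≢v (_ , eq) → tt , trans (sym (upd-≢ c j u≢v)) (trans eq (upd-≡ c v j))))
      (Star-mono (λ u u≢v (_ , eq) → tt , trans (upd-≢ c j u≢v) (trans eq (sym (upd-≡ c v j)))))

    -- The vertex leaves a class where it has more than f v (c v) edges for one where it has
    -- fewer than f v j, so edges plus slack at v drop from above ∑ (f v) to below it.
    decrease : Φ c′ < Φ c
    decrease = +-cancelʳ-< (slack c v + slack c′ v) _ _ (begin-strict
      Φ c′ + (slack c v + slack c′ v)  ≡⟨ cong (_+ (slack c v + slack c′ v)) (cong (_+ ∑ (slack c′)) (trans (#-split (Mono? c′) (λ e → v ∈? inc H e)) (cong₂ _+_ (trans (mono-at c′ v) new≡) (sym rest≡)))) ⟩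
      (a′ + r + ∑ (slack c′)) + (slack c v + slack c′ v)  ≡⟨ shuffle a′ r (∑ (slack c′)) (slack c v) (slack c′ v) ⟩
      (a′ + slack c′ v) + (r + (∑ (slack c′) + slack c v))  <⟨ +-monoˡ-< _ (<-trans low high) ⟩
      (a + slack c v) + (r + (∑ (slack c′) + slack c v))  ≡⟨ cong (λ x → (a + slack c v) + (r + x)) (∑-update v same) ⟩
      (a + slack c v) + (r + (∑ (slack c) + slack c′ v))  ≡⟨ sym (shuffle a r (∑ (slack c)) (slack c′ v) (slack c v)) ⟩
      (a + r + ∑ (slack c)) + (slack c′ v + slack c v)  ≡⟨ cong₂ _+_ (cong (_+ ∑ (slack c)) (sym (trans (#-split (Mono? c) (λ e → v ∈? inc H e)) (cong (_+ r) (mono-at c v))))) (+-comm (slack c′ v) (slack c v)) ⟩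
      Φ c + (slack c v + slack c′ v)  ∎)
      where
      open ≤-Reasoning
      a a′ r : ℕ
      a = degIn c (c v) v
      a′ = degIn c j v
      r = # (λ e → Mono? c e ×-dec ¬? (v ∈? inc H e))
      shuffle : ∀ a r s x y → (a + r + s) + (x + y) ≡ (a + y) + (r + (s + x))
      shuffle = solve 5 (λ a r s x y → (a :+ r :+ s) :+ (x :+ y) := (a :+ y) :+ (r :+ (s :+ x))) refl
        where open +-*-Solver
      low : a′ + slack c′ v < ∑ (f v)
      low = subst (λ i → a′ + (∑ (f v) ∸ f v i) < ∑ (f v)) (sym (upd-≡ c v j))
        (<-≤-trans (+-monoˡ-< _ (proj₂ room)) (≤-reflexive (m+[n∸m]≡n (≤-∑ (f v) j))))
      high : ∑ (f v) < a + slack c v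
      high = ≤-<-trans (≤-reflexive (sym (m+[n∸m]≡n (≤-∑ (f v) (c v))))) (+-monoˡ-< _ over)
      same : ∀ u → u ≢ v → slack c′ u ≡ slack c u
      same u u≢v = cong (λ i → ∑ (f u) ∸ f u i) (upd-≢ c j u≢v)

  refine : ∀ k c → Φ c ≤ k → Good H f c → ∃[ c ] (Good H f c × (∀ v → degIn c (c v) v ≤ f v (c v)))
  refine k c Φ≤k good with any? (λ v → f v (c v) <? degIn c (c v) v)
  ... | no none = c , good , λ v → ≮⇒≥ (λ lt → none (v , lt))
  refine zero c Φ≤k good | yes (v , over) = ⊥-elim (<⇒≱ (decrease good over) (≤-trans Φ≤k z≤n))
  refine (suc k) c Φ≤k good | yes (v , over) = refine k (c′ good over) (≤-pred (≤-trans (decrease good over) Φ≤k)) (good′ good over)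

  partition : ∀ {c} → Good H f c → (∀ v → degIn c (c v) v ≤ f v (c v)) →
    ∃[ P ] (IsFPartition H f P × (∀ i v → v ∈ P i → deg H (inducedEdges H (P i)) v ≤ f v i))
  partition {c} good fine = P , ((disjoint , λ v → c v , ∈⟪⟫⁺ (P? (c v)) refl) , degenerate) , bounded
    where
    P? : ∀ i → Decidable (λ v → c v ≡ i)
    P? i v = c v ≟F i
    P : Fin p → Subset (nV H)
    P i = ⟪ P? i ⟫
    disjoint : ∀ i j → i ≢ j → Empty (P i ∩ P j)
    disjoint i j i≢j (v , v∈) with x∈p∩q⁻ (P i) (P j) v∈
    ... | v∈i , v∈j = i≢j (trans (sym (∈⟪⟫⁻ (P? i) v∈i)) (∈⟪⟫⁻ (P? j) v∈j))
    degenerate : ∀ i → StrictlyDegenerate H (P i) (λ v → f v i)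
    degenerate i Y F Y⊆P ne F⊆ with good Y i ne (λ v v∈ → tt , ∈⟪⟫⁻ (P? i) (Y⊆P v∈))
    ... | v , v∈ , lt = v , v∈ , ≤-<-trans (≤-trans (≤-reflexive (deg≡# H F v))
      (#-mono (λ e → (v ∈? inc H e) ×-dec (e ∈? F)) (λ e → (v ∈? inc H e) ×-dec (inc H e ⊆? Y)) (λ e (v∈e , e∈F) → v∈e , λ {x} → F⊆ e e∈F {x}))) lt
    bounded : ∀ i v → v ∈ P i → deg H (inducedEdges H (P i)) v ≤ f v i
    bounded i v v∈ with ∈⟪⟫⁻ (P? i) v∈
    ... | refl = ≤-trans (≤-reflexive (deg-induced H (P i) v)) (≤-trans
      (#-mono (λ e → (v ∈? inc H e) ×-dec (inc H e ⊆? P i)) (Star? (class? c (c v)) v) (λ e (v∈e , sub) → v∈e , λ u u∈e _ → tt , ∈⟪⟫⁻ (P? i) (sub u∈e)))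
      (fine v))

fpartition⇒good : ∀ (H : PreHypergraph) {p} (f : VecFun H p) {P} → IsFPartition H f P → Partitionable H f
fpartition⇒good H f {P} ((_ , cover) , degenerate) = (λ v → proj₁ (cover v)) , good
  where
  good : Good H f (λ v → proj₁ (cover v))
  good Y i ne mono with degenerate i Y (inducedEdges H Y) sub ne (λ e e∈ {x} → ∈⟪⟫⁻ (λ e → inc H e ⊆? Y) e∈ {x})
    where
    sub : Y ⊆ P i
    sub {v} v∈ = subst (λ j → v ∈ P j) (proj₂ (mono v v∈)) (proj₂ (cover v))
  ... | v , v∈ , lt = v , v∈ , subst (_< f v i) (deg-induced H Y v) lt

theorem1 : (H : PreHypergraph) → IsHypergraph H → Connected H →
    (p : ℕ) → 1 ≤ p → (f : VecFun H p) →
    (∀ v → degH H v ≤ sum (tabulate (f v))) →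
    (∃[ P ] (IsFPartition H f P ×
    (∀ i v → v ∈ P i → deg H (inducedEdges H (P i)) v ≤ f v i)))
    ⇔ (¬ HardPair H f)
theorem1 H hyp conn p 1≤p f deg≤ = mk⇔
  (λ (P , fpart , _) hard → hard-unpart hard (fpartition⇒good H f fpart))
  (λ ¬hard → build ¬hard (partitionable? H f))
  where
  d≤f : ∀ v → # (λ e → v ∈? inc H e) ≤ ∑ (f v)
  d≤f v = subst₂ _≤_ (degH≡# H v) (sum-tabulate (f v)) (deg≤ v)
  open Refine H (IsHypergraph⇒HasOther H hyp) f d≤f
  build : ¬ HardPair H f → Dec (Partitionable H f) → _
  build ¬hard (no unpart) = ⊥-elim (unpart-hard (nV H) ≤-refl hyp conn 1≤p d≤f unpart ¬hard)
  build ¬hard (yes (c , good)) = let c , good , fine = refine (Φ c) c ≤-refl good in partition good fine
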